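{- Let $N_1(B)$ denote the number of triples $(x,y,z)$ of positive integers with $\gcd(x,y,z)=1$, $x+y=z$, $x,y,z\leq B$ and $x,y,z$ all squareful. Then $$ N_1(B)=O\left(B^{3/5}(\log B)^{12}\right), $$ i.e. there is an absolute constant $K>0$ such that $N_1(B)\leq K B^{3/5}(\log B)^{12}$ for all $B\geq 2$.
   Context: An integer $k$ is squareful (i.e. $2$-powerful) if $p^2\mid k$ whenever $p$ is a prime divisor of $k$ (so $1$ is squareful). -}

module Defs where

open import Data.Nat as ℕ using (ℕ; zero; suc)
import Data.Nat.Properties as ℕ
open import Data.Nat.Divisibility using (_∣_)
open import Data.Nat.GCD using (gcd)
open import Data.Nat.Primality using (Prime)
import Data.Integer as ℤ
import Data.Integer.Properties as ℤ
open import Data.Bool using (if_then_else_)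
open import Data.List using (List; length)
open import Data.List.Membership.Propositional using (_∈_)
open import Data.List.Relation.Unary.Unique.Propositional using (Unique)
open import Data.Product using (∃; _×_; _,_; proj₁; proj₂)
open import Data.Rational
open import Data.Rational.Properties
import Data.Rational.Unnormalised as ℚᵘ
import Data.Rational.Unnormalised.Properties as ℚᵘ
open import Data.Rational.Solver using (module +-*-Solver)
open import Data.Sum using (inj₁; inj₂; [_,_]′)
open import Function using (_$_)
open import Function.Bundles using (_⇔_)
open import Relation.Nullary using (Dec; does; yes; no; ¬_; contradiction)
open import Relation.Nullary.Decidable using (toWitness)
open import Relation.Binary.PropositionalEquality
open import Algebra.Definitions.RawSemiring +-*-rawSemiring using (_^_)

private
  variable
    a b c d p q r s ε : ℚ

-- Abstract because with-abstraction over an unfolding proof of a rational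
-- inequality does not terminate in reasonable time.
abstract
  ≤-by : ∀ r → 0ℚ ≤ r → p + r ≡ q → p ≤ q
  ≤-by {p} r 0≤r eq = subst₂ _≤_ (+-identityʳ p) eq (+-monoʳ-≤ p 0≤r)

  *-monoˡ : 0ℚ ≤ r → p ≤ q → r * p ≤ r * q
  *-monoˡ {r} 0≤r = *-monoˡ-≤-nonNeg r {{nonNegative 0≤r}}

  *-monoʳ : 0ℚ ≤ r → p ≤ q → p * r ≤ q * r
  *-monoʳ {r} 0≤r = *-monoʳ-≤-nonNeg r {{nonNegative 0≤r}}

  *-mono : 0ℚ ≤ p → 0ℚ ≤ s → p ≤ q → r ≤ s → p * r ≤ q * s
  *-mono 0≤p 0≤s p≤q r≤s = ≤-trans (*-monoˡ 0≤p r≤s) (*-monoʳ 0≤s p≤q)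

  0≤* : 0ℚ ≤ p → 0ℚ ≤ q → 0ℚ ≤ p * q
  0≤* {p} {q} 0≤p 0≤q = subst (_≤ p * q) (*-zeroʳ p) (*-monoˡ 0≤p 0≤q)

  0≤+ : 0ℚ ≤ p → 0ℚ ≤ q → 0ℚ ≤ p + q
  0≤+ 0≤p 0≤q = +-mono-≤ 0≤p 0≤q

  0<+ : 0ℚ < p → 0ℚ < q → 0ℚ < p + q
  0<+ 0<p 0<q = +-mono-< 0<p 0<q

  0<* : 0ℚ < p → 0ℚ < q → 0ℚ < p * q
  0<* {p} {q} 0<p 0<q =
    positive⁻¹ (p * q) {{pos*pos⇒pos p {{positive 0<p}} q {{positive 0<q}}}}

  0≤1 : 0ℚ ≤ 1ℚ
  0≤1 = toWitness {a? = 0ℚ ≤? 1ℚ} _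

  0≤½ : 0ℚ ≤ ½
  0≤½ = toWitness {a? = 0ℚ ≤? ½} _

  0<½ : 0ℚ < ½
  0<½ = toWitness {a? = 0ℚ <? ½} _

  0<1 : 0ℚ < 1ℚ
  0<1 = toWitness {a? = 0ℚ <? 1ℚ} _

  ∣-∣⇒≤ : ∣ p - q ∣ ≤ ε → p ≤ q + ε
  ∣-∣⇒≤ {p} {q} {ε} h = begin
    p                ≡⟨ solve 2 (λ p q → p := q :+ (p :- q)) refl p q ⟩
    q + (p - q)      ≤⟨ +-monoʳ-≤ q (p≤∣p∣ (p - q)) ⟩
    q + ∣ p - q ∣    ≤⟨ +-monoʳ-≤ q h ⟩
    q + ε            ∎
    where
    open ≤-Reasoning
    open +-*-Solver
    p≤∣p∣ : ∀ p → p ≤ ∣ p ∣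
    p≤∣p∣ p with ≤-total 0ℚ p
    ... | inj₁ 0≤p = ≤-reflexive (sym (0≤p⇒∣p∣≡p 0≤p))
    ... | inj₂ p≤0 = ≤-trans p≤0 (0≤∣p∣ p)

  ≤⇒∣-∣ : p ≤ q + ε → q ≤ p + ε → ∣ p - q ∣ ≤ ε
  ≤⇒∣-∣ {p} {q} {ε} h₁ h₂ with ∣p∣≡p∨∣p∣≡-p (p - q)
  ... | inj₁ eq = subst (_≤ ε) (sym eq) $ subst (p - q ≤_)
    (solve 2 (λ q ε → (q :+ ε) :- q := ε) refl q ε) (+-monoˡ-≤ (- q) h₁)
    where open +-*-Solver
  ... | inj₂ eq = subst (_≤ ε) (sym eq) $ subst₂ _≤_
    (solve 2 (λ p q → q :- p := :- (p :- q)) refl p q)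
    (solve 2 (λ p ε → (p :+ ε) :- p := ε) refl p ε) (+-monoˡ-≤ (- p) h₂)
    where open +-*-Solver

  ⊔-≤+ : ∀ c q → 0ℚ ≤ ε → p ≤ q + ε → c ⊔ p ≤ (c ⊔ q) + ε
  ⊔-≤+ {ε} {p} c q 0≤ε h = ⊔-lub
    (≤-trans (p≤p⊔q c q) (≤-by ε 0≤ε refl))
    (≤-trans h (+-monoˡ-≤ ε (p≤q⊔p c q)))

fromℕℚ : ℕ → ℚ
fromℕℚ n = ℤ.+ n / 1

abstract
  toℚᵘ-fromℕℚ : ∀ n → toℚᵘ (fromℕℚ n) ℚᵘ.≃ ℚᵘ.mkℚᵘ (ℤ.+ n) 0
  toℚᵘ-fromℕℚ n = toℚᵘ-fromℚᵘ (ℚᵘ.mkℚᵘ (ℤ.+ n) 0)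

  fromℕℚ-suc : ∀ n → fromℕℚ (suc n) ≡ 1ℚ + fromℕℚ n
  fromℕℚ-suc n = toℚᵘ-injective (begin
    toℚᵘ (fromℕℚ (suc n))                ≈⟨ toℚᵘ-fromℕℚ (suc n) ⟩
    ℚᵘ.mkℚᵘ (ℤ.+ suc n) 0                ≈⟨ ℚᵘ.*≡* (cong (λ i → (ℤ.1ℤ ℤ.+ i) ℤ.* ℤ.1ℤ) (sym (ℤ.*-identityʳ (ℤ.+ n)))) ⟩
    ℚᵘ.1ℚᵘ ℚᵘ.+ ℚᵘ.mkℚᵘ (ℤ.+ n) 0        ≈⟨ ℚᵘ.+-congʳ ℚᵘ.1ℚᵘ (toℚᵘ-fromℕℚ n) ⟨
    ℚᵘ.1ℚᵘ ℚᵘ.+ toℚᵘ (fromℕℚ n)          ≈⟨ toℚᵘ-homo-+ 1ℚ (fromℕℚ n) ⟨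
    toℚᵘ (1ℚ + fromℕℚ n)                 ∎)
    where open import Relation.Binary.Reasoning.Setoid ℚᵘ.≃-setoid

  0≤fromℕℚ : ∀ n → 0ℚ ≤ fromℕℚ n
  0≤fromℕℚ zero    = ≤-refl
  0≤fromℕℚ (suc n) = subst (0ℚ ≤_) (sym (fromℕℚ-suc n)) (0≤+ 0≤1 (0≤fromℕℚ n))

  archimedean : ∀ p → ∃ λ n → p ≤ fromℕℚ n
  archimedean p@(mkℚ i d _) = ℤ.∣ i ∣ , toℚᵘ-cancel-≤
    (ℚᵘ.≤-respʳ-≃ (ℚᵘ.≃-sym (toℚᵘ-fromℕℚ ℤ.∣ i ∣)) (ℚᵘ.*≤* (i≤∣i∣*d i)))
    where
    i≤∣i∣*d : ∀ i → i ℤ.* ℤ.1ℤ ℤ.≤ ℤ.+ ℤ.∣ i ∣ ℤ.* ℤ.+ suc d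
    i≤∣i∣*d (ℤ.+ n) = subst₂ ℤ._≤_
      (ℤ.pos-* n 1) (ℤ.pos-* n (suc d))
      (ℤ.+≤+ (ℕ.*-monoʳ-≤ n (ℕ.s≤s ℕ.z≤n)))
    i≤∣i∣*d ℤ.-[1+ n ] = subst (ℤ.-[1+ n ] ℤ.* ℤ.1ℤ ℤ.≤_) (ℤ.pos-* (suc n) (suc d)) ℤ.-≤+

  divide : 0ℚ < c → 0ℚ < ε → ∃ λ δ → 0ℚ < δ × c * δ ≡ ε
  divide {c} {ε} 0<c 0<ε = i * ε , 0<* 0<i 0<ε , (begin
    c * (i * ε)   ≡⟨ *-assoc c i ε ⟨
    (c * i) * ε   ≡⟨ cong (_* ε) (*-inverseʳ c) ⟩
    1ℚ * ε        ≡⟨ *-identityˡ ε ⟩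
    ε             ∎)
    where
    open ≡-Reasoning
    instance
      c-pos : Positive c
      c-pos = positive 0<c
      c-nonZero : NonZero c
      c-nonZero = pos⇒nonZero c
    i : ℚ
    i = 1/ c
    0<i : 0ℚ < i
    0<i = positive⁻¹ i {{1/pos⇒pos c}}

abstract
  0≤^ : ∀ k → 0ℚ ≤ p → 0ℚ ≤ p ^ k
  0≤^ zero    0≤p = 0≤1
  0≤^ (suc k) 0≤p = 0≤* 0≤p (0≤^ k 0≤p)

  0<^ : ∀ k → 0ℚ < p → 0ℚ < p ^ k
  0<^ zero    0<p = 0<1
  0<^ (suc k) 0<p = 0<* 0<p (0<^ k 0<p)

  ^-mono : ∀ k → 0ℚ ≤ p → p ≤ q → p ^ k ≤ q ^ k
  ^-mono zero    0≤p p≤q = ≤-refl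
  ^-mono (suc k) 0≤p p≤q = *-mono 0≤p (0≤^ k (≤-trans 0≤p p≤q)) p≤q (^-mono k 0≤p p≤q)

  ^-cancel : ∀ k → 0ℚ ≤ q → p ^ k < q ^ k → p ≤ q
  ^-cancel {q} {p} k 0≤q h with ≤-total p q
  ... | inj₁ p≤q = p≤q
  ... | inj₂ q≤p = contradiction (<-≤-trans h (^-mono k 0≤q q≤p)) (<-irrefl refl)

  1≤^ : ∀ k → 1ℚ ≤ p → 1ℚ ≤ p ^ k
  1≤^ zero    1≤p = ≤-refl
  1≤^ (suc k) 1≤p = *-mono 0≤1 (≤-trans 0≤1 (1≤^ k 1≤p)) 1≤p (1≤^ k 1≤p)

  ^-superadditive : ∀ k → 0ℚ ≤ p → 0ℚ ≤ q → p ^ suc k + q ^ suc k ≤ (p + q) ^ suc k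
  ^-superadditive {p} {q} zero 0≤p 0≤q =
    ≤-reflexive (sym (*-distribʳ-+ 1ℚ p q))
  ^-superadditive {p} {q} (suc k) 0≤p 0≤q = ≤-trans
    (≤-by (p * q ^ suc k + q * p ^ suc k)
      (0≤+ (0≤* 0≤p (0≤^ (suc k) 0≤q)) (0≤* 0≤q (0≤^ (suc k) 0≤p)))
      (solve 4 (λ p q x y → (p :* x :+ q :* y) :+ (p :* y :+ q :* x) := (p :+ q) :* (x :+ y))
        refl p q (p ^ suc k) (q ^ suc k)))
    (*-monoˡ (0≤+ 0≤p 0≤q) (^-superadditive k 0≤p 0≤q))
    where open +-*-Solver

  ½^-anti : ∀ {m n} → m ℕ.≤ n → ½ ^ n ≤ ½ ^ m
  ½^-anti {n = zero}  ℕ.z≤n = ≤-refl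
  ½^-anti {n = suc n} ℕ.z≤n = *-mono 0≤½ 0≤1 (toWitness {a? = ½ ≤? 1ℚ} _) (½^-anti {n = n} ℕ.z≤n)
  ½^-anti (ℕ.s≤s h)         = *-monoˡ 0≤½ (½^-anti h)

  ½^-halves : ∀ n → ½ ^ suc n + ½ ^ suc n ≡ ½ ^ n
  ½^-halves n = trans (sym (*-distribʳ-+ (½ ^ n) ½ ½)) (*-identityˡ (½ ^ n))

  n*½^n≤1 : ∀ n → fromℕℚ n * ½ ^ n ≤ 1ℚ
  n*½^n≤1 zero    = 0≤1
  n*½^n≤1 (suc n) = begin
    fromℕℚ (suc n) * (½ * x)      ≡⟨ cong (_* (½ * x)) (fromℕℚ-suc n) ⟩
    (1ℚ + y) * (½ * x)            ≡⟨ solve 3 (λ h x y → (con 1ℚ :+ y) :* (h :* x) := h :* (x :+ y :* x)) refl ½ x y ⟩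
    ½ * (x + y * x)               ≤⟨ *-monoˡ 0≤½ (+-mono-≤ (½^-anti {n = n} ℕ.z≤n) (n*½^n≤1 n)) ⟩
    ½ * (1ℚ + 1ℚ)                 ≡⟨⟩
    1ℚ                            ∎
    where
    open ≤-Reasoning
    open +-*-Solver
    x y : ℚ
    x = ½ ^ n
    y = fromℕℚ n

  *½^n-small : ∀ c ε → 0ℚ < ε → ∃ λ N → ∀ n → N ℕ.≤ n → c * ½ ^ n ≤ ε
  *½^n-small c ε 0<ε with divide 0<ε 0<1
  ... | i , 0<i , εi≡1 with archimedean (c * i)
  ... | N , ci≤N = N , λ n N≤n → begin
    c * ½ ^ n                       ≡⟨ *-identityˡ (c * ½ ^ n) ⟨
    1ℚ * (c * ½ ^ n)                ≡⟨ cong (_* (c * ½ ^ n)) εi≡1 ⟨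
    (ε * i) * (c * ½ ^ n)           ≡⟨ solve 4 (λ e i c x → (e :* i) :* (c :* x) := e :* ((c :* i) :* x)) refl ε i c (½ ^ n) ⟩
    ε * ((c * i) * ½ ^ n)           ≤⟨ *-monoˡ (<⇒≤ 0<ε) (*-monoʳ (0≤^ n 0≤½) ci≤N) ⟩
    ε * (fromℕℚ N * ½ ^ n)          ≤⟨ *-monoˡ (<⇒≤ 0<ε) (*-monoˡ (0≤fromℕℚ N) (½^-anti N≤n)) ⟩
    ε * (fromℕℚ N * ½ ^ N)          ≤⟨ *-monoˡ (<⇒≤ 0<ε) (n*½^n≤1 N) ⟩
    ε * 1ℚ                          ≡⟨ *-identityʳ ε ⟩
    ε                               ∎
    where
    open ≤-Reasoning
    open +-*-Solver

Cauchy : (ℕ → ℚ) → Set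
Cauchy x = ∀ ε → 0ℚ < ε → ∃ λ N → ∀ m n → N ℕ.≤ m → N ℕ.≤ n → ∣ x m - x n ∣ ≤ ε

record ℝ : Set where
  constructor mkℝ
  field
    seq    : ℕ → ℚ
    cauchy : Cauchy seq

open ℝ

-- By the symmetry in m and n, one-sided estimates suffice.
Cauchy≤ : (ℕ → ℚ) → Set
Cauchy≤ x = ∀ ε → 0ℚ < ε → ∃ λ N → ∀ m n → N ℕ.≤ m → N ℕ.≤ n → x m ≤ x n + ε

abstract
  fromCauchy≤ : ∀ {x} → Cauchy≤ x → Cauchy x
  fromCauchy≤ h ε 0<ε with h ε 0<ε
  ... | N , est = N , λ m n N≤m N≤n → ≤⇒∣-∣ (est m n N≤m N≤n) (est n m N≤n N≤m)

  cauchy≤ : ∀ x → Cauchy≤ (seq x)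
  cauchy≤ x ε 0<ε with cauchy x ε 0<ε
  ... | N , est = N , λ m n N≤m N≤n → ∣-∣⇒≤ (est m n N≤m N≤n)

  bounded : ∀ x → ∃ λ D → 0ℚ < D × (∃ λ N → ∀ n → N ℕ.≤ n → ∣ seq x n ∣ ≤ D)
  bounded x with cauchy x 1ℚ 0<1
  ... | N , est = ∣ u ∣ + 1ℚ , +-mono-≤-< (0≤∣p∣ u) 0<1 , N , λ n N≤n → begin
    ∣ seq x n ∣                ≡⟨ cong ∣_∣ (solve 2 (λ u v → v := u :+ (v :- u)) refl u (seq x n)) ⟩
    ∣ u + (seq x n - u) ∣      ≤⟨ ∣p+q∣≤∣p∣+∣q∣ u (seq x n - u) ⟩
    ∣ u ∣ + ∣ seq x n - u ∣    ≤⟨ +-monoʳ-≤ ∣ u ∣ (est n N N≤n ℕ.≤-refl) ⟩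
    ∣ u ∣ + 1ℚ                 ∎
    where
    open ≤-Reasoning
    open +-*-Solver
    u : ℚ
    u = seq x N

infix  4 _≤ℝ_ _<ℝ_
infixl 7 _*ℝ_
infixr 8 _^ℝ_

_≤ℝ_ : ℝ → ℝ → Set
x ≤ℝ y = ∀ ε → 0ℚ < ε → ∃ λ N → ∀ n → N ℕ.≤ n → seq x n ≤ seq y n + ε

_<ℝ_ : ℝ → ℝ → Set
x <ℝ y = ∃ λ ε → 0ℚ < ε × (∃ λ N → ∀ n → N ℕ.≤ n → seq x n + ε ≤ seq y n)

fromℚ : ℚ → ℝ
fromℚ p = mkℝ (λ _ → p) λ ε 0<ε → 0 , λ _ _ _ _ →
  subst (_≤ ε) (sym (cong ∣_∣ (+-inverseʳ p))) (<⇒≤ 0<ε)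

fromℕ : ℕ → ℝ
fromℕ n = fromℚ (fromℕℚ n)

*-estimate : ∀ a b c d {D E δ} → 0ℚ ≤ δ → ∣ a ∣ ≤ D → ∣ d ∣ ≤ E →
  ∣ a - c ∣ ≤ δ → ∣ b - d ∣ ≤ δ → ∣ a * b - c * d ∣ ≤ (D + E) * δ
*-estimate a b c d {D} {E} {δ} 0≤δ a≤ d≤ a-c≤ b-d≤ = begin
  ∣ a * b - c * d ∣
    ≡⟨ cong ∣_∣ (solve 4 (λ a b c d → a :* b :- c :* d := a :* (b :- d) :+ d :* (a :- c)) refl a b c d) ⟩
  ∣ a * (b - d) + d * (a - c) ∣
    ≤⟨ ∣p+q∣≤∣p∣+∣q∣ (a * (b - d)) (d * (a - c)) ⟩
  ∣ a * (b - d) ∣ + ∣ d * (a - c) ∣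
    ≡⟨ cong₂ _+_ (∣p*q∣≡∣p∣*∣q∣ a (b - d)) (∣p*q∣≡∣p∣*∣q∣ d (a - c)) ⟩
  ∣ a ∣ * ∣ b - d ∣ + ∣ d ∣ * ∣ a - c ∣
    ≤⟨ +-mono-≤ (*-mono (0≤∣p∣ a) 0≤δ a≤ b-d≤) (*-mono (0≤∣p∣ d) 0≤δ d≤ a-c≤) ⟩
  D * δ + E * δ
    ≡⟨ *-distribʳ-+ δ D E ⟨
  (D + E) * δ ∎
  where
  open ≤-Reasoning
  open +-*-Solver

_*ℝ_ : ℝ → ℝ → ℝ
x *ℝ y = mkℝ (λ n → seq x n * seq y n) *-cauchy
  where
  *-cauchy : Cauchy (λ n → seq x n * seq y n)
  *-cauchy ε 0<ε with bounded x | bounded y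
  ... | D , 0<D , N₁ , bx | E , 0<E , N₂ , by
    with divide (0<+ 0<D 0<E) 0<ε
  ... | δ , 0<δ , eq with cauchy x δ 0<δ | cauchy y δ 0<δ
  ... | N₃ , cx | N₄ , cy = N₁₂ ℕ.⊔ N₃₄ , estimate
    where
    N₁₂ = N₁ ℕ.⊔ N₂
    N₃₄ = N₃ ℕ.⊔ N₄
    estimate : ∀ m n → N₁₂ ℕ.⊔ N₃₄ ℕ.≤ m → N₁₂ ℕ.⊔ N₃₄ ℕ.≤ n →
      ∣ seq x m * seq y m - seq x n * seq y n ∣ ≤ ε
    estimate m n N≤m N≤n = subst (_ ≤_) eq $
      *-estimate (seq x m) (seq y m) (seq x n) (seq y n) (<⇒≤ 0<δ)
        (bx m (ℕ.m⊔n≤o⇒m≤o N₁ N₂ N₁₂≤m)) (by n (ℕ.m⊔n≤o⇒n≤o N₁ N₂ N₁₂≤n))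
        (cx m n (ℕ.m⊔n≤o⇒m≤o N₃ N₄ N₃₄≤m) (ℕ.m⊔n≤o⇒m≤o N₃ N₄ N₃₄≤n))
        (cy m n (ℕ.m⊔n≤o⇒n≤o N₃ N₄ N₃₄≤m) (ℕ.m⊔n≤o⇒n≤o N₃ N₄ N₃₄≤n))
      where
      N₁₂≤m = ℕ.m⊔n≤o⇒m≤o N₁₂ N₃₄ N≤m
      N₁₂≤n = ℕ.m⊔n≤o⇒m≤o N₁₂ N₃₄ N≤n
      N₃₄≤m = ℕ.m⊔n≤o⇒n≤o N₁₂ N₃₄ N≤m
      N₃₄≤n = ℕ.m⊔n≤o⇒n≤o N₁₂ N₃₄ N≤n

_^ℝ_ : ℝ → ℕ → ℝ
x ^ℝ zero  = fromℕ 1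
x ^ℝ suc n = x *ℝ x ^ℝ n

maxℝ : ℚ → ℝ → ℝ
maxℝ c x = mkℝ (λ n → c ⊔ seq x n) (fromCauchy≤ max-cauchy)
  where
  max-cauchy : Cauchy≤ (λ n → c ⊔ seq x n)
  max-cauchy ε 0<ε with cauchy≤ x ε 0<ε
  ... | N , est = N , λ m n N≤m N≤n → ⊔-≤+ c (seq x n) (<⇒≤ 0<ε) (est m n N≤m N≤n)

-- Bisection of [0, 1 + q]: for q ≥ 0 and k ≥ 1 the k-th root of q lies in
-- the interval of length (1 + q) / 2ⁿ whose left endpoint is rootℚ k q n.
rootℚ : ℕ → ℚ → ℕ → ℚ
rootℚ k q zero    = 0ℚ
rootℚ k q (suc n) =
  let mid = rootℚ k q n + (1ℚ + q) * ½ ^ suc n in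
  if does (mid ^ k ≤? q) then mid else rootℚ k q n

if-elim : ∀ {A : Set} {p q : ℚ} (P : ℚ → Set) (A? : Dec A) →
  (A → P p) → (¬ A → P q) → P (if does A? then p else q)
if-elim P (yes a) f g = f a
if-elim P (no ¬a) f g = g ¬a

module _ (k : ℕ) {q : ℚ} (0≤q : 0ℚ ≤ q) where

  width : ℕ → ℚ
  width n = (1ℚ + q) * ½ ^ n

  RootBounds : ℕ → ℚ → Set
  RootBounds n r = 0ℚ ≤ r × r ^ suc k ≤ q × q < (r + width n) ^ suc k

  0≤width : ∀ n → 0ℚ ≤ width n
  0≤width n = 0≤* (0≤+ 0≤1 0≤q) (0≤^ n 0≤½)

  rootℚ-bounds : ∀ n → RootBounds n (rootℚ (suc k) q n)
  rootℚ-bounds zero = ≤-refl , subst (_≤ q) (sym (*-zeroˡ (0ℚ ^ k))) 0≤q , (begin-strict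
    q                              ≡⟨ +-identityˡ q ⟨
    0ℚ + q                         <⟨ +-monoˡ-< q 0<1 ⟩
    1ℚ + q                         ≡⟨ *-identityʳ (1ℚ + q) ⟨
    (1ℚ + q) * 1ℚ                  ≤⟨ *-monoˡ (0≤+ 0≤1 0≤q) (1≤^ k (≤-by q 0≤q refl)) ⟩
    (1ℚ + q) ^ suc k               ≡⟨ cong (_^ suc k) (trans (+-identityˡ ((1ℚ + q) * 1ℚ)) (*-identityʳ (1ℚ + q))) ⟨
    (0ℚ + width 0) ^ suc k         ∎)
    where open ≤-Reasoning
  rootℚ-bounds (suc n) with rootℚ-bounds n
  ... | 0≤r , rᵏ≤q , q<[r+w]ᵏ = if-elim (RootBounds (suc n)) (mid ^ suc k ≤? q)
    (λ mᵏ≤q → 0≤+ 0≤r (0≤width (suc n)) , mᵏ≤q , subst (λ t → q < t ^ suc k) eq q<[r+w]ᵏ)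
    (λ mᵏ≰q → 0≤r , rᵏ≤q , ≰⇒> mᵏ≰q)
    where
    r₀ = rootℚ (suc k) q n
    mid = r₀ + width (suc n)
    eq : r₀ + width n ≡ mid + width (suc n)
    eq = begin
      r₀ + (1ℚ + q) * ½ ^ n                       ≡⟨ cong (λ t → r₀ + (1ℚ + q) * t) (½^-halves n) ⟨
      r₀ + (1ℚ + q) * (½ ^ suc n + ½ ^ suc n)     ≡⟨ cong (r₀ +_) (*-distribˡ-+ (1ℚ + q) (½ ^ suc n) (½ ^ suc n)) ⟩
      r₀ + (width (suc n) + width (suc n))        ≡⟨ +-assoc r₀ (width (suc n)) (width (suc n)) ⟨
      mid + width (suc n)                         ∎
      where open ≡-Reasoning

-- The k-th root of max(x, 0).
root : ∀ k .{{_ : ℕ.NonZero k}} → ℝ → ℝ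
root (suc k) x = mkℝ (λ n → rootℚ (suc k) (seq x⁺ n) n) (fromCauchy≤ root-cauchy)
  where
  x⁺ = maxℝ 0ℚ x

  0≤x⁺ : ∀ n → 0ℚ ≤ seq x⁺ n
  0≤x⁺ n = p≤p⊔q 0ℚ (seq x n)

  root-cauchy : Cauchy≤ (λ n → rootℚ (suc k) (seq x⁺ n) n)
  root-cauchy ε 0<ε with bounded x⁺
  ... | D , 0<D , N₁ , bx
    with cauchy≤ x⁺ ((½ * ε) ^ suc k) (0<^ (suc k) (0<* 0<½ 0<ε))
       | *½^n-small (1ℚ + D) (½ * ε) (0<* 0<½ 0<ε)
  ... | N₂ , cx | N₃ , small = N₁ ℕ.⊔ (N₂ ℕ.⊔ N₃) , λ m n N≤m N≤n →
    let N₂₃≤m = ℕ.m⊔n≤o⇒n≤o N₁ (N₂ ℕ.⊔ N₃) N≤m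
        N₂₃≤n = ℕ.m⊔n≤o⇒n≤o N₁ (N₂ ℕ.⊔ N₃) N≤n
        p = seq x⁺ m ; q = seq x⁺ n
        r = rootℚ (suc k) p m ; s = rootℚ (suc k) q n ; w = width k (0≤x⁺ n) n
        0≤s , _ , q<[s+w]ᵏ = rootℚ-bounds k (0≤x⁺ n) n
        0≤r , rᵏ≤p , _ = rootℚ-bounds k (0≤x⁺ m) m
        p≤q+ = cx m n (ℕ.m⊔n≤o⇒m≤o N₂ N₃ N₂₃≤m) (ℕ.m⊔n≤o⇒m≤o N₂ N₃ N₂₃≤n)
        q≤D = subst (_≤ D) (0≤p⇒∣p∣≡p (0≤x⁺ n)) (bx n (ℕ.m⊔n≤o⇒m≤o N₁ (N₂ ℕ.⊔ N₃) N≤n))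
        w≤ = ≤-trans (*-monoʳ (0≤^ n 0≤½) (+-monoʳ-≤ 1ℚ q≤D)) (small n (ℕ.m⊔n≤o⇒n≤o N₂ N₃ N₂₃≤n))
        0≤s+w = 0≤+ 0≤s (0≤width k (0≤x⁺ n) n)
        rᵏ< = begin-strict
          r ^ suc k                              ≤⟨ rᵏ≤p ⟩
          p                                      ≤⟨ p≤q+ ⟩
          q + η ^ suc k                          <⟨ +-monoˡ-< (η ^ suc k) q<[s+w]ᵏ ⟩
          (s + w) ^ suc k + η ^ suc k            ≤⟨ ^-superadditive k 0≤s+w 0≤η ⟩
          (s + w + η) ^ suc k                    ∎
    in begin
    r              ≤⟨ ^-cancel (suc k) (0≤+ 0≤s+w 0≤η) rᵏ< ⟩
    s + w + η      ≤⟨ +-monoˡ-≤ η (+-monoʳ-≤ s w≤) ⟩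
    s + η + η      ≡⟨ +-assoc s η η ⟩
    s + (η + η)    ≡⟨ cong (s +_) (trans (sym (*-distribʳ-+ ε ½ ½)) (*-identityˡ ε)) ⟩
    s + ε          ∎
    where
    open ≤-Reasoning
    η = ½ * ε
    0≤η = <⇒≤ (0<* 0<½ 0<ε)

-- The lower Darboux sum of ∫ f(t) dt over [a, a + w] for decreasing f and
-- the subdivision into 2ⁿ equal parts.
lowerSum : (ℚ → ℚ) → ℚ → ℚ → ℕ → ℚ
lowerSum f a w zero    = w * f (a + w)
lowerSum f a w (suc n) = lowerSum f a (½ * w) n + lowerSum f (a + ½ * w) (½ * w) n

1⊔-positive : ∀ t → Positive (1ℚ ⊔ t)
1⊔-positive t = positive (<-≤-trans 0<1 (p≤p⊔q 1ℚ t))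

-- Equal to 1 / t for t ≥ 1.
recip : ℚ → ℚ
recip t = (1/ (1ℚ ⊔ t)) {{pos⇒nonZero (1ℚ ⊔ t) {{1⊔-positive t}}}}

-- log q as ∫ dt / t over [1, q], for q ≥ 1.
logℚ : ℚ → ℕ → ℚ
logℚ q = lowerSum recip 1ℚ (q - 1ℚ)

0≤recip : ∀ t → 0ℚ ≤ recip t
0≤recip t = <⇒≤ (positive⁻¹ (recip t) {{1/pos⇒pos (1ℚ ⊔ t) {{1⊔-positive t}}}})

recip-inverse : ∀ t → recip t * (1ℚ ⊔ t) ≡ 1ℚ
recip-inverse t = *-inverseˡ (1ℚ ⊔ t) {{pos⇒nonZero (1ℚ ⊔ t) {{1⊔-positive t}}}}

recip≤1 : ∀ t → recip t ≤ 1ℚ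
recip≤1 t = subst₂ _≤_ (*-identityʳ (recip t)) (recip-inverse t)
  (*-monoˡ (0≤recip t) (p≤p⊔q 1ℚ t))

recip-lipschitz : ∀ a b → 0ℚ ≤ ε → b ≤ a + ε → recip a ≤ recip b + ε
recip-lipschitz {ε} a b 0≤ε h = begin
  i                          ≡⟨ *-identityʳ i ⟨
  i * 1ℚ                     ≡⟨ cong (i *_) (recip-inverse b) ⟨
  i * (j * Y)                ≤⟨ *-monoˡ (0≤recip a) (*-monoˡ (0≤recip b) (⊔-≤+ 1ℚ a 0≤ε h)) ⟩
  i * (j * (X + ε))          ≡⟨ solve 4 (λ i j x e → i :* (j :* (x :+ e)) := j :* (i :* x) :+ (i :* j) :* e) refl i j X ε ⟩
  j * (i * X) + (i * j) * ε  ≤⟨ +-mono-≤ (≤-reflexive (cong (j *_) (recip-inverse a)))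
                                  (*-monoʳ 0≤ε (*-mono (0≤recip a) 0≤1 (recip≤1 a) (recip≤1 b))) ⟩
  j * 1ℚ + (1ℚ * 1ℚ) * ε     ≡⟨ cong₂ _+_ (*-identityʳ j) (*-identityˡ ε) ⟩
  j + ε                      ∎
  where
  open ≤-Reasoning
  open +-*-Solver
  X = 1ℚ ⊔ a
  Y = 1ℚ ⊔ b
  i = recip a
  j = recip b

recip-anti : ∀ a b → a ≤ b → recip b ≤ recip a
recip-anti a b a≤b = subst (recip b ≤_) (+-identityʳ (recip a))
  (recip-lipschitz b a ≤-refl (subst (a ≤_) (sym (+-identityʳ b)) a≤b))

L : ℚ → ℚ → ℕ → ℚ
L = lowerSum recip

½w+½w≡w : ∀ w → ½ * w + ½ * w ≡ w
½w+½w≡w w = trans (sym (*-distribʳ-+ w ½ ½)) (*-identityˡ w)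

a+½w+½w≡a+w : ∀ a w → a + ½ * w + ½ * w ≡ a + w
a+½w+½w≡a+w a w = trans (+-assoc a (½ * w) (½ * w)) (cong (a +_) (½w+½w≡w w))

module _ where
  open ≤-Reasoning
  open +-*-Solver

  L-upper : ∀ a w n → 0ℚ ≤ w → L a w n ≤ w * recip a
  L-upper a w zero    0≤w = *-monoˡ 0≤w (recip-anti a (a + w) (≤-by w 0≤w refl))
  L-upper a w (suc n) 0≤w = begin
    L a h n + L (a + h) h n          ≤⟨ +-mono-≤ (L-upper a h n 0≤h) (L-upper (a + h) h n 0≤h) ⟩
    h * recip a + h * recip (a + h)  ≤⟨ +-monoʳ-≤ (h * recip a) (*-monoˡ 0≤h (recip-anti a (a + h) (≤-by h 0≤h refl))) ⟩
    h * recip a + h * recip a        ≡⟨ *-distribʳ-+ (recip a) h h ⟨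
    (h + h) * recip a                ≡⟨ cong (_* recip a) (½w+½w≡w w) ⟩
    w * recip a                      ∎
    where
    h = ½ * w
    0≤h = 0≤* 0≤½ 0≤w

  L-lower : ∀ a w n → 0ℚ ≤ w → w * recip (a + w) ≤ L a w n
  L-lower a w zero    0≤w = ≤-refl
  L-lower a w (suc n) 0≤w = begin
    w * recip (a + w)                          ≡⟨ cong₂ (λ u v → u * recip v) (½w+½w≡w w) (a+½w+½w≡a+w a w) ⟨
    (h + h) * recip (a + h + h)                ≡⟨ *-distribʳ-+ (recip (a + h + h)) h h ⟩
    h * recip (a + h + h) + h * recip (a + h + h)
      ≤⟨ +-monoˡ-≤ (h * recip (a + h + h)) (*-monoˡ 0≤h (recip-anti (a + h) (a + h + h) (≤-by h 0≤h refl))) ⟩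
    h * recip (a + h) + h * recip (a + h + h)  ≤⟨ +-mono-≤ (L-lower a h n 0≤h) (L-lower (a + h) h n 0≤h) ⟩
    L a h n + L (a + h) h n                    ∎
    where
    h = ½ * w
    0≤h = 0≤* 0≤½ 0≤w

  L-mono : ∀ a w {m n} → 0ℚ ≤ w → m ℕ.≤ n → L a w m ≤ L a w n
  L-mono a w {n = n} 0≤w ℕ.z≤n = L-lower a w n 0≤w
  L-mono a w 0≤w (ℕ.s≤s m≤n) =
    +-mono-≤ (L-mono a (½ * w) 0≤h m≤n) (L-mono (a + ½ * w) (½ * w) 0≤h m≤n)
    where 0≤h = 0≤* 0≤½ 0≤w

  L-error : ∀ a w {m n} → 0ℚ ≤ w → m ℕ.≤ n →
    L a w n ≤ L a w m + w * ½ ^ m * (recip a - recip (a + w))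
  L-error a w {n = n} 0≤w ℕ.z≤n = begin
    L a w n                ≤⟨ L-upper a w n 0≤w ⟩
    w * recip a            ≡⟨ solve 3 (λ w x y → w :* x := w :* y :+ w :* con 1ℚ :* (x :- y)) refl w (recip a) (recip (a + w)) ⟩
    w * recip (a + w) + w * 1ℚ * (recip a - recip (a + w)) ∎
  L-error a w {suc m} {suc n} 0≤w (ℕ.s≤s m≤n) = begin
    L a h n + L (a + h) h n
      ≤⟨ +-mono-≤ (L-error a h 0≤h m≤n) (L-error (a + h) h 0≤h m≤n) ⟩
    (L a h m + h * ½ ^ m * (recip a - recip (a + h))) +
    (L (a + h) h m + h * ½ ^ m * (recip (a + h) - recip (a + h + h)))
      ≡⟨ solve 8 (λ e w x A B u v z →
           (A :+ e :* w :* x :* (u :- v)) :+ (B :+ e :* w :* x :* (v :- z))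
           := A :+ B :+ w :* (e :* x) :* (u :- z)) refl
           ½ w (½ ^ m) (L a h m) (L (a + h) h m) (recip a) (recip (a + h)) (recip (a + h + h)) ⟩
    L a h m + L (a + h) h m + w * (½ * ½ ^ m) * (recip a - recip (a + h + h))
      ≡⟨ cong (λ t → L a h m + L (a + h) h m + w * (½ * ½ ^ m) * (recip a - recip t)) (a+½w+½w≡a+w a w) ⟩
    L a h m + L (a + h) h m + w * (½ * ½ ^ m) * (recip a - recip (a + w)) ∎
    where
    h = ½ * w
    0≤h = 0≤* 0≤½ 0≤w

  L-near : ∀ a w m n → 0ℚ ≤ w → L a w m ≤ L a w n + w * ½ ^ n
  L-near a w m n 0≤w = [ near₁ , near₂ ]′ (ℕ.≤-total m n)
    where
    near₁ : m ℕ.≤ n → L a w m ≤ L a w n + w * ½ ^ n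
    near₁ m≤n = ≤-trans (L-mono a w 0≤w m≤n) (≤-by (w * ½ ^ n) (0≤* 0≤w (0≤^ n 0≤½)) refl)
    near₂ : n ℕ.≤ m → L a w m ≤ L a w n + w * ½ ^ n
    near₂ n≤m = ≤-trans (L-error a w 0≤w n≤m) $ +-monoʳ-≤ (L a w n) $
      subst (w * ½ ^ n * (recip a - recip (a + w)) ≤_) (*-identityʳ (w * ½ ^ n)) $
      *-monoˡ (0≤* 0≤w (0≤^ n 0≤½)) $ ≤-trans
        (≤-by (recip (a + w)) (0≤recip (a + w))
          (solve 2 (λ x y → (x :- y) :+ y := x) refl (recip a) (recip (a + w))))
        (recip≤1 a)

  -- Dependence on the upper limit, with [1 + σ d, 1 + (σ + ω) d] the part of
  -- [1, 1 + d] under consideration.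
  L-lipschitz : ∀ σ ω a a′ w w′ n {d d′ δ D} →
    0ℚ ≤ σ → 0ℚ ≤ ω → σ + ω ≤ 1ℚ → 0ℚ ≤ d → d ≤ D → 0ℚ ≤ δ → d ≤ d′ + δ → d′ ≤ d + δ →
    a ≡ 1ℚ + σ * d → a′ ≡ 1ℚ + σ * d′ → w ≡ ω * d → w′ ≡ ω * d′ →
    L a w n ≤ L a′ w′ n + ω * ((1ℚ + D) * δ)
  L-lipschitz σ ω _ _ _ _ zero {d} {d′} {δ} {D} 0≤σ 0≤ω σ+ω≤1 0≤d d≤D 0≤δ d≤ d′≤ refl refl refl refl = begin
    ω * d * i                                ≤⟨ *-monoˡ (0≤* 0≤ω 0≤d) (recip-lipschitz b₀ b′ 0≤δ b′≤b+δ) ⟩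
    ω * d * (j + δ)                          ≡⟨ solve 4 (λ o d j e → o :* d :* (j :+ e) := o :* (d :* j :+ d :* e)) refl ω d j δ ⟩
    ω * (d * j + d * δ)                      ≤⟨ *-monoˡ 0≤ω (+-mono-≤ (*-monoʳ (0≤recip b′) d≤) (*-monoʳ 0≤δ d≤D)) ⟩
    ω * ((d′ + δ) * j + D * δ)               ≡⟨ solve 5 (λ o d e j D → o :* ((d :+ e) :* j :+ D :* e) := o :* d :* j :+ o :* (e :* j :+ D :* e)) refl ω d′ δ j D ⟩
    ω * d′ * j + ω * (δ * j + D * δ)         ≤⟨ +-monoʳ-≤ (ω * d′ * j) (*-monoˡ 0≤ω (+-monoˡ-≤ (D * δ) (*-monoˡ 0≤δ (recip≤1 b′)))) ⟩
    ω * d′ * j + ω * (δ * 1ℚ + D * δ)        ≡⟨ solve 4 (λ y o e D → y :+ o :* (e :* con 1ℚ :+ D :* e) := y :+ o :* ((con 1ℚ :+ D) :* e)) refl (ω * d′ * j) ω δ D ⟩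
    ω * d′ * j + ω * ((1ℚ + D) * δ)          ∎
    where
    b₀ = 1ℚ + σ * d + ω * d
    b′ = 1ℚ + σ * d′ + ω * d′
    i = recip b₀
    j = recip b′
    b′≤b+δ : b′ ≤ b₀ + δ
    b′≤b+δ = begin
      1ℚ + σ * d′ + ω * d′           ≡⟨ solve 3 (λ s o d → con 1ℚ :+ s :* d :+ o :* d := con 1ℚ :+ (s :+ o) :* d) refl σ ω d′ ⟩
      1ℚ + (σ + ω) * d′              ≤⟨ +-monoʳ-≤ 1ℚ (*-monoˡ (0≤+ 0≤σ 0≤ω) d′≤) ⟩
      1ℚ + (σ + ω) * (d + δ)         ≡⟨ solve 4 (λ s o d e → con 1ℚ :+ (s :+ o) :* (d :+ e) := con 1ℚ :+ s :* d :+ o :* d :+ (s :+ o) :* e) refl σ ω d δ ⟩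
      b₀ + (σ + ω) * δ                ≤⟨ +-monoʳ-≤ b₀ (*-monoʳ 0≤δ σ+ω≤1) ⟩
      b₀ + 1ℚ * δ                     ≡⟨ cong (b₀ +_) (*-identityˡ δ) ⟩
      b₀ + δ                          ∎
  L-lipschitz σ ω a a′ w w′ (suc n) {d} {d′} {δ} {D} 0≤σ 0≤ω σ+ω≤1 0≤d d≤D 0≤δ d≤ d′≤ refl refl refl refl = begin
    L a h n + L (a + h) h n
      ≤⟨ +-mono-≤
           (L-lipschitz σ η a a′ h h′ n 0≤σ 0≤η
             (≤-trans (≤-by η 0≤η (a+½w+½w≡a+w σ ω)) σ+ω≤1)
             0≤d d≤D 0≤δ d≤ d′≤ refl refl (eqη d) (eqη d′))
           (L-lipschitz (σ + η) η (a + h) (a′ + h′) h h′ n (0≤+ 0≤σ 0≤η) 0≤η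
             (subst (_≤ 1ℚ) (sym (a+½w+½w≡a+w σ ω)) σ+ω≤1)
             0≤d d≤D 0≤δ d≤ d′≤ (eqσ d) (eqσ d′) (eqη d) (eqη d′)) ⟩
    (L a′ h′ n + η * K) + (L (a′ + h′) h′ n + η * K)
      ≡⟨ solve 4 (λ x y u k → (x :+ u :* k) :+ (y :+ u :* k) := x :+ y :+ (u :+ u) :* k) refl
           (L a′ h′ n) (L (a′ + h′) h′ n) η K ⟩
    L a′ h′ n + L (a′ + h′) h′ n + (η + η) * K
      ≡⟨ cong (λ t → L a′ h′ n + L (a′ + h′) h′ n + t * K) (½w+½w≡w ω) ⟩
    L a′ h′ n + L (a′ + h′) h′ n + ω * K ∎
    where
    h = ½ * w
    h′ = ½ * w′
    η = ½ * ω
    K = (1ℚ + D) * δ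
    0≤η = 0≤* 0≤½ 0≤ω
    eqη : ∀ d → ½ * (ω * d) ≡ η * d
    eqη d = sym (*-assoc ½ ω d)
    eqσ : ∀ d → 1ℚ + σ * d + ½ * (ω * d) ≡ 1ℚ + (σ + η) * d
    eqσ d = solve 4 (λ e s o d → con 1ℚ :+ s :* d :+ e :* (o :* d) := con 1ℚ :+ (s :+ e :* o) :* d) refl ½ σ ω d

-- The natural logarithm of max(x, 1).
log⁺ : ℝ → ℝ
log⁺ x = mkℝ (λ n → logℚ (seq x⁺ n) n) (fromCauchy≤ log-cauchy)
  where
  open ≤-Reasoning
  open +-*-Solver

  x⁺ = maxℝ 1ℚ x

  0≤x⁺-1 : ∀ n → 0ℚ ≤ seq x⁺ n - 1ℚ
  0≤x⁺-1 n = +-monoˡ-≤ (- 1ℚ) (p≤p⊔q 1ℚ (seq x n))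

  log-cauchy : Cauchy≤ (λ n → logℚ (seq x⁺ n) n)
  log-cauchy ε 0<ε with bounded x⁺
  ... | D , 0<D , N₁ , bx
    with divide (0<+ 0<1 0<D) (0<* 0<½ 0<ε) | *½^n-small D (½ * ε) (0<* 0<½ 0<ε)
  ... | δ , 0<δ , eq | N₃ , small with cauchy≤ x⁺ δ 0<δ
  ... | N₂ , cx = N₁ ℕ.⊔ (N₂ ℕ.⊔ N₃) , λ m n N≤m N≤n →
    let N₂₃≤m = ℕ.m⊔n≤o⇒n≤o N₁ (N₂ ℕ.⊔ N₃) N≤m
        N₂₃≤n = ℕ.m⊔n≤o⇒n≤o N₁ (N₂ ℕ.⊔ N₃) N≤n
        u = seq x⁺ m - 1ℚ ; v = seq x⁺ n - 1ℚ
        N₂≤m = ℕ.m⊔n≤o⇒m≤o N₂ N₃ N₂₃≤m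
        N₂≤n = ℕ.m⊔n≤o⇒m≤o N₂ N₃ N₂₃≤n
    in begin
    L 1ℚ u m
      ≤⟨ L-lipschitz 0ℚ 1ℚ 1ℚ 1ℚ u v m ≤-refl 0≤1 ≤-refl (0≤x⁺-1 m)
           (≤D m (ℕ.m⊔n≤o⇒m≤o N₁ (N₂ ℕ.⊔ N₃) N≤m) bx) (<⇒≤ 0<δ)
           (shift (seq x⁺ m) (seq x⁺ n) δ (cx m n N₂≤m N₂≤n)) (shift (seq x⁺ n) (seq x⁺ m) δ (cx n m N₂≤n N₂≤m))
           (1≡ u) (1≡ v) (sym (*-identityˡ u)) (sym (*-identityˡ v)) ⟩
    L 1ℚ v m + 1ℚ * ((1ℚ + D) * δ)
      ≡⟨ cong (L 1ℚ v m +_) (trans (*-identityˡ ((1ℚ + D) * δ)) eq) ⟩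
    L 1ℚ v m + ½ * ε
      ≤⟨ +-monoˡ-≤ (½ * ε) (L-near 1ℚ v m n (0≤x⁺-1 n)) ⟩
    L 1ℚ v n + v * ½ ^ n + ½ * ε
      ≤⟨ +-monoˡ-≤ (½ * ε) (+-monoʳ-≤ (L 1ℚ v n) (≤-trans
           (*-monoʳ (0≤^ n 0≤½) (≤D n (ℕ.m⊔n≤o⇒m≤o N₁ (N₂ ℕ.⊔ N₃) N≤n) bx))
           (small n (ℕ.m⊔n≤o⇒n≤o N₂ N₃ N₂₃≤n)))) ⟩
    L 1ℚ v n + ½ * ε + ½ * ε
      ≡⟨ a+½w+½w≡a+w (L 1ℚ v n) ε ⟩
    L 1ℚ v n + ε ∎
    where
    1≡ : ∀ u → 1ℚ ≡ 1ℚ + 0ℚ * u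
    1≡ u = sym (cong (1ℚ +_) (*-zeroˡ u))
    shift : ∀ p q r → p ≤ q + r → p - 1ℚ ≤ q - 1ℚ + r
    shift p q r h = subst (p - 1ℚ ≤_)
      (solve 3 (λ q r c → q :+ r :- c := q :- c :+ r) refl q r 1ℚ) (+-monoˡ-≤ (- 1ℚ) h)
    ≤D : ∀ n → N₁ ℕ.≤ n → (∀ n → N₁ ℕ.≤ n → ∣ seq x⁺ n ∣ ≤ D) → seq x⁺ n - 1ℚ ≤ D
    ≤D n N₁≤n bx = ≤-trans
      (≤-by {q = seq x⁺ n} 1ℚ 0≤1 (solve 2 (λ q c → q :- c :+ c := q) refl (seq x⁺ n) 1ℚ))
      (subst (_≤ D) (0≤p⇒∣p∣≡p (≤-trans 0≤1 (p≤p⊔q 1ℚ (seq x n)))) (bx n N₁≤n))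

Squareful : ℕ → Set
Squareful k = ∀ p → Prime p → p ∣ k → p ℕ.^ 2 ∣ k

record Admissible (B : ℝ) (x y z : ℕ) : Set where
  field
    x-positive  : 0 ℕ.< x
    y-positive  : 0 ℕ.< y
    z-positive  : 0 ℕ.< z
    coprime     : gcd (gcd x y) z ≡ 1
    sum         : x ℕ.+ y ≡ z
    x≤B         : fromℕ x ≤ℝ B
    y≤B         : fromℕ y ≤ℝ B
    z≤B         : fromℕ z ≤ℝ B
    x-squareful : Squareful x
    y-squareful : Squareful y
    z-squareful : Squareful z

HasCardinality : {A : Set} → (A → Set) → ℕ → Set
HasCardinality P n = ∃ λ xs → Unique xs × (∀ a → a ∈ xs ⇔ P a) × length xs ≡ n

-- N₁ B N means N₁(B) = N.  It is a relation because x ≤ B is not decidable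
-- for real B.
N₁ : ℝ → ℕ → Set
N₁ B = HasCardinality {ℕ × ℕ × ℕ} λ (x , y , z) → Admissible B x y z

{-# OPTIONS --safe #-}

-- A squareful number is a² b³, so a solution of x + y = z gives
-- b₀³ a₀² + b₁³ a₁² = b₂³ a₂², a conic in the a's for fixed b's and a cubic in the
-- b's for fixed a's.  If all terms are at most M and T = ⌊M^(3/5)⌋, then
-- X² Y³ = x y z ≤ M³ with X = a₀ a₁ a₂ and Y = b₀ b₁ b₂, so X ≤ T or Y ≤ T.
--
-- Say Y ≤ T (the other case is the same with the roles of 2 and 3 exchanged).
-- Modulo a prime divisor of one coefficient, the ratio of the two other unknowns is
-- one of at most three roots of unity up to a constant.  Three solutions which agree
-- in all these ratios have a determinant divisible (up to a factor n ∈ {2, 3}) by the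
-- product of the coefficients; it is nonzero because the curve is strictly convex in
-- the positive quadrant, and it is too small if the three solutions lie on a common one
-- of O(T / Y) arcs.  Hence the number of solutions is at most a constant times the
-- number of tuples consisting of factorisations bᵢ = dᵢ₀ dᵢ₁ dᵢ₂, recording the classes
-- of the ratios, and an arc index m ≤ T / Y.  These are 10-tuples of positive integers
-- with product at most T, of which there are O(T (log T)⁹).
module Submission where

open import Data.Nat as ℕ using (ℕ; zero; suc)
import Data.Nat.Properties as ℕ
import Data.Nat.Divisibility as ℕ
import Data.Nat.DivMod as ℕ
open import Data.Nat.Coprimality using (Coprime; coprime-Bézout; coprime-divisor)
open import Data.Nat.GCD using (gcd; gcd[m,n]∣m; gcd[m,n]∣n; gcd-greatest; c*gcd[m,n]≡gcd[cm,cn]; gcd[m,n]≡0⇒m≡0; module Bézout)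
open import Data.Nat.Induction using (Acc; acc; <-wellFounded)
open import Data.Nat.ListAction using (product)
open import Data.Nat.ListAction.Properties using (∈⇒∣product)
open import Data.Nat.Primality using (Prime; prime?; prime[2]; prime⇒irreducible; prime⇒nonTrivial; prime⇒nonZero; euclidsLemma)
open import Data.Nat.Primality.Factorisation using (factorise; factors; PrimeFactorisation; factorisationHasAllPrimeFactors)
import Data.Nat.Tactic.RingSolver as ℕSolver
import Data.Integer as ℤ
import Data.Integer.Properties as ℤ
open import Data.Integer.DivMod using (_%ℕ_; _/ℕ_; n%ℕd<d; a≡a%ℕn+[a/ℕn]*n)
open import Data.List using (List; []; _∷_; _++_; cartesianProduct; filter; length; map; upTo)
open import Data.List.Properties using (length-++; length-map)
open import Data.List.Membership.Propositional using (_∈_; lose)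
open import Data.List.Membership.Propositional.Properties using (∈-++⁺ˡ; ∈-++⁺ʳ; ∈-cartesianProduct⁺; ∈-filter⁺; ∈-filter⁻; ∈-map⁺; ∈-upTo⁺; ∈-upTo⁻)
open import Data.List.Relation.Unary.All as All using (All; []; _∷_)
import Data.List.Relation.Unary.All.Properties as All
open import Data.List.Relation.Unary.AllPairs using ([]; _∷_)
open import Data.List.Relation.Unary.Any using (Any; here; there)
open import Data.List.Relation.Unary.Unique.Propositional using (Unique)
import Data.List.Relation.Unary.Unique.Propositional.Properties as Unique
open import Data.Vec using (Vec; []; _∷_)
import Data.Vec.Properties as Vec
open import Data.Vec.Relation.Unary.All as VAll using ([]; _∷_)
open import Data.Product using (∃; ∃₂; _×_; _,_; proj₁; proj₂; swap)
import Data.Product.Properties as Product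
open import Data.Sum using (_⊎_; inj₁; inj₂)
open import Data.Empty using (⊥; ⊥-elim)
open import Function using (_$_; _∘_)
open import Function.Bundles using (Equivalence)
open import Relation.Binary.Definitions using (DecidableEquality; tri<; tri≈; tri>)
open import Relation.Binary.PropositionalEquality
open import Relation.Nullary using (¬_; ¬?; Dec; yes; no; contradiction)
open import Relation.Nullary.Decidable using (toWitness)
open import Defs using (ℝ; fromℕ; fromℚ; Squareful; _≤ℝ_; _<ℝ_; _*ℝ_; _^ℝ_; root; log⁺; N₁)

-- Write `k` for the number of arcs, `A` for the product of the three coefficients and `D` for the
-- determinant. Both exponents lead to `A |D|ⁿ k⁶ ≤ 8 M³`: on a conic the polar form is
-- quadratically small along an arc, so `D` gains `k³`; on a cubic it only gains `k²`; raising to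
-- the power `n` evens this out. Together with `|D| ≥ A / n`, three points would give
-- `(k Y)⁶ ≤ 216 M³`. So `k Y` need only exceed a multiple of `M^(1/2)`, and `k Y > 3 T` leaves
-- room. The delicate point is the passage from primes to prime powers: agreement of ratios modulo
-- each prime lifts to the whole coefficient only up to `n`, and at the prime 2, where the square
-- roots 1 and -1 of 1 coincide, residues modulo 4 have to be recorded as well. This costs a bounded
-- factor. The real number `B` enters only through an integer `M`, the largest of 2 and the
-- occurring `z`, so that nothing about `B` has to be decided. Ten factors give nine logarithms; the
-- exponent 12 is reached by weakening.

-- Roots of `β sⁿ + γ` modulo a prime, and the class of a ratio.

module LocalRoots where

  open import Data.Integer hiding (suc) renaming (∣_∣ to abs)
  open import Data.Integer.Properties
  open import Data.Integer.Divisibility.Signed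
  open import Data.Integer.Tactic.RingSolver using (solve-∀)

  -- A closed two-element type lets one argument serve conic and cubic, while each polynomial
  -- identity is still checked for a concrete degree.
  data Exponent : Set where
    two three : Exponent

  deg : Exponent → ℕ
  deg two   = 2
  deg three = 3

  -- (sⁿ - rⁿ) / (s - r)
  Q : Exponent → ℤ → ℤ → ℤ
  Q two   s r = s + r
  Q three s r = s * s + s * r + r * r

  pow-diff : ∀ n s r → s ^ deg n - r ^ deg n ≡ (s - r) * Q n s r
  pow-diff two   = identity
    where
    identity : ∀ s r → s * (s * 1ℤ) - r * (r * 1ℤ) ≡ (s - r) * (s + r)
    identity = solve-∀
  pow-diff three = identity
    where
    identity : ∀ s r → s * (s * (s * 1ℤ)) - r * (r * (r * 1ℤ)) ≡ (s - r) * (s * s + s * r + r * r)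
    identity = solve-∀

  ^-*-distrib : ∀ s r k → (s * r) ^ k ≡ s ^ k * r ^ k
  ^-*-distrib s r zero    = refl
  ^-*-distrib s r (suc k) = trans (cong (s * r *_) (^-*-distrib s r k)) (identity s r (s ^ k) (r ^ k))
    where
    identity : ∀ s r x y → s * r * (x * y) ≡ s * x * (r * y)
    identity = solve-∀

  module Ratio (p : ℕ) (n : Exponent) (β γ : ℤ) where

    isRoot : ℕ → Set
    isRoot s = + p ∣ β * (+ s) ^ deg n + γ

    root? : ∀ s → Dec (isRoot s)
    root? s = + p ∣? β * (+ s) ^ deg n + γ

    roots : List ℕ
    roots = filter root? (upTo p)

    Matches : ℕ → ℕ → ℕ → Set
    Matches u v r = + p ∣ + u - + r * + v

    match? : ∀ u v r → Dec (Matches u v r)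
    match? u v r = + p ∣? + u - + r * + v

    -- The position in the list is recorded instead of the root itself, so that only as many values
    -- occur as there are roots. Without a match the value is the length of the list.
    firstMatch : ℕ → ℕ → List ℕ → ℕ
    firstMatch u v [] = 0
    firstMatch u v (r ∷ R) with match? u v r
    ... | yes _ = 0
    ... | no  _ = suc (firstMatch u v R)

    firstMatch< : ∀ {u v R} → Any (Matches u v) R → firstMatch u v R ℕ.< length R
    firstMatch< {u} {v} {r ∷ R} h with match? u v r | h
    ... | yes _  | _       = ℕ.s≤s ℕ.z≤n
    ... | no ¬m  | here m  = contradiction m ¬m
    ... | no _   | there t = ℕ.s≤s (firstMatch< t)

    firstMatch-≡ : ∀ {u v u′ v′ R} → Any (Matches u v) R → Any (Matches u′ v′) R →
      firstMatch u v R ≡ firstMatch u′ v′ R → ∃ λ r → Matches u v r × Matches u′ v′ r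
    firstMatch-≡ {u} {v} {u′} {v′} {r ∷ R} h h′ eq with match? u v r | match? u′ v′ r | h | h′
    ... | yes m | yes m′ | _       | _        = r , m , m′
    ... | no ¬m | no _   | here m  | _        = contradiction m ¬m
    ... | no _  | no ¬m  | there _ | here m   = contradiction m ¬m
    ... | no _  | no _   | there t | there t′ = firstMatch-≡ t t′ (ℕ.suc-injective eq)
    ... | yes _ | no _   | _       | _        = contradiction eq λ ()
    ... | no _  | yes _  | _       | _        = contradiction eq λ ()

    -- The class of u / v modulo p among the roots of β sⁿ + γ.
    ratioClass : ℕ → ℕ → ℕ
    ratioClass u v = firstMatch u v roots

    record OnCurve (u v : ℕ) : Set where
      constructor onCurve
      field
        p∤v   : ¬ p ℕ.∣ v
        curve : + p ∣ β * (+ u) ^ deg n + γ * (+ v) ^ deg n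

  module _ {p : ℕ} (p-prime : Prime p) where

    private instance
      _ = ℕ.nonTrivial⇒nonZero p {{prime⇒nonTrivial p-prime}}

    euclid : ∀ a b → + p ∣ a * b → + p ∣ a ⊎ + p ∣ b
    euclid a b h with euclidsLemma (abs a) (abs b) p-prime (subst (p ℕ.∣_) (abs-* a b) (∣⇒∣ᵤ h))
    ... | inj₁ d = inj₁ (∣ᵤ⇒∣ d)
    ... | inj₂ d = inj₂ (∣ᵤ⇒∣ d)

    euclidʳ : ∀ {a b} → ¬ + p ∣ a → + p ∣ a * b → + p ∣ b
    euclidʳ {a} {b} p∤a h with euclid a b h
    ... | inj₁ d = contradiction d p∤a
    ... | inj₂ d = d

    euclidˡ : ∀ {a b} → ¬ + p ∣ b → + p ∣ a * b → + p ∣ a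
    euclidˡ {a} {b} p∤b h with euclid a b h
    ... | inj₁ d = d
    ... | inj₂ d = contradiction d p∤b

    ∣^⇒∣ : ∀ a k → + p ∣ a ^ k → + p ∣ a
    ∣^⇒∣ a zero    h = ∣-trans h (divides a (sym (*-identityʳ a)))
    ∣^⇒∣ a (suc k) h with euclid a (a ^ k) h
    ... | inj₁ d = d
    ... | inj₂ d = ∣^⇒∣ a k d

    -- The difference has absolute value at most `a ⊔ b`, which is less than `p`.
    residues-≡ : ∀ {a b} → a ℕ.< p → b ℕ.< p → + p ∣ + a - + b → a ≡ b
    residues-≡ {a} {b} a<p b<p h with abs (+ a - + b) in eq
    ... | zero  = +-injective (i-j≡0⇒i≡j (+ a) (+ b) (∣i∣≡0⇒i≡0 eq))
    ... | suc k = contradiction (∣⇒∣ᵤ h) (subst (λ t → ¬ p ℕ.∣ t) (sym eq) (ℕ.>⇒∤ (ℕ.≤-<-trans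
      (ℕ.≤-trans (ℕ.≤-reflexive (sym eq))
        (ℕ.≤-trans (ℕ.≤-reflexive (cong abs (m-n≡m⊖n a b))) (∣m⊝n∣≤m⊔n a b)))
      (ℕ.⊔-lub a<p b<p))))

    prime∤⇒coprime : ∀ {v} → ¬ p ℕ.∣ v → Coprime v p
    prime∤⇒coprime p∤v (d∣v , d∣p) with prime⇒irreducible p-prime d∣p
    ... | inj₁ d≡1  = d≡1
    ... | inj₂ refl = contradiction d∣v p∤v

    inverse : ∀ v → ¬ p ℕ.∣ v → ∃ λ w → + p ∣ 1ℤ - w * + v
    inverse v p∤v with coprime-Bézout (prime∤⇒coprime p∤v)
    ... | Bézout.+- x y eq = + x , divides (- + y) (begin
      1ℤ - + x * + v              ≡⟨ cong (λ t → 1ℤ - t) (pos-* x v) ⟨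
      1ℤ - + (x ℕ.* v)            ≡⟨ cong (λ t → 1ℤ - + t) eq ⟨
      1ℤ - (1ℤ + + (y ℕ.* p))     ≡⟨ cong (λ t → 1ℤ - (1ℤ + t)) (pos-* y p) ⟩
      1ℤ - (1ℤ + + y * + p)       ≡⟨ identity (+ y) (+ p) ⟩
      - + y * + p                 ∎)
      where
      open ≡-Reasoning
      identity : ∀ y p → 1ℤ - (1ℤ + y * p) ≡ - y * p
      identity = solve-∀
    ... | Bézout.-+ x y eq = - + x , divides (+ y) (begin
      1ℤ - - + x * + v            ≡⟨ identity (+ x) (+ v) ⟩
      1ℤ + + x * + v              ≡⟨ cong (λ t → 1ℤ + t) (pos-* x v) ⟨
      + (1 ℕ.+ x ℕ.* v)           ≡⟨ cong +_ eq ⟩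
      + (y ℕ.* p)                 ≡⟨ pos-* y p ⟩
      + y * + p                   ∎)
      where
      open ≡-Reasoning
      identity : ∀ x v → 1ℤ - - x * v ≡ 1ℤ + x * v
      identity = solve-∀

    quotient-residue : ∀ u v → ¬ p ℕ.∣ v → ∃ λ r → r ℕ.< p × + p ∣ u - + r * + v
    quotient-residue u v p∤v with inverse v p∤v
    ... | w , divides c 1-wv≡cp = (u * w) %ℕ p , n%ℕd<d (u * w) p , divides (u * c + q * + v) (begin
      u - r * + v                               ≡⟨ id₁ u w r (+ v) ⟩
      u * (1ℤ - w * + v) + (u * w - r) * + v    ≡⟨ cong₂ (λ s t → u * s + t * + v) 1-wv≡cp (trans (cong (λ t → t - r) (a≡a%ℕn+[a/ℕn]*n (u * w) p)) (id₂ r (q * + p))) ⟩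
      u * (c * + p) + q * + p * + v             ≡⟨ id₃ u c q (+ p) (+ v) ⟩
      (u * c + q * + v) * + p                   ∎)
      where
      open ≡-Reasoning
      r = + ((u * w) %ℕ p)
      q = (u * w) /ℕ p
      id₁ : ∀ u w r v → u - r * v ≡ u * (1ℤ - w * v) + (u * w - r) * v
      id₁ = solve-∀
      id₂ : ∀ r t → r + t - r ≡ t
      id₂ = solve-∀
      id₃ : ∀ u c q p v → u * (c * p) + q * p * v ≡ (u * c + q * v) * p
      id₃ = solve-∀

    module _ (n : Exponent) (β γ : ℤ) where

      open Ratio p n β γ

      module _ (p∤β : ¬ + p ∣ β) where

        Q-root : ∀ {s r} → s ≢ r → s ℕ.< p → r ℕ.< p → isRoot s → isRoot r → + p ∣ Q n (+ s) (+ r)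
        Q-root {s} {r} s≢r s<p r<p hs hr = euclidʳ (s≢r ∘ residues-≡ s<p r<p) $
          subst (+ p ∣_) (pow-diff n (+ s) (+ r)) $ euclidʳ p∤β $
          subst (+ p ∣_) (identity β γ ((+ s) ^ deg n) ((+ r) ^ deg n)) (∣m∣n⇒∣m-n hs hr)
          where
          identity : ∀ β γ x y → (β * x + γ) - (β * y + γ) ≡ β * (x - y)
          identity = solve-∀

        -- Divided differences: modulo `p`, `Q n a` vanishes at every other root, and a second
        -- difference gives `b - c` for squares and `(b - x) (a + b + x)` for cubes; in the latter
        -- case `x = c` and `x = d` leave `c - d`. The variable `n′` with `n′ ≡ n` permits a case
        -- split on the fixed parameter `n`.
        no-four-roots : ∀ n′ a b c d → n′ ≡ n → a ≢ b → a ≢ c → a ≢ d → b ≢ c → b ≢ d → c ≢ d →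
          a ℕ.< p → b ℕ.< p → c ℕ.< p → d ℕ.< p → isRoot a → isRoot b → isRoot c → ¬ isRoot d
        no-four-roots two a b c d refl a≢b a≢c a≢d b≢c b≢d c≢d a< b< c< d< ha hb hc hd =
          b≢c $ residues-≡ b< c< $ subst (+ p ∣_) (identity (+ a) (+ b) (+ c)) $
            ∣m∣n⇒∣m-n (Q-root a≢b a< b< ha hb) (Q-root a≢c a< c< ha hc)
          where
          identity : ∀ a b c → (a + b) - (a + c) ≡ b - c
          identity = solve-∀
        no-four-roots three a b c d refl a≢b a≢c a≢d b≢c b≢d c≢d a< b< c< d< ha hb hc hd =
          c≢d $ residues-≡ c< d< $ subst (+ p ∣_) (id₂ (+ a) (+ b) (+ c) (+ d)) $
            ∣m∣n⇒∣m-n (sum b≢c c< a≢c hc) (sum b≢d d< a≢d hd)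
          where
          id₁ : ∀ a b x → (a * a + a * b + b * b) - (a * a + a * x + x * x) ≡ (b - x) * (a + b + x)
          id₁ = solve-∀
          id₂ : ∀ a b c d → (a + b + c) - (a + b + d) ≡ c - d
          id₂ = solve-∀
          sum : ∀ {x} → b ≢ x → x ℕ.< p → a ≢ x → isRoot x → + p ∣ + a + + b + + x
          sum {x} b≢x x< a≢x hx = euclidʳ (b≢x ∘ residues-≡ b< x<) $
            subst (+ p ∣_) (id₁ (+ a) (+ b) (+ x)) $
            ∣m∣n⇒∣m-n (Q-root a≢b a< b< ha hb) (Q-root a≢x a< x< ha hx)

        length-roots≤3 : length roots ℕ.≤ 3
        length-roots≤3 = bound roots
          (Unique.filter⁺ root? (Unique.upTo⁺ p))
          (All.tabulate λ s∈ → let s∈upTo , root = ∈-filter⁻ root? {xs = upTo p} s∈ in ∈-upTo⁻ s∈upTo , root)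
          where
          bound : ∀ R → Unique R → All (λ s → s ℕ.< p × isRoot s) R → length R ℕ.≤ 3
          bound [] _ _ = ℕ.z≤n
          bound (_ ∷ []) _ _ = ℕ.s≤s ℕ.z≤n
          bound (_ ∷ _ ∷ []) _ _ = ℕ.s≤s (ℕ.s≤s ℕ.z≤n)
          bound (_ ∷ _ ∷ _ ∷ []) _ _ = ℕ.≤-refl
          bound (a ∷ b ∷ c ∷ d ∷ _)
            ((a≢b ∷ a≢c ∷ a≢d ∷ _) ∷ (b≢c ∷ b≢d ∷ _) ∷ (c≢d ∷ _) ∷ _)
            ((a< , ha) ∷ (b< , hb) ∷ (c< , hc) ∷ (d< , hd) ∷ _) =
            contradiction hd (no-four-roots n a b c d refl a≢b a≢c a≢d b≢c b≢d c≢d a< b< c< d< ha hb hc)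

      transfer : ∀ u v r → + p ∣ β * u ^ deg n + γ * v ^ deg n → + p ∣ u - r * v →
        + p ∣ (β * r ^ deg n + γ) * v ^ deg n
      transfer u v r h m = subst (+ p ∣_) (identity β γ (u ^ N) (v ^ N) (r ^ N))
        (∣m∣n⇒∣m-n h (∣n⇒∣m*n β diff))
        where
        N = deg n
        identity : ∀ β γ x y z → (β * x + γ * y) - β * (x - z * y) ≡ (β * z + γ) * y
        identity = solve-∀
        eq : (u - r * v) * Q n u (r * v) ≡ u ^ N - r ^ N * v ^ N
        eq = trans (sym (pow-diff n u (r * v))) (cong (λ t → u ^ N - t) (^-*-distrib r v N))
        diff : + p ∣ u ^ N - r ^ N * v ^ N
        diff = subst (+ p ∣_) eq (∣m⇒∣m*n (Q n u (r * v)) m)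

      matching-root : ∀ {u v r} → OnCurve u v → Matches u v r → isRoot r
      matching-root {u} {v} {r} (onCurve p∤v h) m =
        euclidˡ {β * (+ r) ^ deg n + γ} {(+ v) ^ deg n}
          (λ d → p∤v (∣⇒∣ᵤ {+ p} {+ v} (∣^⇒∣ (+ v) (deg n) d)))
          (transfer (+ u) (+ v) (+ r) h m)

      matches-root : ∀ {u v} → OnCurve u v → Any (Matches u v) roots
      matches-root {u} {v} c = let r , r<p , m = quotient-residue (+ u) v (OnCurve.p∤v c) in
        lose {P = Matches u v} {x = r}
        (∈-filter⁺ root? {xs = upTo p} (∈-upTo⁺ r<p) (matching-root {u} {v} {r} c m)) m

      ratioClass<3 : ∀ {u v} → ¬ + p ∣ β → OnCurve u v → ratioClass u v ℕ.< 3
      ratioClass<3 {u} {v} p∤β c = ℕ.<-≤-trans (firstMatch< {u} {v} {roots} (matches-root c)) (length-roots≤3 p∤β)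

      -- Equal positions in the same list yield one root `r` with `u ≡ r v` and `u′ ≡ r v′`;
      -- eliminating `r` leaves the minor.
      ratioClass-≡ : ∀ {u v u′ v′} → OnCurve u v → OnCurve u′ v′ →
        ratioClass u v ≡ ratioClass u′ v′ → + p ∣ + u * + v′ - + u′ * + v
      ratioClass-≡ {u} {v} {u′} {v′} c c′ eq =
        let r , m , m′ = firstMatch-≡ {u} {v} {u′} {v′} {roots} (matches-root c) (matches-root c′) eq in
        subst (+ p ∣_) (identity (+ u) (+ v) (+ u′) (+ v′) (+ r))
        (∣m∣n⇒∣m-n (∣m⇒∣m*n {m = + u - + r * + v} (+ v′) m) (∣m⇒∣m*n {m = + u′ - + r * + v′} (+ v) m′))
        where
        identity : ∀ u v u′ v′ r → (u - r * v) * v′ - (u′ - r * v′) * v ≡ u * v′ - u′ * v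
        identity = solve-∀

-- From agreement modulo primes to divisibility by the full coefficient.

module CommonClasses where

  open import Data.Integer hiding (suc) renaming (∣_∣ to abs)
  open import Data.Integer.Properties
  open import Data.Integer.Divisibility.Signed
  open import Data.Integer.Tactic.RingSolver using (solve-∀)
  open LocalRoots

  infix 4 _⟂_
  _⟂_ : ℕ → ℕ → Set
  a ⟂ b = ∀ p → Prime p → p ℕ.∣ a → p ℕ.∣ b → ⊥

  ⟂-sym : ∀ {a b} → a ⟂ b → b ⟂ a
  ⟂-sym h p pp p∣b p∣a = h p pp p∣a p∣b

  prime∣^⇒∣ : ∀ {p} a k → Prime p → p ℕ.∣ a ℕ.^ k → p ℕ.∣ a
  prime∣^⇒∣ a zero pp h = ℕ.∣-trans h (ℕ.1∣ a)
  prime∣^⇒∣ a (suc k) pp h with euclidsLemma a (a ℕ.^ k) pp h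
  ... | inj₁ d = d
  ... | inj₂ d = prime∣^⇒∣ a k pp d

  prime-divisor : ∀ g → g ≢ 0 → g ≢ 1 → ∃ λ p → Prime p × p ℕ.∣ g
  prime-divisor g g≢0 g≢1 = go (factorise g {{ℕ.≢-nonZero g≢0}})
    where
    go : PrimeFactorisation g → ∃ λ p → Prime p × p ℕ.∣ g
    go record { factors = [] ; isFactorisation = eq } = contradiction eq g≢1
    go record { factors = p ∷ ps ; isFactorisation = eq ; factorsPrime = pp ∷ _ } =
      p , pp , ℕ.divides (product ps) (trans eq (ℕ.*-comm p (product ps)))

  ⟂⇒coprime : ∀ {a b} → a ≢ 0 → a ⟂ b → Coprime a b
  ⟂⇒coprime a≢0 h {d} (d∣a , d∣b) with d ℕ.≟ 1
  ... | yes d≡1 = d≡1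
  ... | no  d≢1 with prime-divisor d (λ { refl → a≢0 (ℕ.0∣⇒≡0 d∣a) }) d≢1
  ... | p , pp , p∣d = ⊥-elim (h p pp (ℕ.∣-trans p∣d d∣a) (ℕ.∣-trans p∣d d∣b))

  ⟂-∣* : ∀ {a b c} → a ≢ 0 → a ⟂ b → a ℕ.∣ c → b ℕ.∣ c → a ℕ.* b ℕ.∣ c
  ⟂-∣* {a} {b} a≢0 a⟂b a∣c (ℕ.divides q refl) =
    ℕ.*-monoˡ-∣ b $
    coprime-divisor {a} {b} {q} (⟂⇒coprime a≢0 a⟂b) (subst (a ℕ.∣_) (ℕ.*-comm q b) a∣c)

  -- The prime factorisation of `g` consists of copies of `q`, and two copies are excluded.
  squarefree-part : ∀ {g} q → g ≢ 0 → (∀ p → Prime p → p ℕ.∣ g → p ≡ q) → ¬ q ℕ.* q ℕ.∣ g → g ℕ.∣ q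
  squarefree-part {g} q g≢0 only-q q²∤g = go (factorise g {{ℕ.≢-nonZero g≢0}})
    where
    go : PrimeFactorisation g → g ℕ.∣ q
    go record { factors = [] ; isFactorisation = eq } = subst (ℕ._∣ q) (sym eq) (ℕ.1∣ q)
    go record { factors = a ∷ [] ; isFactorisation = eq ; factorsPrime = pa ∷ _ } =
      ℕ.∣-reflexive (trans g≡a (only-q a pa (ℕ.∣-reflexive (sym g≡a))))
      where g≡a = trans eq (ℕ.*-identityʳ a)
    go record { factors = a ∷ b ∷ ps ; isFactorisation = eq ; factorsPrime = pa ∷ pb ∷ _ } =
      contradiction (subst₂ (λ x y → x ℕ.* y ℕ.∣ g) a≡q b≡q (ℕ.divides (product ps) g≡)) q²∤g
      where
      g≡ : g ≡ product ps ℕ.* (a ℕ.* b)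
      g≡ = trans eq (trans (sym (ℕ.*-assoc a b (product ps))) (ℕ.*-comm (a ℕ.* b) (product ps)))
      ab∣g = ℕ.divides (product ps) g≡
      a≡q = only-q a pa (ℕ.m*n∣⇒m∣ a b ab∣g)
      b≡q = only-q b pb (ℕ.m*n∣⇒n∣ a b ab∣g)

  -- `M` divides `x M` and `x y`, hence also `x gcd(M, y)`.
  ∣*-gcd : ∀ {M x y q} → M ℕ.∣ x ℕ.* y → gcd M y ℕ.∣ q → M ℕ.∣ q ℕ.* x
  ∣*-gcd {M} {x} {y} {q} M∣xy g∣q = ℕ.∣-trans M∣xg
    (subst (x ℕ.* gcd M y ℕ.∣_) (ℕ.*-comm x q) (ℕ.*-monoʳ-∣ x g∣q))
    where
    M∣xg : M ℕ.∣ x ℕ.* gcd M y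
    M∣xg = subst (M ℕ.∣_) (sym (c*gcd[m,n]≡gcd[cm,cn] x M y)) (gcd-greatest (ℕ.n∣m*n x) M∣xy)

  deg-prime : ∀ n → Prime (deg n)
  deg-prime two   = prime[2]
  deg-prime three = toWitness {a? = prime? 3} _

  -- Modulo s - r the factor Q is deg n times a product of s and r.
  Qˡ Qʳ : Exponent → ℤ → ℤ → ℤ
  Qˡ two   s r = - 1ℤ
  Qˡ three s r = s - r
  Qʳ two   s r = s
  Qʳ three s r = s * r

  Q-expand : ∀ n s r → Q n s r ≡ (s - r) * Qˡ n s r + + deg n * Qʳ n s r
  Q-expand two   = identity
    where
    identity : ∀ s r → s + r ≡ (s - r) * - 1ℤ + + 2 * s
    identity = solve-∀
  Q-expand three = identity
    where
    identity : ∀ s r → s * s + s * r + r * r ≡ (s - r) * (s - r) + + 3 * (s * r)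
    identity = solve-∀

  -- The hypothesis modulo 4 is for n = 2, where the roots of unity 1 and -1 coincide modulo 2.
  module _ (n : Exponent) {m M : ℕ} {s r : ℤ}
    (M≢0 : M ≢ 0) (rad : ∀ p → Prime p → p ℕ.∣ M → p ℕ.∣ m)
    (s≡r : ∀ p → Prime p → p ℕ.∣ m → + p ∣ s - r)
    (p∤s : ∀ p → Prime p → p ℕ.∣ m → ¬ + p ∣ s) (p∤r : ∀ p → Prime p → p ℕ.∣ m → ¬ + p ∣ r)
    (s≡r[4] : + 4 ∣ s - r) where

    private
      N = deg n
      g = gcd M (abs (Q n s r))

      g∣M : g ℕ.∣ M
      g∣M = gcd[m,n]∣m M (abs (Q n s r))

      p∤Qʳ : ∀ n p → Prime p → p ℕ.∣ m → ¬ + p ∣ Qʳ n s r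
      p∤Qʳ two   p pp p∣m = p∤s p pp p∣m
      p∤Qʳ three p pp p∣m p∣sr with euclid pp s r p∣sr
      ... | inj₁ d = p∤s p pp p∣m d
      ... | inj₂ d = p∤r p pp p∣m d

      ∣NQʳ : ∀ k → k ℕ.∣ g → + k ∣ (s - r) * Qˡ n s r → + k ∣ + N * Qʳ n s r
      ∣NQʳ k k∣g h = ∣m+n∣m⇒∣n (subst (+ k ∣_) (Q-expand n s r)
        (∣ᵤ⇒∣ {+ k} {Q n s r} (ℕ.∣-trans k∣g (gcd[m,n]∣n M (abs (Q n s r)))))) h

      only-N : ∀ p → Prime p → p ℕ.∣ g → p ≡ N
      only-N p pp p∣g with euclid pp (+ N) (Qʳ n s r) (∣NQʳ p p∣g (∣m⇒∣m*n (Qˡ n s r) (s≡r p pp p∣m)))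
        where p∣m = rad p pp (ℕ.∣-trans p∣g g∣M)
      ... | inj₂ d = contradiction d (p∤Qʳ n p pp (rad p pp (ℕ.∣-trans p∣g g∣M)))
      ... | inj₁ d with prime⇒irreducible (deg-prime n) (∣⇒∣ᵤ {+ p} {+ N} d)
      ... | inj₂ p≡N = p≡N
      ... | inj₁ refl = contradiction (prime⇒nonTrivial pp) λ ()

      N²∣ : ∀ n → + deg n ∣ s - r → + (deg n ℕ.* deg n) ∣ (s - r) * Qˡ n s r
      N²∣ two   _ = ∣m⇒∣m*n (- 1ℤ) s≡r[4]
      N²∣ three (divides q eq) = divides (q * q) (trans (cong (λ t → t * t) eq) (identity q))
        where
        identity : ∀ q → q * + 3 * (q * + 3) ≡ q * q * + 9
        identity = solve-∀

      N²∤g : ¬ N ℕ.* N ℕ.∣ g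
      N²∤g h = p∤Qʳ n N (deg-prime n) N∣m $ *-cancelˡ-∣ (+ N) {{N-nonZero n}} $
        subst (_∣ + N * Qʳ n s r) (pos-* N N) $ ∣NQʳ (N ℕ.* N) h (N²∣ n (s≡r N (deg-prime n) N∣m))
        where
        N∣m = rad N (deg-prime n) (ℕ.∣-trans (ℕ.m*n∣⇒m∣ N N h) g∣M)
        N-nonZero : ∀ n → NonZero (+ deg n)
        N-nonZero two   = _
        N-nonZero three = _

    -- In `sᴺ - rᴺ = (s - r) Q` the factor `Q` shares at most one prime `N` with `M`. A common prime
    -- divides `s - r`, hence `N Qʳ`, hence is `N`. If `N²` divided `Q`, then `N` would divide `Qʳ`,
    -- since `N²` divides `(s - r) Qˡ`: for `N = 3` this is the square of `s - r`, for `N = 2` it is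
    -- the assumption modulo 4.
    cofactor : + M ∣ s ^ N - r ^ N → + M ∣ + N * (s - r)
    cofactor h = ∣ᵤ⇒∣ {+ M} {+ N * (s - r)} $ subst (M ℕ.∣_) (sym (abs-* (+ N) (s - r))) $
      ∣*-gcd {M} {abs (s - r)} {abs (Q n s r)} {N}
        (subst (M ℕ.∣_) (abs-* (s - r) (Q n s r)) (∣⇒∣ᵤ (subst (+ M ∣_) (pow-diff n s r) h)))
        (squarefree-part N (λ g≡0 → M≢0 (gcd[m,n]≡0⇒m≡0 g≡0)) only-N N²∤g)

  module _ (c : ℕ → ℕ) where

    slot : ℕ → List ℕ → ℕ
    slot j ps = product (filter (λ p → c p ℕ.≟ j) ps)

    slots : List ℕ → ℕ × ℕ × ℕ
    slots ps = slot 0 ps , slot 1 ps , slot 2 ps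

    product-slots : ∀ {ps} → All (λ p → c p ℕ.< 3) ps → slot 0 ps ℕ.* slot 1 ps ℕ.* slot 2 ps ≡ product ps
    product-slots [] = refl
    product-slots {p ∷ ps} (h ∷ hs) with c p | product-slots hs
    ... | 0 | ih = trans (trans (cong (ℕ._* slot 2 ps) (ℕ.*-assoc p (slot 0 ps) (slot 1 ps)))
                     (ℕ.*-assoc p (slot 0 ps ℕ.* slot 1 ps) (slot 2 ps))) (cong (p ℕ.*_) ih)
    ... | 1 | ih = trans (cong (ℕ._* slot 2 ps) (trans (sym (ℕ.*-assoc (slot 0 ps) p (slot 1 ps)))
                     (trans (cong (ℕ._* slot 1 ps) (ℕ.*-comm (slot 0 ps) p)) (ℕ.*-assoc p (slot 0 ps) (slot 1 ps)))))
                     (trans (ℕ.*-assoc p (slot 0 ps ℕ.* slot 1 ps) (slot 2 ps)) (cong (p ℕ.*_) ih))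
    ... | 2 | ih = trans (sym (ℕ.*-assoc (slot 0 ps ℕ.* slot 1 ps) p (slot 2 ps)))
                     (trans (cong (ℕ._* slot 2 ps) (ℕ.*-comm (slot 0 ps ℕ.* slot 1 ps) p))
                     (trans (ℕ.*-assoc p (slot 0 ps ℕ.* slot 1 ps) (slot 2 ps)) (cong (p ℕ.*_) ih)))
    product-slots {p ∷ ps} (ℕ.s≤s (ℕ.s≤s (ℕ.s≤s ())) ∷ hs) | suc (suc (suc _)) | ih

  -- A prime divides the product of its own class, and by unique factorisation a prime divisor of a
  -- product of primes is one of the factors. So the three products remember the class of every
  -- prime.
  slots-injective : ∀ c c′ {ps} → All Prime ps → All (λ p → c p ℕ.< 3) ps → slots c ps ≡ slots c′ ps →
    ∀ {p} → p ∈ ps → c p ≡ c′ p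
  slots-injective c c′ {ps} primes c<3 eq {p} p∈ps =
    sym (proj₂ (∈-filter⁻ (λ q → c′ q ℕ.≟ c p) {xs = ps} p∈slot))
    where
    slot-eq : ∀ j → j ℕ.< 3 → slot c j ps ≡ slot c′ j ps
    slot-eq 0 _ = cong proj₁ eq
    slot-eq 1 _ = cong (proj₁ ∘ proj₂) eq
    slot-eq 2 _ = cong (proj₂ ∘ proj₂) eq
    slot-eq (suc (suc (suc _))) (ℕ.s≤s (ℕ.s≤s (ℕ.s≤s ())))
    p∣slot : p ℕ.∣ slot c′ (c p) ps
    p∣slot = subst (p ℕ.∣_) (slot-eq (c p) (All.lookup c<3 p∈ps))
      (∈⇒∣product (∈-filter⁺ (λ q → c q ℕ.≟ c p) p∈ps refl))
    p∈slot : p ∈ filter (λ q → c′ q ℕ.≟ c p) ps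
    p∈slot = factorisationHasAllPrimeFactors (All.lookup primes p∈ps) p∣slot
      (All.filter⁺ (λ q → c′ q ℕ.≟ c p) primes)

  primeFactors : ℕ → List ℕ
  primeFactors zero    = []
  primeFactors (suc m) = factors (factorise (suc m))

  primeFactors-prime : ∀ m → All Prime (primeFactors m)
  primeFactors-prime zero    = []
  primeFactors-prime (suc m) = PrimeFactorisation.factorsPrime (factorise (suc m))

  product-primeFactors : ∀ {m} → m ≢ 0 → product (primeFactors m) ≡ m
  product-primeFactors {zero}  m≢0 = contradiction refl m≢0
  product-primeFactors {suc m} _   = sym (PrimeFactorisation.isFactorisation (factorise (suc m)))

  ∈-primeFactors⁻ : ∀ {m p} → m ≢ 0 → p ∈ primeFactors m → p ℕ.∣ m
  ∈-primeFactors⁻ m≢0 p∈ = subst (_ ℕ.∣_) (product-primeFactors m≢0) (∈⇒∣product p∈)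

  ∈-primeFactors⁺ : ∀ {m p} → m ≢ 0 → Prime p → p ℕ.∣ m → p ∈ primeFactors m
  ∈-primeFactors⁺ {m} {p} m≢0 pp p∣m = factorisationHasAllPrimeFactors pp
    (subst (p ℕ.∣_) (sym (product-primeFactors m≢0)) p∣m) (primeFactors-prime m)

  -- The complement of `deg` to 5: squares of the unknowns come with cubes as coefficients, and
  -- conversely.
  cof : Exponent → ℕ
  cof two   = 3
  cof three = 2

  ratioSlots : Exponent → ℕ → (β γ : ℤ) → ℕ → ℕ → ℕ × ℕ × ℕ
  ratioSlots n m β γ u v = slots (λ p → Ratio.ratioClass p n β γ u v) (primeFactors m)

  module Modulus (n : Exponent) {m : ℕ} (m≢0 : m ≢ 0) (β γ : ℤ) where

    record Local (u v : ℕ) : Set where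
      constructor local
      field
        m⟂u   : m ⟂ u
        m⟂v   : m ⟂ v
        curve : + (m ℕ.^ cof n) ∣ β * (+ u) ^ deg n + γ * (+ v) ^ deg n

    private
      m∣mᵉ : ∀ n → m ℕ.∣ m ℕ.^ cof n
      m∣mᵉ two   = ℕ.m∣m*n _
      m∣mᵉ three = ℕ.m∣m*n _

      local⇒onCurve : ∀ {u v p} → Local u v → Prime p → p ℕ.∣ m → Ratio.OnCurve p n β γ u v
      local⇒onCurve {p = p} (local m⟂u m⟂v h) pp p∣m = Ratio.onCurve (m⟂v p pp p∣m)
        (∣-trans (∣ᵤ⇒∣ {+ p} {+ (m ℕ.^ cof n)} (ℕ.∣-trans p∣m (m∣mᵉ n))) h)

    module _ (m⟂β : m ⟂ abs β) where

      private
        p∤β : ∀ {p} → Prime p → p ℕ.∣ m → ¬ + p ∣ β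
        p∤β {p} pp p∣m d = m⟂β p pp p∣m (∣⇒∣ᵤ {+ p} {β} d)

        class<3 : ∀ {u v} → Local u v → All (λ p → Ratio.ratioClass p n β γ u v ℕ.< 3) (primeFactors m)
        class<3 {u} {v} l = All.tabulate λ {p} p∈ →
          let pp = All.lookup (primeFactors-prime m) p∈
              p∣m = ∈-primeFactors⁻ m≢0 p∈ in
          ratioClass<3 pp n β γ {u} {v} (p∤β pp p∣m) (local⇒onCurve l pp p∣m)

      product-ratioSlots : ∀ {u v} → Local u v →
        let d₀ , d₁ , d₂ = ratioSlots n m β γ u v in d₀ ℕ.* d₁ ℕ.* d₂ ≡ m
      product-ratioSlots {u} {v} l = trans
        (product-slots (λ p → Ratio.ratioClass p n β γ u v) (class<3 l)) (product-primeFactors m≢0)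

      minor-∣ : ∀ {u v u′ v′} → Local u v → Local u′ v′ → ratioSlots n m β γ u v ≡ ratioSlots n m β γ u′ v′ →
        + 4 ∣ + u * + v′ - + u′ * + v →
        + (m ℕ.^ cof n) ∣ + deg n * (+ u * + v′ - + u′ * + v)
      minor-∣ {u} {v} {u′} {v′} l l′ eq h4 = cofactor n {m} {M} {s} {r}
        (λ M≡0 → m≢0 (ℕ.m^n≡0⇒m≡0 m (cof n) M≡0)) (λ p pp → prime∣^⇒∣ m (cof n) pp)
        (λ p pp p∣m → ratioClass-≡ pp n β γ {u} {v} {u′} {v′} (local⇒onCurve l pp p∣m) (local⇒onCurve l′ pp p∣m)
          (slots-injective _ _ (primeFactors-prime m) (class<3 l) eq (∈-primeFactors⁺ m≢0 pp p∣m)))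
        (λ p pp p∣m → ∤* pp (Local.m⟂u l p pp p∣m) (Local.m⟂v l′ p pp p∣m))
        (λ p pp p∣m → ∤* pp (Local.m⟂u l′ p pp p∣m) (Local.m⟂v l p pp p∣m))
        h4 M∣sᴺ-rᴺ
        where
        M = m ℕ.^ cof n
        N = deg n
        s = + u * + v′
        r = + u′ * + v
        ∤* : ∀ {p a b} → Prime p → ¬ p ℕ.∣ a → ¬ p ℕ.∣ b → ¬ + p ∣ + a * + b
        ∤* {p} {a} {b} pp p∤a p∤b d with euclid pp (+ a) (+ b) d
        ... | inj₁ d = p∤a (∣⇒∣ᵤ {+ p} {+ a} d)
        ... | inj₂ d = p∤b (∣⇒∣ᵤ {+ p} {+ b} d)
        identity : ∀ β γ x y x′ y′ → (β * x + γ * y) * y′ - (β * x′ + γ * y′) * y ≡ β * (x * y′ - x′ * y)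
        identity = solve-∀
        M∣β* : + M ∣ β * (s ^ N - r ^ N)
        M∣β* = subst (λ t → + M ∣ β * t)
          (sym (cong₂ _-_ (^-*-distrib (+ u) (+ v′) N) (^-*-distrib (+ u′) (+ v) N))) $
          subst (+ M ∣_) (identity β γ ((+ u) ^ N) ((+ v) ^ N) ((+ u′) ^ N) ((+ v′) ^ N)) $
          ∣m∣n⇒∣m-n (∣m⇒∣m*n ((+ v′) ^ N) (Local.curve l)) (∣m⇒∣m*n ((+ v) ^ N) (Local.curve l′))
        M⟂β : M ⟂ abs β
        M⟂β p pp p∣M = m⟂β p pp (prime∣^⇒∣ m (cof n) pp p∣M)
        M∣sᴺ-rᴺ : + M ∣ s ^ N - r ^ N
        M∣sᴺ-rᴺ = ∣ᵤ⇒∣ {+ M} {s ^ N - r ^ N} $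
          coprime-divisor (⟂⇒coprime (λ M≡0 → m≢0 (ℕ.m^n≡0⇒m≡0 m (cof n) M≡0)) M⟂β) $
          subst (M ℕ.∣_) (abs-* β (s ^ N - r ^ N)) (∣⇒∣ᵤ {+ M} {β * (s ^ N - r ^ N)} M∣β*)

-- The determinant of three points: it is nonzero, and small for nearby points.

module Determinant where

  open import Data.Integer hiding (suc) renaming (∣_∣ to abs)
  open import Data.Integer.Properties
  open import Data.Integer.Tactic.RingSolver using (solve-∀)
  open LocalRoots using (Exponent; two; three; deg; Q; pow-diff)

  pos-^ : ∀ a k → + (a ℕ.^ k) ≡ (+ a) ^ k
  pos-^ a zero    = refl
  pos-^ a (suc k) = trans (pos-* a (a ℕ.^ k)) (cong (+ a *_) (pos-^ a k))

  pos-*^ : ∀ c a k → + (c ℕ.* a ℕ.^ k) ≡ + c * (+ a) ^ k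
  pos-*^ c a k = trans (pos-* c (a ℕ.^ k)) (cong (+ c *_) (pos-^ a k))

  ^-*-distribℕ : ∀ a b k → (a ℕ.* b) ℕ.^ k ≡ a ℕ.^ k ℕ.* b ℕ.^ k
  ^-*-distribℕ a b zero    = refl
  ^-*-distribℕ a b (suc k) = trans (cong (a ℕ.* b ℕ.*_) (^-*-distribℕ a b k)) (identity a b (a ℕ.^ k) (b ℕ.^ k))
    where
    identity : ∀ s r x y → s ℕ.* r ℕ.* (x ℕ.* y) ≡ s ℕ.* x ℕ.* (r ℕ.* y)
    identity = ℕSolver.solve-∀

  det : (u₁ v₁ w₁ u₂ v₂ w₂ u₃ v₃ w₃ : ℤ) → ℤ
  det u₁ v₁ w₁ u₂ v₂ w₂ u₃ v₃ w₃ =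
    u₁ * (v₂ * w₃ - v₃ * w₂) - v₁ * (u₂ * w₃ - u₃ * w₂) + w₁ * (u₂ * v₃ - u₃ * v₂)

  Qℕ : Exponent → ℕ → ℕ → ℕ
  Qℕ two   s r = s ℕ.+ r
  Qℕ three s r = s ℕ.* s ℕ.+ s ℕ.* r ℕ.+ r ℕ.* r

  pos-Q : ∀ n s r → + Qℕ n s r ≡ Q n (+ s) (+ r)
  pos-Q two   s r = refl
  pos-Q three s r = cong₂ _+_ (cong₂ _+_ (pos-* s s) (pos-* s r)) (pos-* r r)

  Qℕ-monoʳ-< : ∀ n s {r r′} → r ℕ.< r′ → Qℕ n s r ℕ.< Qℕ n s r′
  Qℕ-monoʳ-< two   s r<r′ = ℕ.+-monoʳ-< s r<r′
  Qℕ-monoʳ-< three s r<r′ = ℕ.+-mono-≤-<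
    (ℕ.+-monoʳ-≤ (s ℕ.* s) (ℕ.*-monoʳ-≤ s (ℕ.<⇒≤ r<r′))) (ℕ.*-mono-< r<r′ r<r′)

  Qℕ-pos : ∀ n s {r} → 0 ℕ.< r → 0 ℕ.< Qℕ n s r
  Qℕ-pos n s 0<r = ℕ.≤-<-trans ℕ.z≤n (Qℕ-monoʳ-< n s 0<r)

  ^-mono-<-deg : ∀ n {a b} → a ℕ.< b → a ℕ.^ deg n ℕ.< b ℕ.^ deg n
  ^-mono-<-deg two   = ℕ.^-monoˡ-< 2
  ^-mono-<-deg three = ℕ.^-monoˡ-< 3

  *-≢0 : ∀ {a b} → a ≢ 0ℤ → b ≢ 0ℤ → a * b ≢ 0ℤ
  *-≢0 {a} {b} a≢0 b≢0 ab≡0 with i*j≡0⇒i≡0∨j≡0 a ab≡0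
  ... | inj₁ a≡0 = a≢0 a≡0
  ... | inj₂ b≡0 = b≢0 b≡0

  pos≢0 : ∀ {a} → 0 ℕ.< a → + a ≢ 0ℤ
  pos≢0 0<a refl = ℕ.<-irrefl refl 0<a

  -- Three points of α sⁿ + β tⁿ = Γ in the positive quadrant are not collinear:
  -- the slope of the chord from (s₁, t₁) to (s, t) is - α Q(s₁, s) / (β Q(t₁, t)),
  -- and s ↦ Q(s₁, s) / Q(t₁, t) is strictly increasing along the curve.
  module _ (n : Exponent) {α β Γ : ℕ} (0<α : 0 ℕ.< α) (0<β : 0 ℕ.< β) {s₁ t₁ : ℕ}
    (eq₁ : α ℕ.* s₁ ℕ.^ deg n ℕ.+ β ℕ.* t₁ ℕ.^ deg n ≡ Γ) where

    private
      N = deg n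

      OnΓ : ℕ → ℕ → Set
      OnΓ s t = α ℕ.* s ℕ.^ N ℕ.+ β ℕ.* t ℕ.^ N ≡ Γ

      onΓ-ℤ : ∀ {s t} → OnΓ s t → + α * (+ s) ^ N + + β * (+ t) ^ N ≡ + Γ
      onΓ-ℤ {s} {t} eq = trans (sym (cong₂ _+_ (pos-*^ α s N) (pos-*^ β t N))) (cong +_ eq)

      chord : ∀ {s t} → OnΓ s t → + α * (+ s₁ - + s) * + Qℕ n s₁ s ≡ - (+ β * (+ t₁ - + t) * + Qℕ n t₁ t)
      chord {s} {t} eq = begin
        + α * (+ s₁ - + s) * + Qℕ n s₁ s         ≡⟨ *-assoc (+ α) (+ s₁ - + s) (+ Qℕ n s₁ s) ⟩
        + α * ((+ s₁ - + s) * + Qℕ n s₁ s)       ≡⟨ cong (+ α *_) (diff s₁ s) ⟩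
        + α * ((+ s₁) ^ N - (+ s) ^ N)           ≡⟨ id₁ (+ α) (+ β) ((+ s₁) ^ N) ((+ s) ^ N) ((+ t₁) ^ N) ((+ t) ^ N) ⟩
        (+ α * (+ s₁) ^ N + + β * (+ t₁) ^ N) - (+ α * (+ s) ^ N + + β * (+ t) ^ N) - + β * ((+ t₁) ^ N - (+ t) ^ N)
          ≡⟨ cong₂ (λ x y → x - y - + β * ((+ t₁) ^ N - (+ t) ^ N)) (onΓ-ℤ {s₁} {t₁} eq₁) (onΓ-ℤ {s} {t} eq) ⟩
        + Γ - + Γ - + β * ((+ t₁) ^ N - (+ t) ^ N)         ≡⟨ cong (λ x → + Γ - + Γ - + β * x) (diff t₁ t) ⟨
        + Γ - + Γ - + β * ((+ t₁ - + t) * + Qℕ n t₁ t)     ≡⟨ id₂ (+ Γ) (+ β) (+ t₁ - + t) (+ Qℕ n t₁ t) ⟩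
        - (+ β * (+ t₁ - + t) * + Qℕ n t₁ t)     ∎
        where
        open ≡-Reasoning
        diff : ∀ s r → (+ s - + r) * + Qℕ n s r ≡ (+ s) ^ N - (+ r) ^ N
        diff s r = trans (cong ((+ s - + r) *_) (pos-Q n s r)) (sym (pow-diff n (+ s) (+ r)))
        id₁ : ∀ α β x y z w → α * (x - y) ≡ (α * x + β * z) - (α * y + β * w) - β * (z - w)
        id₁ = solve-∀
        id₂ : ∀ Γ β x y → Γ - Γ - β * (x * y) ≡ - (β * x * y)
        id₂ = solve-∀

      decreasing : ∀ {s t s′ t′} → OnΓ s t → OnΓ s′ t′ → s ℕ.< s′ → t′ ℕ.< t
      decreasing {s} {t} {s′} {t′} eq eq′ s<s′ with t ℕ.≤? t′
      ... | no  t≰t′ = ℕ.≰⇒> t≰t′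
      ... | yes t≤t′ = contradiction (trans eq (sym eq′)) (ℕ.<⇒≢ (ℕ.+-mono-<-≤
        (ℕ.*-monoʳ-< α {{ℕ.>-nonZero 0<α}} (^-mono-<-deg n s<s′)) (ℕ.*-monoʳ-≤ β (ℕ.^-monoˡ-≤ N t≤t′))))

      not-collinear-< : ∀ {s₂ t₂ s₃ t₃} → OnΓ s₂ t₂ → OnΓ s₃ t₃ → 0 ℕ.< s₃ → 0 ℕ.< t₂ → s₁ ≢ s₂ → s₁ ≢ s₃ → s₂ ℕ.< s₃ →
        (+ s₁ - + s₂) * (+ t₁ - + t₃) ≢ (+ s₁ - + s₃) * (+ t₁ - + t₂)
      not-collinear-< {s₂} {t₂} {s₃} {t₃} eq₂ eq₃ 0<s₃ 0<t₂ s₁≢s₂ s₁≢s₃ s₂<s₃ ad≡bc =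
        ℕ.<⇒≢ A₂B₃<A₃B₂ (+-injective A₂B₃≡A₃B₂)
        where
        open ≡-Reasoning
        a = + s₁ - + s₂
        b = + s₁ - + s₃
        c = + t₁ - + t₂
        d = + t₁ - + t₃
        A₂ = Qℕ n s₁ s₂
        A₃ = Qℕ n s₁ s₃
        B₂ = Qℕ n t₁ t₂
        B₃ = Qℕ n t₁ t₃
        0<A₃ = Qℕ-pos n s₁ 0<s₃
        0<B₂ = Qℕ-pos n t₁ 0<t₂
        t₃<t₂ = decreasing {s₂} {t₂} {s₃} {t₃} eq₂ eq₃ s₂<s₃
        A₂<A₃ = Qℕ-monoʳ-< n s₁ s₂<s₃
        B₃<B₂ = Qℕ-monoʳ-< n t₁ t₃<t₂
        a≢0 : a ≢ 0ℤ
        a≢0 a≡0 = s₁≢s₂ (+-injective (i-j≡0⇒i≡j (+ s₁) (+ s₂) a≡0))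
        b≢0 : b ≢ 0ℤ
        b≢0 b≡0 = s₁≢s₃ (+-injective (i-j≡0⇒i≡j (+ s₁) (+ s₃) b≡0))
        id₀ : ∀ β x → - (β * 0ℤ * x) ≡ 0ℤ
        id₀ = solve-∀
        d≢0 : d ≢ 0ℤ
        d≢0 d≡0 = *-≢0 (*-≢0 (pos≢0 0<α) b≢0) (pos≢0 0<A₃)
          (trans (chord {s₃} {t₃} eq₃) (trans (cong (λ x → - (+ β * x * + B₃)) d≡0) (id₀ (+ β) (+ B₃))))
        id₁ : ∀ α β a d A B → α * β * (a * d) * (A * B) ≡ α * a * A * (β * d * B)
        id₁ = solve-∀
        id₂ : ∀ β c B X → - (β * c * B) * X ≡ β * c * B * - X
        id₂ = solve-∀
        id₃ : ∀ α β b c A B → β * c * B * (α * b * A) ≡ α * β * (b * c) * (A * B)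
        id₃ = solve-∀
        -- Multiplying the two chord relations crosswise compares the slopes without division; the
        -- nonzero factor `α β a d` is cancelled afterwards.
        cross : + α * + β * (a * d) * (+ A₂ * + B₃) ≡ + α * + β * (a * d) * (+ A₃ * + B₂)
        cross = begin
          + α * + β * (a * d) * (+ A₂ * + B₃)          ≡⟨ id₁ (+ α) (+ β) a d (+ A₂) (+ B₃) ⟩
          + α * a * + A₂ * (+ β * d * + B₃)            ≡⟨ cong (_* (+ β * d * + B₃)) (chord {s₂} {t₂} eq₂) ⟩
          - (+ β * c * + B₂) * (+ β * d * + B₃)        ≡⟨ id₂ (+ β) c (+ B₂) (+ β * d * + B₃) ⟩
          + β * c * + B₂ * - (+ β * d * + B₃)          ≡⟨ cong (+ β * c * + B₂ *_) (chord {s₃} {t₃} eq₃) ⟨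
          + β * c * + B₂ * (+ α * b * + A₃)            ≡⟨ id₃ (+ α) (+ β) b c (+ A₃) (+ B₂) ⟩
          + α * + β * (b * c) * (+ A₃ * + B₂)          ≡⟨ cong (λ x → + α * + β * x * (+ A₃ * + B₂)) ad≡bc ⟨
          + α * + β * (a * d) * (+ A₃ * + B₂)          ∎
        A₂B₃≡A₃B₂ : + (A₂ ℕ.* B₃) ≡ + (A₃ ℕ.* B₂)
        A₂B₃≡A₃B₂ = trans (pos-* A₂ B₃) (trans
          (*-cancelˡ-≡ (+ α * + β * (a * d)) (+ A₂ * + B₃) (+ A₃ * + B₂)
            {{≢-nonZero (*-≢0 (*-≢0 (pos≢0 0<α) (pos≢0 0<β)) (*-≢0 a≢0 d≢0))}} cross)
          (sym (pos-* A₃ B₂)))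
        A₂B₃<A₃B₂ : A₂ ℕ.* B₃ ℕ.< A₃ ℕ.* B₂
        A₂B₃<A₃B₂ = ℕ.≤-<-trans (ℕ.*-monoʳ-≤ A₂ (ℕ.<⇒≤ B₃<B₂)) (ℕ.*-monoˡ-< B₂ {{ℕ.>-nonZero 0<B₂}} A₂<A₃)

    not-collinear : ∀ {s₂ t₂ s₃ t₃} → OnΓ s₂ t₂ → OnΓ s₃ t₃ →
      0 ℕ.< s₂ → 0 ℕ.< t₂ → 0 ℕ.< s₃ → 0 ℕ.< t₃ → s₁ ≢ s₂ → s₁ ≢ s₃ → s₂ ≢ s₃ →
      (+ s₁ - + s₂) * (+ t₁ - + t₃) ≢ (+ s₁ - + s₃) * (+ t₁ - + t₂)
    not-collinear {s₂} {t₂} {s₃} {t₃} eq₂ eq₃ 0<s₂ 0<t₂ 0<s₃ 0<t₃ s₁≢s₂ s₁≢s₃ s₂≢s₃ h with ℕ.<-cmp s₂ s₃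
    ... | tri< s₂<s₃ _ _ = not-collinear-< {s₂} {t₂} {s₃} {t₃} eq₂ eq₃ 0<s₃ 0<t₂ s₁≢s₂ s₁≢s₃ s₂<s₃ h
    ... | tri≈ _ s₂≡s₃ _ = s₂≢s₃ s₂≡s₃
    ... | tri> _ _ s₃<s₂ = not-collinear-< {s₃} {t₃} {s₂} {t₂} eq₃ eq₂ 0<s₂ 0<t₃ s₁≢s₃ s₁≢s₂ s₃<s₂ (sym h)

  OnCurve₂ : Exponent → (α β γ u v w : ℕ) → Set
  OnCurve₂ n α β γ u v w = α ℕ.* u ℕ.^ deg n ℕ.+ β ℕ.* v ℕ.^ deg n ≡ γ ℕ.* w ℕ.^ deg n

  detℕ : (u₁ v₁ w₁ u₂ v₂ w₂ u₃ v₃ w₃ : ℕ) → ℤ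
  detℕ u₁ v₁ w₁ u₂ v₂ w₂ u₃ v₃ w₃ =
    det (+ u₁) (+ v₁) (+ w₁) (+ u₂) (+ v₂) (+ w₂) (+ u₃) (+ v₃) (+ w₃)

  minor : (u w u′ w′ : ℕ) → ℕ
  minor u w u′ w′ = abs (+ u * + w′ - + u′ * + w)

  scaled : ∀ n α β γ {u v w} c → OnCurve₂ n α β γ u v w →
    α ℕ.* (u ℕ.* c) ℕ.^ deg n ℕ.+ β ℕ.* (v ℕ.* c) ℕ.^ deg n ≡ γ ℕ.* (w ℕ.* c) ℕ.^ deg n
  scaled n α β γ {u} {v} {w} c eq = begin
    α ℕ.* (u ℕ.* c) ℕ.^ N ℕ.+ β ℕ.* (v ℕ.* c) ℕ.^ N
      ≡⟨ cong₂ (λ x y → α ℕ.* x ℕ.+ β ℕ.* y) (^-*-distribℕ u c N) (^-*-distribℕ v c N) ⟩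
    α ℕ.* (u ℕ.^ N ℕ.* c ℕ.^ N) ℕ.+ β ℕ.* (v ℕ.^ N ℕ.* c ℕ.^ N)
      ≡⟨ id₁ α β (u ℕ.^ N) (v ℕ.^ N) (c ℕ.^ N) ⟩
    (α ℕ.* u ℕ.^ N ℕ.+ β ℕ.* v ℕ.^ N) ℕ.* c ℕ.^ N          ≡⟨ cong (ℕ._* c ℕ.^ N) eq ⟩
    γ ℕ.* w ℕ.^ N ℕ.* c ℕ.^ N                              ≡⟨ ℕ.*-assoc γ (w ℕ.^ N) (c ℕ.^ N) ⟩
    γ ℕ.* (w ℕ.^ N ℕ.* c ℕ.^ N)                            ≡⟨ cong (γ ℕ.*_) (^-*-distribℕ w c N) ⟨
    γ ℕ.* (w ℕ.* c) ℕ.^ N                                  ∎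
    where
    open ≡-Reasoning
    N = deg n
    id₁ : ∀ α β x y z → α ℕ.* (x ℕ.* z) ℕ.+ β ℕ.* (y ℕ.* z) ≡ (α ℕ.* x ℕ.+ β ℕ.* y) ℕ.* z
    id₁ = ℕSolver.solve-∀

  module _ (n : Exponent) {α β γ : ℕ} (0<α : 0 ℕ.< α) (0<β : 0 ℕ.< β)
    {u₁ v₁ w₁ u₂ v₂ w₂ u₃ v₃ w₃ : ℕ}
    (0<u₂ : 0 ℕ.< u₂) (0<v₂ : 0 ℕ.< v₂) (0<u₃ : 0 ℕ.< u₃) (0<v₃ : 0 ℕ.< v₃)
    (0<w₁ : 0 ℕ.< w₁) (0<w₂ : 0 ℕ.< w₂) (0<w₃ : 0 ℕ.< w₃)
    (eq₁ : OnCurve₂ n α β γ u₁ v₁ w₁) (eq₂ : OnCurve₂ n α β γ u₂ v₂ w₂) (eq₃ : OnCurve₂ n α β γ u₃ v₃ w₃)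
    (≢₁₂ : u₁ ℕ.* w₂ ≢ u₂ ℕ.* w₁) (≢₁₃ : u₁ ℕ.* w₃ ≢ u₃ ℕ.* w₁) (≢₂₃ : u₂ ℕ.* w₃ ≢ u₃ ℕ.* w₂)
    where

    private
      c₁ = w₂ ℕ.* w₃
      c₂ = w₁ ℕ.* w₃
      c₃ = w₁ ℕ.* w₂
      instance
        _ = ℕ.>-nonZero 0<w₁
        _ = ℕ.>-nonZero 0<w₂
        _ = ℕ.>-nonZero 0<w₃

    -- Scaling each point by the third coordinates of the other two gives all of them the third
    -- coordinate `w₁ w₂ w₃`. They then lie on one affine curve, and the expression that tests
    -- collinearity there is `w₁ w₂ w₃` times the determinant.
    det≢0 : detℕ u₁ v₁ w₁ u₂ v₂ w₂ u₃ v₃ w₃ ≢ 0ℤ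
    det≢0 det≡0 = not-collinear n {Γ = γ ℕ.* (w₁ ℕ.* c₁) ℕ.^ deg n} 0<α 0<β {u₁ ℕ.* c₁} {v₁ ℕ.* c₁}
      (scaled n α β γ {u₁} {v₁} {w₁} c₁ eq₁)
      {u₂ ℕ.* c₂} {v₂ ℕ.* c₂} {u₃ ℕ.* c₃} {v₃ ℕ.* c₃}
      (trans (scaled n α β γ {u₂} {v₂} {w₂} c₂ eq₂) (cong (λ t → γ ℕ.* t ℕ.^ deg n) (r₁ w₁ w₂ w₃)))
      (trans (scaled n α β γ {u₃} {v₃} {w₃} c₃ eq₃) (cong (λ t → γ ℕ.* t ℕ.^ deg n) (r₂ w₁ w₂ w₃)))
      (ℕ.*-mono-< 0<u₂ (ℕ.*-mono-< 0<w₁ 0<w₃)) (ℕ.*-mono-< 0<v₂ (ℕ.*-mono-< 0<w₁ 0<w₃))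
      (ℕ.*-mono-< 0<u₃ (ℕ.*-mono-< 0<w₁ 0<w₂)) (ℕ.*-mono-< 0<v₃ (ℕ.*-mono-< 0<w₁ 0<w₂))
      (λ e → ≢₁₂ (ℕ.*-cancelʳ-≡ _ _ w₃ (trans (ℕ.*-assoc u₁ w₂ w₃) (trans e (sym (ℕ.*-assoc u₂ w₁ w₃))))))
      (λ e → ≢₁₃ (ℕ.*-cancelʳ-≡ _ _ w₂ (trans (r₃ u₁ w₂ w₃) (trans e (sym (ℕ.*-assoc u₃ w₁ w₂))))))
      (λ e → ≢₂₃ (ℕ.*-cancelʳ-≡ _ _ w₁ (trans (r₄ u₂ w₁ w₃) (trans e (r₅ u₃ w₁ w₂)))))
      (i-j≡0⇒i≡j _ _ (begin
        (+ (u₁ ℕ.* c₁) - + (u₂ ℕ.* c₂)) * (+ (v₁ ℕ.* c₁) - + (v₃ ℕ.* c₃)) -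
        (+ (u₁ ℕ.* c₁) - + (u₃ ℕ.* c₃)) * (+ (v₁ ℕ.* c₁) - + (v₂ ℕ.* c₂))
          ≡⟨ cong₂ _-_
               (cong₂ _*_ (cong₂ _-_ (cast u₁ w₂ w₃) (cast u₂ w₁ w₃)) (cong₂ _-_ (cast v₁ w₂ w₃) (cast v₃ w₁ w₂)))
               (cong₂ _*_ (cong₂ _-_ (cast u₁ w₂ w₃) (cast u₃ w₁ w₂)) (cong₂ _-_ (cast v₁ w₂ w₃) (cast v₂ w₁ w₃))) ⟩
        (+ u₁ * (+ w₂ * + w₃) - + u₂ * (+ w₁ * + w₃)) * (+ v₁ * (+ w₂ * + w₃) - + v₃ * (+ w₁ * + w₂)) -
        (+ u₁ * (+ w₂ * + w₃) - + u₃ * (+ w₁ * + w₂)) * (+ v₁ * (+ w₂ * + w₃) - + v₂ * (+ w₁ * + w₃))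
          ≡⟨ cross (+ u₁) (+ v₁) (+ w₁) (+ u₂) (+ v₂) (+ w₂) (+ u₃) (+ v₃) (+ w₃) ⟩
        + w₁ * + w₂ * + w₃ * detℕ u₁ v₁ w₁ u₂ v₂ w₂ u₃ v₃ w₃ ≡⟨ cong (+ w₁ * + w₂ * + w₃ *_) det≡0 ⟩
        + w₁ * + w₂ * + w₃ * 0ℤ ≡⟨ *-zeroʳ (+ w₁ * + w₂ * + w₃) ⟩
        0ℤ ∎))
      where
      open ≡-Reasoning
      cast : ∀ a b c → + (a ℕ.* (b ℕ.* c)) ≡ + a * (+ b * + c)
      cast a b c = trans (pos-* a (b ℕ.* c)) (cong (+ a *_) (pos-* b c))
      r₁ : ∀ a b c → b ℕ.* (a ℕ.* c) ≡ a ℕ.* (b ℕ.* c)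
      r₁ = ℕSolver.solve-∀
      r₂ : ∀ a b c → c ℕ.* (a ℕ.* b) ≡ a ℕ.* (b ℕ.* c)
      r₂ = ℕSolver.solve-∀
      r₃ : ∀ u b c → u ℕ.* c ℕ.* b ≡ u ℕ.* (b ℕ.* c)
      r₃ = ℕSolver.solve-∀
      r₄ : ∀ u a c → u ℕ.* c ℕ.* a ≡ u ℕ.* (a ℕ.* c)
      r₄ = ℕSolver.solve-∀
      r₅ : ∀ u a b → u ℕ.* (a ℕ.* b) ≡ u ℕ.* b ℕ.* a
      r₅ = ℕSolver.solve-∀
      cross : ∀ u₁ v₁ w₁ u₂ v₂ w₂ u₃ v₃ w₃ →
        (u₁ * (w₂ * w₃) - u₂ * (w₁ * w₃)) * (v₁ * (w₂ * w₃) - v₃ * (w₁ * w₂)) -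
        (u₁ * (w₂ * w₃) - u₃ * (w₁ * w₂)) * (v₁ * (w₂ * w₃) - v₂ * (w₁ * w₃)) ≡
        w₁ * w₂ * w₃ * (u₁ * (v₂ * w₃ - v₃ * w₂) - v₁ * (u₂ * w₃ - u₃ * w₂) + w₁ * (u₂ * v₃ - u₃ * v₂))
      cross = solve-∀

  -- Both points lie in a common arc: a multiple of (u/w - u′/w′)ⁿ is bounded.
  Near : Exponent → (k α γ u w u′ w′ : ℕ) → Set
  Near n k α γ u w u′ w′ = k ℕ.^ deg n ℕ.* α ℕ.* minor u w u′ w′ ℕ.^ deg n ℕ.≤ γ ℕ.* (w ℕ.* w′) ℕ.^ deg n

  module Conic (α β γ : ℕ) where

    -- The polar form of `γ w² - α u² - β v²`.
    B : (u v w u′ v′ w′ : ℕ) → ℤ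
    B u v w u′ v′ w′ = + γ * + w * + w′ - + α * + u * + u′ - + β * + v * + v′

    conic-ℤ : ∀ {u v w} → OnCurve₂ two α β γ u v w → + α * + u * + u + + β * + v * + v - + γ * + w * + w ≡ 0ℤ
    conic-ℤ {u} {v} {w} eq = begin
      + α * + u * + u + + β * + v * + v - + γ * + w * + w    ≡⟨ assoc (+ α) (+ β) (+ γ) (+ u) (+ v) (+ w) ⟩
      + α * (+ u) ^ 2 + + β * (+ v) ^ 2 - + γ * (+ w) ^ 2    ≡⟨ cong₂ _-_ (cong₂ _+_ (pos-*^ α u 2) (pos-*^ β v 2)) (pos-*^ γ w 2) ⟨
      + (α ℕ.* u ℕ.^ 2) + + (β ℕ.* v ℕ.^ 2) - + (γ ℕ.* w ℕ.^ 2)  ≡⟨ cong (λ t → + t - + (γ ℕ.* w ℕ.^ 2)) eq ⟩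
      + (γ ℕ.* w ℕ.^ 2) - + (γ ℕ.* w ℕ.^ 2)                  ≡⟨ +-inverseʳ (+ (γ ℕ.* w ℕ.^ 2)) ⟩
      0ℤ ∎
      where
      open ≡-Reasoning
      assoc : ∀ α β γ u v w → α * u * u + β * v * v - γ * w * w ≡ α * (u * (u * 1ℤ)) + β * (v * (v * 1ℤ)) - γ * (w * (w * 1ℤ))
      assoc = solve-∀

    -- As both points are isotropic, the polar form turns into a sum of squares of minors. It is
    -- therefore quadratically small in the distance of the points, and this is the source of the
    -- factor `k * k` in `B-bound`.
    2ww′B : ∀ {u v w u′ v′ w′} → OnCurve₂ two α β γ u v w → OnCurve₂ two α β γ u′ v′ w′ →
      + 2 * (+ w * + w′) * B u v w u′ v′ w′ ≡
      + α * ((+ u * + w′ - + u′ * + w) * (+ u * + w′ - + u′ * + w)) +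
      + β * ((+ v * + w′ - + v′ * + w) * (+ v * + w′ - + v′ * + w))
    2ww′B {u} {v} {w} {u′} {v′} {w′} eq eq′ = trans
      (identity (+ α) (+ β) (+ γ) (+ u) (+ v) (+ w) (+ u′) (+ v′) (+ w′))
      (trans (cong₂ (λ x y → rhs - + w′ * + w′ * x - + w * + w * y) (conic-ℤ {u} {v} {w} eq) (conic-ℤ {u′} {v′} {w′} eq′))
        (zeros rhs (+ w) (+ w′)))
      where
      rhs = + α * ((+ u * + w′ - + u′ * + w) * (+ u * + w′ - + u′ * + w)) +
            + β * ((+ v * + w′ - + v′ * + w) * (+ v * + w′ - + v′ * + w))
      identity : ∀ α β γ u v w u′ v′ w′ →
        + 2 * (w * w′) * (γ * w * w′ - α * u * u′ - β * v * v′) ≡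
        α * ((u * w′ - u′ * w) * (u * w′ - u′ * w)) + β * ((v * w′ - v′ * w) * (v * w′ - v′ * w))
        - w′ * w′ * (α * u * u + β * v * v - γ * w * w) - w * w * (α * u′ * u′ + β * v′ * v′ - γ * w′ * w′)
      identity = solve-∀
      zeros : ∀ r w w′ → r - w′ * w′ * 0ℤ - w * w * 0ℤ ≡ r
      zeros = solve-∀

    B-bound : ∀ k {u v w u′ v′ w′} → 0 ℕ.< w → 0 ℕ.< w′ →
      OnCurve₂ two α β γ u v w → OnCurve₂ two α β γ u′ v′ w′ →
      Near two k α γ u w u′ w′ → Near two k β γ v w v′ w′ →
      k ℕ.* k ℕ.* abs (B u v w u′ v′ w′) ℕ.≤ γ ℕ.* (w ℕ.* w′)
    B-bound k {u} {v} {w} {u′} {v′} {w′} 0<w 0<w′ eq eq′ nearᵤ nearᵥ =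
      ℕ.*-cancelˡ-≤ (2 ℕ.* (w ℕ.* w′)) {{ℕ.>-nonZero (ℕ.*-mono-< {0} {2} (ℕ.s≤s ℕ.z≤n) (ℕ.*-mono-< 0<w 0<w′))}} (begin
        2 ℕ.* (w ℕ.* w′) ℕ.* (k ℕ.* k ℕ.* b)            ≡⟨ id₁ k (w ℕ.* w′) b ⟩
        k ℕ.* k ℕ.* (2 ℕ.* (w ℕ.* w′) ℕ.* b)            ≡⟨ cong (k ℕ.* k ℕ.*_) abs-B ⟩
        k ℕ.* k ℕ.* abs (+ α * (X * X) + + β * (Y * Y)) ≤⟨ ℕ.*-monoʳ-≤ (k ℕ.* k) (∣i+j∣≤∣i∣+∣j∣ (+ α * (X * X)) (+ β * (Y * Y))) ⟩
        k ℕ.* k ℕ.* (abs (+ α * (X * X)) ℕ.+ abs (+ β * (Y * Y)))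
          ≡⟨ cong₂ (λ x y → k ℕ.* k ℕ.* (x ℕ.+ y)) (abs-*² α X) (abs-*² β Y) ⟩
        k ℕ.* k ℕ.* (α ℕ.* (abs X ℕ.* abs X) ℕ.+ β ℕ.* (abs Y ℕ.* abs Y))
          ≡⟨ id₂ k α β (abs X) (abs Y) ⟩
        k ℕ.^ 2 ℕ.* α ℕ.* abs X ℕ.^ 2 ℕ.+ k ℕ.^ 2 ℕ.* β ℕ.* abs Y ℕ.^ 2
          ≤⟨ ℕ.+-mono-≤ nearᵤ nearᵥ ⟩
        γ ℕ.* (w ℕ.* w′) ℕ.^ 2 ℕ.+ γ ℕ.* (w ℕ.* w′) ℕ.^ 2 ≡⟨ id₃ γ (w ℕ.* w′) ⟩
        2 ℕ.* (w ℕ.* w′) ℕ.* (γ ℕ.* (w ℕ.* w′))          ∎)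
      where
      open ℕ.≤-Reasoning
      b = abs (B u v w u′ v′ w′)
      X = + u * + w′ - + u′ * + w
      Y = + v * + w′ - + v′ * + w
      abs-*² : ∀ a x → abs (+ a * (x * x)) ≡ a ℕ.* (abs x ℕ.* abs x)
      abs-*² a x = trans (abs-* (+ a) (x * x)) (cong (a ℕ.*_) (abs-* x x))
      abs-B : 2 ℕ.* (w ℕ.* w′) ℕ.* b ≡ abs (+ α * (X * X) + + β * (Y * Y))
      abs-B = trans (sym (trans (abs-* (+ 2 * (+ w * + w′)) (B u v w u′ v′ w′))
        (cong (ℕ._* b) (trans (abs-* (+ 2) (+ w * + w′)) (cong (2 ℕ.*_) (abs-* (+ w) (+ w′)))))))
        (cong abs (2ww′B {u} {v} {w} {u′} {v′} {w′} eq eq′))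
      id₁ : ∀ k x b → 2 ℕ.* x ℕ.* (k ℕ.* k ℕ.* b) ≡ k ℕ.* k ℕ.* (2 ℕ.* x ℕ.* b)
      id₁ = ℕSolver.solve-∀
      id₂ : ∀ k α β x y → k ℕ.* k ℕ.* (α ℕ.* (x ℕ.* x) ℕ.+ β ℕ.* (y ℕ.* y)) ≡
        k ℕ.* (k ℕ.* 1) ℕ.* α ℕ.* (x ℕ.* (x ℕ.* 1)) ℕ.+ k ℕ.* (k ℕ.* 1) ℕ.* β ℕ.* (y ℕ.* (y ℕ.* 1))
      id₂ = ℕSolver.solve-∀
      id₃ : ∀ γ x → γ ℕ.* (x ℕ.* (x ℕ.* 1)) ℕ.+ γ ℕ.* (x ℕ.* (x ℕ.* 1)) ≡ 2 ℕ.* x ℕ.* (γ ℕ.* x)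
      id₃ = ℕSolver.solve-∀

    -- The Gram determinant of three isotropic vectors of α u² + β v² - γ w².
    gram : ∀ α β γ u₁ v₁ w₁ u₂ v₂ w₂ u₃ v₃ w₃ →
      let g = λ u v w u′ v′ w′ → γ * w * w′ - α * u * u′ - β * v * v′
          q = λ u v w → α * u * u + β * v * v - γ * w * w
          D = u₁ * (v₂ * w₃ - v₃ * w₂) - v₁ * (u₂ * w₃ - u₃ * w₂) + w₁ * (u₂ * v₃ - u₃ * v₂)
          q₁ = q u₁ v₁ w₁
          q₂ = q u₂ v₂ w₂
          q₃ = q u₃ v₃ w₃
          g₁₂ = g u₁ v₁ w₁ u₂ v₂ w₂
          g₁₃ = g u₁ v₁ w₁ u₃ v₃ w₃
          g₂₃ = g u₂ v₂ w₂ u₃ v₃ w₃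
      in α * β * γ * (D * D) ≡
         + 2 * (g₁₂ * g₁₃ * g₂₃) + q₁ * (g₂₃ * g₂₃ - q₂ * q₃) + q₂ * (g₁₃ * g₁₃) + q₃ * (g₁₂ * g₁₂)
    gram = solve-∀

    -- On the conic the diagonal of the Gram matrix vanishes. What remains is twice the product of
    -- three polar values, each of which contributes a factor `k²`.
    det²-bound : ∀ k {u₁ v₁ w₁ u₂ v₂ w₂ u₃ v₃ w₃} → 0 ℕ.< w₁ → 0 ℕ.< w₂ → 0 ℕ.< w₃ →
      OnCurve₂ two α β γ u₁ v₁ w₁ → OnCurve₂ two α β γ u₂ v₂ w₂ → OnCurve₂ two α β γ u₃ v₃ w₃ →
      Near two k α γ u₁ w₁ u₂ w₂ → Near two k α γ u₁ w₁ u₃ w₃ → Near two k α γ u₂ w₂ u₃ w₃ →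
      Near two k β γ v₁ w₁ v₂ w₂ → Near two k β γ v₁ w₁ v₃ w₃ → Near two k β γ v₂ w₂ v₃ w₃ →
      k ℕ.^ 6 ℕ.* (α ℕ.* β ℕ.* γ ℕ.* abs (detℕ u₁ v₁ w₁ u₂ v₂ w₂ u₃ v₃ w₃) ℕ.^ 2) ℕ.≤
      2 ℕ.* (γ ℕ.* w₁ ℕ.^ 2 ℕ.* (γ ℕ.* w₂ ℕ.^ 2) ℕ.* (γ ℕ.* w₃ ℕ.^ 2))
    det²-bound k {u₁} {v₁} {w₁} {u₂} {v₂} {w₂} {u₃} {v₃} {w₃} 0<w₁ 0<w₂ 0<w₃ eq₁ eq₂ eq₃ u₁₂ u₁₃ u₂₃ v₁₂ v₁₃ v₂₃ = begin
      k ℕ.^ 6 ℕ.* (α ℕ.* β ℕ.* γ ℕ.* abs D ℕ.^ 2)                     ≡⟨ cong (k ℕ.^ 6 ℕ.*_) abs-gram ⟩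
      k ℕ.^ 6 ℕ.* (2 ℕ.* (abs g₁₂ ℕ.* abs g₁₃ ℕ.* abs g₂₃))           ≡⟨ id₁ k (abs g₁₂) (abs g₁₃) (abs g₂₃) ⟩
      2 ℕ.* (k ℕ.* k ℕ.* abs g₁₂ ℕ.* (k ℕ.* k ℕ.* abs g₁₃) ℕ.* (k ℕ.* k ℕ.* abs g₂₃))
        ≤⟨ ℕ.*-monoʳ-≤ 2 (ℕ.*-mono-≤ (ℕ.*-mono-≤
             (B-bound k 0<w₁ 0<w₂ eq₁ eq₂ u₁₂ v₁₂) (B-bound k 0<w₁ 0<w₃ eq₁ eq₃ u₁₃ v₁₃))
             (B-bound k 0<w₂ 0<w₃ eq₂ eq₃ u₂₃ v₂₃)) ⟩
      2 ℕ.* (γ ℕ.* (w₁ ℕ.* w₂) ℕ.* (γ ℕ.* (w₁ ℕ.* w₃)) ℕ.* (γ ℕ.* (w₂ ℕ.* w₃)))  ≡⟨ id₂ γ w₁ w₂ w₃ ⟩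
      2 ℕ.* (γ ℕ.* w₁ ℕ.^ 2 ℕ.* (γ ℕ.* w₂ ℕ.^ 2) ℕ.* (γ ℕ.* w₃ ℕ.^ 2)) ∎
      where
      open ℕ.≤-Reasoning
      D = detℕ u₁ v₁ w₁ u₂ v₂ w₂ u₃ v₃ w₃
      g₁₂ = B u₁ v₁ w₁ u₂ v₂ w₂
      g₁₃ = B u₁ v₁ w₁ u₃ v₃ w₃
      g₂₃ = B u₂ v₂ w₂ u₃ v₃ w₃
      zeros : ∀ x a b c → x + 0ℤ * a + 0ℤ * b + 0ℤ * c ≡ x
      zeros = solve-∀
      gram-isotropic : + α * + β * + γ * (D * D) ≡ + 2 * (g₁₂ * g₁₃ * g₂₃)
      gram-isotropic = trans (gram (+ α) (+ β) (+ γ) (+ u₁) (+ v₁) (+ w₁) (+ u₂) (+ v₂) (+ w₂) (+ u₃) (+ v₃) (+ w₃))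
        (trans (lemma (g₁₂ * g₁₃ * g₂₃) (g₂₃ * g₂₃) (g₁₃ * g₁₃) (g₁₂ * g₁₂) (conic-ℤ {u₁} {v₁} {w₁} eq₁) (conic-ℤ {u₂} {v₂} {w₂} eq₂) (conic-ℤ {u₃} {v₃} {w₃} eq₃))
          refl)
        where
        lemma : ∀ x a b c {q₁ q₂ q₃} → q₁ ≡ 0ℤ → q₂ ≡ 0ℤ → q₃ ≡ 0ℤ →
          + 2 * x + q₁ * (a - q₂ * q₃) + q₂ * b + q₃ * c ≡ + 2 * x
        lemma x a b c refl refl refl = zeros (+ 2 * x) (a - 0ℤ * 0ℤ) b c
      abs-gram : α ℕ.* β ℕ.* γ ℕ.* abs D ℕ.^ 2 ≡ 2 ℕ.* (abs g₁₂ ℕ.* abs g₁₃ ℕ.* abs g₂₃)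
      abs-gram = trans (sym (abs-lhs α β γ D)) (trans (cong abs gram-isotropic) (abs-rhs g₁₂ g₁₃ g₂₃))
        where
        abs-lhs : ∀ α β γ D → abs (+ α * + β * + γ * (D * D)) ≡ α ℕ.* β ℕ.* γ ℕ.* abs D ℕ.^ 2
        abs-lhs α β γ D = trans (abs-* (+ α * + β * + γ) (D * D)) (cong₂ ℕ._*_
          (trans (abs-* (+ α * + β) (+ γ)) (cong (ℕ._* γ) (abs-* (+ α) (+ β))))
          (trans (abs-* D D) (cong (abs D ℕ.*_) (sym (ℕ.*-identityʳ (abs D))))))
        abs-rhs : ∀ a b c → abs (+ 2 * (a * b * c)) ≡ 2 ℕ.* (abs a ℕ.* abs b ℕ.* abs c)
        abs-rhs a b c = trans (abs-* (+ 2) (a * b * c)) (cong (2 ℕ.*_)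
          (trans (abs-* (a * b) c) (cong (ℕ._* abs c) (abs-* a b))))
      id₁ : ∀ k a b c → k ℕ.* (k ℕ.* (k ℕ.* (k ℕ.* (k ℕ.* (k ℕ.* 1))))) ℕ.* (2 ℕ.* (a ℕ.* b ℕ.* c)) ≡
        2 ℕ.* (k ℕ.* k ℕ.* a ℕ.* (k ℕ.* k ℕ.* b) ℕ.* (k ℕ.* k ℕ.* c))
      id₁ = ℕSolver.solve-∀
      id₂ : ∀ γ a b c → 2 ℕ.* (γ ℕ.* (a ℕ.* b) ℕ.* (γ ℕ.* (a ℕ.* c)) ℕ.* (γ ℕ.* (b ℕ.* c))) ≡
        2 ℕ.* (γ ℕ.* (a ℕ.* (a ℕ.* 1)) ℕ.* (γ ℕ.* (b ℕ.* (b ℕ.* 1))) ℕ.* (γ ℕ.* (c ℕ.* (c ℕ.* 1))))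
      id₂ = ℕSolver.solve-∀

  module Cubic (α β γ : ℕ) where

    private
      cube : ℕ → ℕ
      cube x = x ℕ.^ 3

      product-bound : ∀ k {x y W W′} → k ℕ.^ 3 ℕ.* α ℕ.* cube x ℕ.≤ γ ℕ.* cube W → k ℕ.^ 3 ℕ.* β ℕ.* cube y ℕ.≤ γ ℕ.* cube W′ →
        k ℕ.^ 6 ℕ.* (α ℕ.* β) ℕ.* cube (x ℕ.* y) ℕ.≤ γ ℕ.* γ ℕ.* cube (W ℕ.* W′)
      product-bound k {x} {y} {W} {W′} hx hy = ℕ.≤-trans (ℕ.≤-reflexive (id₁ k α β x y))
        (ℕ.≤-trans (ℕ.*-mono-≤ hx hy) (ℕ.≤-reflexive (id₂ γ W W′)))
        where
        id₁ : ∀ k α β x y → k ℕ.* (k ℕ.* (k ℕ.* (k ℕ.* (k ℕ.* (k ℕ.* 1))))) ℕ.* (α ℕ.* β) ℕ.* (x ℕ.* y ℕ.* (x ℕ.* y ℕ.* (x ℕ.* y ℕ.* 1))) ≡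
          k ℕ.* (k ℕ.* (k ℕ.* 1)) ℕ.* α ℕ.* (x ℕ.* (x ℕ.* (x ℕ.* 1))) ℕ.* (k ℕ.* (k ℕ.* (k ℕ.* 1)) ℕ.* β ℕ.* (y ℕ.* (y ℕ.* (y ℕ.* 1))))
        id₁ = ℕSolver.solve-∀
        id₂ : ∀ γ x y → γ ℕ.* (x ℕ.* (x ℕ.* (x ℕ.* 1))) ℕ.* (γ ℕ.* (y ℕ.* (y ℕ.* (y ℕ.* 1)))) ≡ γ ℕ.* γ ℕ.* (x ℕ.* y ℕ.* (x ℕ.* y ℕ.* (x ℕ.* y ℕ.* 1)))
        id₂ = ℕSolver.solve-∀

      double-bound : ∀ K {s c C} → s ℕ.≤ c ℕ.+ c → K ℕ.* cube c ℕ.≤ C → K ℕ.* cube s ℕ.≤ 8 ℕ.* C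
      double-bound K {c = c} s≤2c h = ℕ.≤-trans (ℕ.*-monoʳ-≤ K (ℕ.^-monoˡ-≤ 3 s≤2c))
        (ℕ.≤-trans (ℕ.≤-reflexive (identity K c)) (ℕ.*-monoʳ-≤ 8 h))
        where
        identity : ∀ K c → K ℕ.* ((c ℕ.+ c) ℕ.* ((c ℕ.+ c) ℕ.* ((c ℕ.+ c) ℕ.* 1))) ≡ 8 ℕ.* (K ℕ.* (c ℕ.* (c ℕ.* (c ℕ.* 1))))
        identity = ℕSolver.solve-∀

      sum-bound : ∀ K {a b C} → K ℕ.* cube a ℕ.≤ C → K ℕ.* cube b ℕ.≤ C → K ℕ.* cube (a ℕ.+ b) ℕ.≤ 8 ℕ.* C
      sum-bound K {a} {b} ha hb with ℕ.≤-total a b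
      ... | inj₁ a≤b = double-bound K {a ℕ.+ b} {b} (ℕ.+-monoˡ-≤ b a≤b) hb
      ... | inj₂ b≤a = double-bound K {a ℕ.+ b} {a} (ℕ.+-monoʳ-≤ a b≤a) ha

    w·det : ∀ u₁ v₁ w₁ u₂ v₂ w₂ u₃ v₃ w₃ →
      w₁ * (u₁ * (v₂ * w₃ - v₃ * w₂) - v₁ * (u₂ * w₃ - u₃ * w₂) + w₁ * (u₂ * v₃ - u₃ * v₂)) ≡
      (u₁ * w₂ - u₂ * w₁) * (v₁ * w₃ - v₃ * w₁) - (u₁ * w₃ - u₃ * w₁) * (v₁ * w₂ - v₂ * w₁)
    w·det = solve-∀

    -- For the cubic, `w·det` writes the determinant by products of two minors. Each product gains
    -- `k²`, so the cube gains `k ^ 6` as for the conic. The 8 is the cube of the number of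
    -- products.
    det³-bound : ∀ k {u₁ v₁ w₁ u₂ v₂ w₂ u₃ v₃ w₃} → 0 ℕ.< w₁ →
      Near three k α γ u₁ w₁ u₂ w₂ → Near three k α γ u₁ w₁ u₃ w₃ →
      Near three k β γ v₁ w₁ v₂ w₂ → Near three k β γ v₁ w₁ v₃ w₃ →
      k ℕ.^ 6 ℕ.* (α ℕ.* β ℕ.* γ ℕ.* abs (detℕ u₁ v₁ w₁ u₂ v₂ w₂ u₃ v₃ w₃) ℕ.^ 3) ℕ.≤
      8 ℕ.* (γ ℕ.* w₁ ℕ.^ 3 ℕ.* (γ ℕ.* w₂ ℕ.^ 3) ℕ.* (γ ℕ.* w₃ ℕ.^ 3))
    det³-bound k {u₁} {v₁} {w₁} {u₂} {v₂} {w₂} {u₃} {v₃} {w₃} 0<w₁ u₁₂ u₁₃ v₁₂ v₁₃ =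
      ℕ.*-cancelˡ-≤ (cube w₁) {{ℕ.m^n≢0 w₁ 3 {{ℕ.>-nonZero 0<w₁}}}} (begin
        cube w₁ ℕ.* (k ℕ.^ 6 ℕ.* (α ℕ.* β ℕ.* γ ℕ.* cube d))         ≡⟨ id₁ (k ℕ.^ 6) α β γ w₁ d ⟩
        γ ℕ.* (k ℕ.^ 6 ℕ.* (α ℕ.* β) ℕ.* cube (w₁ ℕ.* d))            ≤⟨ ℕ.*-monoʳ-≤ γ (ℕ.*-monoʳ-≤ (k ℕ.^ 6 ℕ.* (α ℕ.* β)) (ℕ.^-monoˡ-≤ 3 wd≤)) ⟩
        γ ℕ.* (k ℕ.^ 6 ℕ.* (α ℕ.* β) ℕ.* cube (x₂ ℕ.* y₃ ℕ.+ x₃ ℕ.* y₂))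
          ≤⟨ ℕ.*-monoʳ-≤ γ (sum-bound (k ℕ.^ 6 ℕ.* (α ℕ.* β)) {x₂ ℕ.* y₃} {x₃ ℕ.* y₂}
               (product-bound k {x₂} {y₃} {w₁ ℕ.* w₂} {w₁ ℕ.* w₃} u₁₂ v₁₃)
               (ℕ.≤-trans (product-bound k {x₃} {y₂} {w₁ ℕ.* w₃} {w₁ ℕ.* w₂} u₁₃ v₁₂)
                 (ℕ.≤-reflexive (cong (λ t → γ ℕ.* γ ℕ.* cube t) (ℕ.*-comm (w₁ ℕ.* w₃) (w₁ ℕ.* w₂)))))) ⟩
        γ ℕ.* (8 ℕ.* (γ ℕ.* γ ℕ.* cube (w₁ ℕ.* w₂ ℕ.* (w₁ ℕ.* w₃))))  ≡⟨ id₂ γ w₁ w₂ w₃ ⟩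
        cube w₁ ℕ.* (8 ℕ.* (γ ℕ.* cube w₁ ℕ.* (γ ℕ.* cube w₂) ℕ.* (γ ℕ.* cube w₃))) ∎)
      where
      open ℕ.≤-Reasoning
      D = detℕ u₁ v₁ w₁ u₂ v₂ w₂ u₃ v₃ w₃
      d = abs D
      x₂ = minor u₁ w₁ u₂ w₂
      x₃ = minor u₁ w₁ u₃ w₃
      y₂ = minor v₁ w₁ v₂ w₂
      y₃ = minor v₁ w₁ v₃ w₃
      X₂ = + u₁ * + w₂ - + u₂ * + w₁
      X₃ = + u₁ * + w₃ - + u₃ * + w₁
      Y₂ = + v₁ * + w₂ - + v₂ * + w₁
      Y₃ = + v₁ * + w₃ - + v₃ * + w₁
      wd≤ : w₁ ℕ.* d ℕ.≤ x₂ ℕ.* y₃ ℕ.+ x₃ ℕ.* y₂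
      wd≤ = begin
        w₁ ℕ.* d                        ≡⟨ abs-* (+ w₁) D ⟨
        abs (+ w₁ * D)                  ≡⟨ cong abs (w·det (+ u₁) (+ v₁) (+ w₁) (+ u₂) (+ v₂) (+ w₂) (+ u₃) (+ v₃) (+ w₃)) ⟩
        abs (X₂ * Y₃ - X₃ * Y₂)         ≤⟨ ∣i-j∣≤∣i∣+∣j∣ (X₂ * Y₃) (X₃ * Y₂) ⟩
        abs (X₂ * Y₃) ℕ.+ abs (X₃ * Y₂) ≡⟨ cong₂ ℕ._+_ (abs-* X₂ Y₃) (abs-* X₃ Y₂) ⟩
        x₂ ℕ.* y₃ ℕ.+ x₃ ℕ.* y₂         ∎
      id₁ : ∀ K α β γ w d → w ℕ.* (w ℕ.* (w ℕ.* 1)) ℕ.* (K ℕ.* (α ℕ.* β ℕ.* γ ℕ.* (d ℕ.* (d ℕ.* (d ℕ.* 1))))) ≡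
        γ ℕ.* (K ℕ.* (α ℕ.* β) ℕ.* (w ℕ.* d ℕ.* (w ℕ.* d ℕ.* (w ℕ.* d ℕ.* 1))))
      id₁ = ℕSolver.solve-∀
      id₂ : ∀ γ a b c → let W = a ℕ.* b ℕ.* (a ℕ.* c) in
        γ ℕ.* (8 ℕ.* (γ ℕ.* γ ℕ.* (W ℕ.* (W ℕ.* (W ℕ.* 1))))) ≡
        a ℕ.* (a ℕ.* (a ℕ.* 1)) ℕ.* (8 ℕ.* (γ ℕ.* (a ℕ.* (a ℕ.* (a ℕ.* 1))) ℕ.* (γ ℕ.* (b ℕ.* (b ℕ.* (b ℕ.* 1)))) ℕ.* (γ ℕ.* (c ℕ.* (c ℕ.* (c ℕ.* 1))))))
      id₂ = ℕSolver.solve-∀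

-- Subdivision of the curve into arcs.

module Arcs where

  open import Data.Nat
  open import Data.Nat.Properties
  open import Data.Nat.Tactic.RingSolver using (solve-∀)
  open LocalRoots using (Exponent; two; three; deg)
  open Determinant using (^-*-distribℕ; minor; Near)

  module _ {P : ℕ → Set} (P? : ∀ i → Dec (P i)) where

    -- A downward search which returns 0 untested; hence the premise `P 0` of `largest-holds`.
    largest : ℕ → ℕ
    largest zero = 0
    largest (suc k) with P? (suc k)
    ... | yes _ = suc k
    ... | no  _ = largest k

    largest-holds : P 0 → ∀ k → P (largest k)
    largest-holds P0 zero = P0
    largest-holds P0 (suc k) with P? (suc k)
    ... | yes p = p
    ... | no  _ = largest-holds P0 k

    largest≤ : ∀ k → largest k ≤ k
    largest≤ zero = z≤n
    largest≤ (suc k) with P? (suc k)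
    ... | yes _ = ≤-refl
    ... | no  _ = m≤n⇒m≤1+n (largest≤ k)

    largest-greatest : ∀ {k i} → i ≤ k → P i → i ≤ largest k
    largest-greatest {zero} z≤n _ = z≤n
    largest-greatest {suc k} {i} i≤1+k p with P? (suc k)
    ... | yes _ = i≤1+k
    ... | no ¬p with m≤n⇒m<n∨m≡n i≤1+k
    ... | inj₁ (s≤s i≤k) = largest-greatest i≤k p
    ... | inj₂ refl      = contradiction p ¬p

  -- Fractions without division: `j / E` is at most `(a / C)^(1/N)`, and `s / S` is at most `j / E`.
  ^-compare : ∀ N {a C E j s S} → 0 < j → j ^ N * C ≤ E ^ N * a → s * E ≤ S * j → s ^ N * C ≤ S ^ N * a
  ^-compare N {a} {C} {E} {j} {s} {S} 0<j h sE≤Sj = *-cancelˡ-≤ (j ^ N) {{m^n≢0 j N {{>-nonZero 0<j}}}} (begin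
    j ^ N * (s ^ N * C)      ≡⟨ id₁ (j ^ N) (s ^ N) C ⟩
    s ^ N * (j ^ N * C)      ≤⟨ *-monoʳ-≤ (s ^ N) h ⟩
    s ^ N * (E ^ N * a)      ≡⟨ *-assoc (s ^ N) (E ^ N) a ⟨
    s ^ N * E ^ N * a        ≡⟨ cong (_* a) (^-*-distribℕ s E N) ⟨
    (s * E) ^ N * a          ≤⟨ *-monoˡ-≤ a (^-monoˡ-≤ N sE≤Sj) ⟩
    (S * j) ^ N * a          ≡⟨ cong (_* a) (^-*-distribℕ S j N) ⟩
    S ^ N * j ^ N * a        ≡⟨ id₂ (S ^ N) (j ^ N) a ⟩
    j ^ N * (S ^ N * a)      ∎)
    where
    open ≤-Reasoning
    id₁ : ∀ x y z → x * (y * z) ≡ y * (x * z)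
    id₁ = solve-∀
    id₂ : ∀ x y z → x * y * z ≡ y * (x * z)
    id₂ = solve-∀

  -- (a xᴺ / C)^(1/N) is additive in x, so lower bounds for it add up.
  ^-superadditiveℕ : ∀ N {a C A E i j} → 0 < j → i ^ N * C ≤ A ^ N * a → j ^ N * C ≤ E ^ N * a →
    (i + j) ^ N * C ≤ (A + E) ^ N * a
  ^-superadditiveℕ N {a} {C} {A} {E} {i} {j} 0<j hA hE with E * i ≤? A * j
  -- The mediant `(i + j) / (A + E)` is at most the larger of `i / A` and `j / E`, so only that one
  -- has to be compared.
  ... | yes Ei≤Aj = ^-compare N {a} {C} {E} {j} {i + j} {A + E} 0<j hE (begin
    (i + j) * E      ≡⟨ id₁ i j E ⟩
    E * i + E * j    ≤⟨ +-monoˡ-≤ (E * j) Ei≤Aj ⟩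
    A * j + E * j    ≡⟨ *-distribʳ-+ j A E ⟨
    (A + E) * j      ∎)
    where
    open ≤-Reasoning
    id₁ : ∀ i j E → (i + j) * E ≡ E * i + E * j
    id₁ = solve-∀
  ... | no Ei≰Aj = ^-compare N {a} {C} {A} {i} {i + j} {A + E} 0<i hA (begin
    (i + j) * A      ≡⟨ id₁ i j A ⟩
    A * i + A * j    ≤⟨ +-monoʳ-≤ (A * i) (<⇒≤ (≰⇒> Ei≰Aj)) ⟩
    A * i + E * i    ≡⟨ *-distribʳ-+ i A E ⟨
    (A + E) * i      ∎)
    where
    open ≤-Reasoning
    id₁ : ∀ i j A → (i + j) * A ≡ A * i + A * j
    id₁ = solve-∀
    0<i : 0 < i
    0<i = n≢0⇒n>0 λ i≡0 → Ei≰Aj (≤-trans (≤-reflexive (trans (cong (E *_) i≡0) (*-zeroʳ E))) z≤n)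

  0^deg≡0 : ∀ n → 0 ^ deg n ≡ 0
  0^deg≡0 two   = refl
  0^deg≡0 three = refl

  module Arc (n : Exponent) (k : ℕ) where

    private
      N = deg n

    below? : ∀ x z i → Dec (i ^ N * z ≤ k ^ N * x)
    below? x z i = i ^ N * z ≤? k ^ N * x

    -- ⌊ k (x / z)^(1/n) ⌋ for x < z.
    arc : ℕ → ℕ → ℕ
    arc x z = largest (below? x z) k

    arc≤ : ∀ x z → arc x z ≤ k
    arc≤ x z = largest≤ (below? x z) k

    arc-lower : ∀ x z → arc x z ^ N * z ≤ k ^ N * x
    arc-lower x z = largest-holds (below? x z) (subst (λ t → t * z ≤ k ^ N * x) (sym (0^deg≡0 n)) z≤n) k

    arc-upper : ∀ {x z} → 0 < k → x < z → k ^ N * x < suc (arc x z) ^ N * z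
    arc-upper {x} {z} 0<k x<z with suc (arc x z) ≤? k
    ... | yes 1+i≤k = ≰⇒> λ h → <-irrefl refl (largest-greatest (below? x z) 1+i≤k h)
    -- Here the search ended at its limit `k`, and the strict upper bound comes from `x < z` instead
    -- of a failed test.
    ... | no  1+i≰k = <-≤-trans (*-monoʳ-< (k ^ N) {{m^n≢0 k N {{>-nonZero 0<k}}}} x<z)
      (*-monoˡ-≤ z (^-monoˡ-≤ N (<⇒≤ (≰⇒> 1+i≰k))))

    arc-mono : ∀ {x z x′ z′} → 0 < z′ → x′ * z ≤ x * z′ → arc x′ z′ ≤ arc x z
    arc-mono {x} {z} {x′} {z′} 0<z′ h = largest-greatest (below? x z) (arc≤ x′ z′)
      (*-cancelʳ-≤ _ _ z′ {{>-nonZero 0<z′}} (begin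
        i ^ N * z * z′       ≡⟨ id₁ (i ^ N) z z′ ⟩
        i ^ N * z′ * z       ≤⟨ *-monoˡ-≤ z (arc-lower x′ z′) ⟩
        k ^ N * x′ * z       ≡⟨ *-assoc (k ^ N) x′ z ⟩
        k ^ N * (x′ * z)     ≤⟨ *-monoʳ-≤ (k ^ N) h ⟩
        k ^ N * (x * z′)     ≡⟨ *-assoc (k ^ N) x z′ ⟨
        k ^ N * x * z′       ∎))
      where
      open ≤-Reasoning
      i = arc x′ z′
      id₁ : ∀ a b c → a * b * c ≡ a * c * b
      id₁ = solve-∀

    -- Along the curve the first arc index increases while the second decreases,
    -- so this single number determines both.
    arcCode : (x y z : ℕ) → ℕ
    arcCode x y z = arc x z + (k ∸ arc y z)

    arcCode≤ : ∀ x y z → arcCode x y z ≤ k + k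
    arcCode≤ x y z = +-mono-≤ (arc≤ x z) (m∸n≤m k (arc y z))

    private
      arcs-≡-≤ : ∀ {x y z x′ y′ z′} → 0 < z → 0 < z′ → x + y ≡ z → x′ + y′ ≡ z′ → x′ * z ≤ x * z′ →
        arcCode x y z ≡ arcCode x′ y′ z′ → arc x z ≡ arc x′ z′ × arc y z ≡ arc y′ z′
      arcs-≡-≤ {x} {y} {_} {x′} {y′} 0<z 0<z′ refl refl h eq = i≡i′ , ∸-cancelˡ-≡ (arc≤ y _) (arc≤ y′ _)
        (+-cancelˡ-≡ (arc x z) _ _ (trans eq (cong (_+ (k ∸ arc y′ z′)) (sym i≡i′))))
        where
        z = x + y
        z′ = x′ + y′
        h′ : y * z′ ≤ y′ * z
        h′ = +-cancelˡ-≤ (x′ * z) _ _ (begin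
          x′ * z + y * z′        ≤⟨ +-monoˡ-≤ (y * z′) h ⟩
          x * z′ + y * z′        ≡⟨ id₁ x y x′ y′ ⟩
          x′ * z + y′ * z        ∎)
          where
          open ≤-Reasoning
          id₁ : ∀ x y x′ y′ → x * (x′ + y′) + y * (x′ + y′) ≡ x′ * (x + y) + y′ * (x + y)
          id₁ = solve-∀
        i′≤i = arc-mono {x} {z} {x′} {z′} 0<z′ h
        j≤j′ = arc-mono {y′} {z′} {y} {z} 0<z h′
        i≡i′ : arc x z ≡ arc x′ z′
        i≡i′ = ≤-antisym (+-cancelʳ-≤ (k ∸ arc y z) _ _ (≤-trans (≤-reflexive eq)
          (+-monoʳ-≤ (arc x′ z′) (∸-monoʳ-≤ k j≤j′)))) i′≤i

    arcs-≡ : ∀ {x y z x′ y′ z′} → 0 < z → 0 < z′ → x + y ≡ z → x′ + y′ ≡ z′ →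
      arcCode x y z ≡ arcCode x′ y′ z′ → arc x z ≡ arc x′ z′ × arc y z ≡ arc y′ z′
    arcs-≡ {x} {y} {z} {x′} {y′} {z′} 0<z 0<z′ s s′ eq with ≤-total (x′ * z) (x * z′)
    ... | inj₁ h = arcs-≡-≤ 0<z 0<z′ s s′ h eq
    ... | inj₂ h = let e , e′ = arcs-≡-≤ 0<z′ 0<z s′ s h (sym eq) in sym e , sym e′

    private
      -- If the difference exceeded one step, adding the lower bound 1 for `p ∸ q` to the lower
      -- bound `i` for `q` would give `suc i` for `p`, against the upper bound.
      near-≥ : ∀ α γ {p q W} i → i ^ N * (γ * W ^ N) ≤ k ^ N * (α * q ^ N) →
        k ^ N * (α * p ^ N) < suc i ^ N * (γ * W ^ N) → q ≤ p →
        k ^ N * α * (p ∸ q) ^ N ≤ γ * W ^ N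
      near-≥ α γ {p} {q} {W} i lo up q≤p with k ^ N * α * (p ∸ q) ^ N ≤? γ * W ^ N
      ... | yes h = h
      ... | no ¬h = contradiction
        (subst₂ (λ s t → s ^ N * C ≤ t ^ N * a) (+-comm i 1) (m+[n∸m]≡n q≤p)
          (^-superadditiveℕ N {a} {C} {q} {p ∸ q} {i} {1} (s≤s z≤n)
            (≤-trans lo (≤-reflexive (id₁ (k ^ N) α (q ^ N))))
            (≤-trans (≤-reflexive (trans (cong (_* C) (^-zeroˡ N)) (*-identityˡ C)))
              (≤-trans (<⇒≤ (≰⇒> ¬h)) (≤-reflexive (*-comm a ((p ∸ q) ^ N)))))))
        (<⇒≱ (subst (_< suc i ^ N * C) (id₁ (k ^ N) α (p ^ N)) up))
        where
        C = γ * W ^ N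
        a = k ^ N * α
        id₁ : ∀ x y z → x * (y * z) ≡ z * (x * y)
        id₁ = solve-∀

    abs-minor : ∀ {u w u′ w′} → u′ * w ≤ u * w′ → minor u w u′ w′ ≡ u * w′ ∸ u′ * w
    abs-minor {u} {w} {u′} {w′} h = trans
      (cong ℤ.∣_∣ (trans (cong₂ ℤ._-_ (sym (ℤ.pos-* u w′)) (sym (ℤ.pos-* u′ w))) (ℤ.m-n≡m⊖n (u * w′) (u′ * w))))
      (cong ℤ.∣_∣ (ℤ.⊖-≥ h))

    minor-sym : ∀ u w u′ w′ → minor u w u′ w′ ≡ minor u′ w′ u w
    minor-sym u w u′ w′ = ℤ.∣i-j∣≡∣j-i∣ (ℤ.+ u ℤ.* ℤ.+ w′) (ℤ.+ u′ ℤ.* ℤ.+ w)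

    private
      distrib : ∀ a b u c → a * (b * u ^ N) * c ^ N ≡ a * (b * (u * c) ^ N)
      distrib a b u c = trans (id₁ a b (u ^ N) (c ^ N)) (cong (λ t → a * (b * t)) (sym (^-*-distribℕ u c N)))
        where
        id₁ : ∀ a b x y → a * (b * x) * y ≡ a * (b * (x * y))
        id₁ = solve-∀

      lower : ∀ {α γ u w} c → arc (α * u ^ N) (γ * w ^ N) ^ N * (γ * (w * c) ^ N) ≤ k ^ N * (α * (u * c) ^ N)
      lower {α} {γ} {u} {w} c = subst₂ _≤_ (distrib (i ^ N) γ w c) (distrib (k ^ N) α u c)
        (*-monoˡ-≤ (c ^ N) (arc-lower (α * u ^ N) (γ * w ^ N)))
        where i = arc (α * u ^ N) (γ * w ^ N)

      upper : ∀ {α γ u w} c → 0 < k → 0 < c → α * u ^ N < γ * w ^ N →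
        k ^ N * (α * (u * c) ^ N) < suc (arc (α * u ^ N) (γ * w ^ N)) ^ N * (γ * (w * c) ^ N)
      upper {α} {γ} {u} {w} c 0<k 0<c x<z = subst₂ _<_ (distrib (k ^ N) α u c) (distrib (suc i ^ N) γ w c)
        (*-monoˡ-< (c ^ N) {{m^n≢0 c N {{>-nonZero 0<c}}}} (arc-upper 0<k x<z))
        where i = arc (α * u ^ N) (γ * w ^ N)

      -- Multiplying one point by `w′` and the other by `w` gives both the third coordinate
      -- `w * w′`, where `near-≥` compares them.
      near-oriented : ∀ {α γ u w u′ w′} → 0 < k → 0 < w′ → α * u ^ N < γ * w ^ N →
        arc (α * u ^ N) (γ * w ^ N) ≡ arc (α * u′ ^ N) (γ * w′ ^ N) → u′ * w ≤ u * w′ → Near n k α γ u w u′ w′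
      near-oriented {α} {γ} {u} {w} {u′} {w′} 0<k 0<w′ x<z eq h =
        subst (λ t → k ^ N * α * t ^ N ≤ γ * (w * w′) ^ N) (sym (abs-minor {u} {w} {u′} {w′} h))
          (near-≥ α γ {u * w′} {u′ * w} {w * w′} (arc (α * u ^ N) (γ * w ^ N))
            (subst₂ (λ i W → i ^ N * (γ * W ^ N) ≤ k ^ N * (α * (u′ * w) ^ N)) (sym eq) (*-comm w′ w)
              (lower {α} {γ} {u′} {w′} w))
            (upper {α} {γ} {u} {w} w′ 0<k 0<w′ x<z) h)

    near : ∀ {α γ u w u′ w′} → 0 < k → 0 < w → 0 < w′ → α * u ^ N < γ * w ^ N → α * u′ ^ N < γ * w′ ^ N →
      arc (α * u ^ N) (γ * w ^ N) ≡ arc (α * u′ ^ N) (γ * w′ ^ N) → Near n k α γ u w u′ w′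
    near {α} {γ} {u} {w} {u′} {w′} 0<k 0<w 0<w′ x<z x′<z′ eq with ≤-total (u′ * w) (u * w′)
    ... | inj₁ h = near-oriented {α} {γ} {u} {w} {u′} {w′} 0<k 0<w′ x<z eq h
    ... | inj₂ h = subst₂ (λ s t → k ^ N * α * s ^ N ≤ γ * t ^ N) (minor-sym u′ w′ u w) (*-comm w′ w)
      (near-oriented {α} {γ} {u′} {w′} {u} {w} 0<k 0<w x′<z′ (sym eq) h)

-- Tuples with bounded product, and maps with small fibres.

module Counting where

  open import Data.Nat
  open import Data.Nat.Properties
  open import Data.Nat.DivMod

  module _ {A : Set} where

    concatUpTo : ℕ → (ℕ → List A) → List A
    concatUpTo zero    f = []
    concatUpTo (suc n) f = f n ++ concatUpTo n f

    ∈-concatUpTo : ∀ {n i x} {f : ℕ → List A} → i < n → x ∈ f i → x ∈ concatUpTo n f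
    ∈-concatUpTo {suc n} {i} {f = f} i<1+n x∈ with m≤n⇒m<n∨m≡n (≤-pred i<1+n)
    ... | inj₁ i<n  = ∈-++⁺ʳ (f n) (∈-concatUpTo i<n x∈)
    ... | inj₂ refl = ∈-++⁺ˡ x∈

  sumUpTo : ℕ → (ℕ → ℕ) → ℕ
  sumUpTo zero    f = 0
  sumUpTo (suc n) f = f n + sumUpTo n f

  length-concatUpTo : ∀ {A : Set} n (f : ℕ → List A) → length (concatUpTo n f) ≡ sumUpTo n (length ∘ f)
  length-concatUpTo zero    f = refl
  length-concatUpTo (suc n) f = trans (length-++ (f n)) (cong (length (f n) +_) (length-concatUpTo n f))

  sumUpTo-mono : ∀ n {f g : ℕ → ℕ} → (∀ i → f i ≤ g i) → sumUpTo n f ≤ sumUpTo n g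
  sumUpTo-mono zero    h = z≤n
  sumUpTo-mono (suc n) h = +-mono-≤ (h n) (sumUpTo-mono n h)

  sumUpTo-*ʳ : ∀ n f c → sumUpTo n (λ i → f i * c) ≡ sumUpTo n f * c
  sumUpTo-*ʳ zero    f c = refl
  sumUpTo-*ʳ (suc n) f c = trans (cong (f n * c +_) (sumUpTo-*ʳ n f c)) (sym (*-distribʳ-+ c (f n) (sumUpTo n f)))

  sumUpTo-const : ∀ n c → sumUpTo n (λ _ → c) ≡ n * c
  sumUpTo-const zero    c = refl
  sumUpTo-const (suc n) c = cong (c +_) (sumUpTo-const n c)

  sumUpTo-+ : ∀ m n f c → (∀ i → m ≤ i → f i ≤ c) → sumUpTo (n + m) f ≤ n * c + sumUpTo m f
  sumUpTo-+ m zero    f c h = ≤-refl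
  sumUpTo-+ m (suc n) f c h = ≤-trans (+-mono-≤ (h (n + m) (m≤n+m m n)) (sumUpTo-+ m n f c h))
    (≤-reflexive (sym (+-assoc c (n * c) (sumUpTo m f))))

  -- Dyadic blocks: each of the `2 ^ H` new terms is at most `T / 2 ^ H`, so doubling the range adds
  -- at most `T`. The form `suc (pred (2 ^ H))` exhibits the divisor as a successor.
  harmonic : ∀ T H → sumUpTo (2 ^ H) (λ i → T / suc i) ≤ T * suc H
  harmonic T zero = ≤-reflexive (trans (+-identityʳ (T / 1)) (trans (n/1≡n T) (sym (*-identityʳ T))))
  harmonic T (suc H) = begin
    sumUpTo (2 ^ suc H) f                   ≡⟨ cong (λ t → sumUpTo (2 ^ H + t) f) (+-identityʳ (2 ^ H)) ⟩
    sumUpTo (2 ^ H + 2 ^ H) f               ≤⟨ sumUpTo-+ (2 ^ H) (2 ^ H) f (T / suc (pred (2 ^ H))) (λ i h → /-antimono T i (≤-trans pred[n]≤n h)) ⟩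
    2 ^ H * (T / suc (pred (2 ^ H))) + sumUpTo (2 ^ H) f
      ≤⟨ +-mono-≤ (≤-trans (≤-reflexive (cong (_* (T / suc (pred (2 ^ H)))) (sym (suc-pred (2 ^ H) {{m^n≢0 2 H}}))))
           (≤-trans (≤-reflexive (*-comm (suc (pred (2 ^ H))) _)) (m/n*n≤m T (suc (pred (2 ^ H)))))) (harmonic T H) ⟩
    T + T * suc H                           ≡⟨ *-suc T (suc H) ⟨
    T * suc (suc H)                         ∎
    where
    open ≤-Reasoning
    f : ℕ → ℕ
    f i = T / suc i
    /-antimono : ∀ T i {m} → m ≤ i → T / suc i ≤ T / suc m
    /-antimono T i {m} m≤i = ≤-trans (≤-reflexive (sym (m*n/n≡m (T / suc i) (suc m))))
      (/-monoˡ-≤ (suc m) (≤-trans (*-monoʳ-≤ (T / suc i) (s≤s m≤i)) (m/n*n≤m T (suc i))))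

  ∏ : ∀ {k} → Vec ℕ k → ℕ
  ∏ []      = 1
  ∏ (d ∷ v) = d * ∏ v

  module _ (H : ℕ) where

    -- The range 2 ^ H is the same at every level, so that the harmonic sum is bounded once.
    tuples : ∀ k → ℕ → List (Vec ℕ (suc k))
    tuples zero    T = concatUpTo T λ i → (suc i ∷ []) ∷ []
    tuples (suc k) T = concatUpTo (2 ^ H) λ i → map (suc i ∷_) (tuples k (T / suc i))

    length-tuples : ∀ k T → length (tuples k T) ≤ T * suc H ^ k
    length-tuples zero T = ≤-reflexive (trans (length-concatUpTo T _) (sumUpTo-const T 1))
    length-tuples (suc k) T = begin
      length (tuples (suc k) T)                                          ≡⟨ length-concatUpTo (2 ^ H) _ ⟩
      sumUpTo (2 ^ H) (λ i → length (map (suc i ∷_) (tuples k (T / suc i))))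
        ≤⟨ sumUpTo-mono (2 ^ H) (λ i → ≤-trans (≤-reflexive (length-map (suc i ∷_) (tuples k (T / suc i)))) (length-tuples k (T / suc i))) ⟩
      sumUpTo (2 ^ H) (λ i → T / suc i * suc H ^ k)                      ≡⟨ sumUpTo-*ʳ (2 ^ H) (λ i → T / suc i) (suc H ^ k) ⟩
      sumUpTo (2 ^ H) (λ i → T / suc i) * suc H ^ k                      ≤⟨ *-monoˡ-≤ (suc H ^ k) (harmonic T H) ⟩
      T * suc H * suc H ^ k                                              ≡⟨ *-assoc T (suc H) (suc H ^ k) ⟩
      T * suc H ^ suc k                                                  ∎
      where open ≤-Reasoning

    ∈-tuples : ∀ {k T} {v : Vec ℕ (suc k)} → T ≤ 2 ^ H → VAll.All (0 <_) v → ∏ v ≤ T → v ∈ tuples k T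
    ∈-tuples {v = zero ∷ _} _ (() ∷ _) _
    ∈-tuples {zero} {T} {suc d ∷ []} T≤ _ h = ∈-concatUpTo {f = λ i → (suc i ∷ []) ∷ []} (subst (_≤ T) (*-identityʳ (suc d)) h) (here refl)
    ∈-tuples {suc k} {T} {suc d ∷ v} T≤ (_ ∷ v>0) h =
      ∈-concatUpTo {f = λ i → map (suc i ∷_) (tuples k (T / suc i))} (≤-trans (≤-trans (m≤m*n (suc d) (∏ v) {{>-nonZero (∏-pos v>0)}}) h) T≤)
        (∈-map⁺ (suc d ∷_) (∈-tuples (≤-trans T/d≤T T≤) v>0 (≤-trans (≤-reflexive (sym (m*n/n≡m (∏ v) (suc d))))
          (/-monoˡ-≤ (suc d) (subst (_≤ T) (*-comm (suc d) (∏ v)) h)))))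
      where
      ∏-pos : ∀ {k} {v : Vec ℕ k} → VAll.All (0 <_) v → 0 < ∏ v
      ∏-pos []        = s≤s z≤n
      ∏-pos (p ∷ ps)  = *-mono-< p (∏-pos ps)
      T/d≤T : T / suc d ≤ T
      T/d≤T = ≤-trans (m≤m*n (T / suc d) (suc d)) (m/n*n≤m T (suc d))

  module _ {A : Set} {P : A → Set} (P? : ∀ x → Dec (P x)) where

    length-filter-¬ : ∀ xs → length xs ≡ length (filter P? xs) + length (filter (¬? ∘ P?) xs)
    length-filter-¬ [] = refl
    length-filter-¬ (x ∷ xs) with P? x
    ... | yes _ = cong suc (length-filter-¬ xs)
    ... | no  _ = trans (cong suc (length-filter-¬ xs)) (sym (+-suc _ _))

  module _ {A B : Set} (_≟ᴮ_ : DecidableEquality B) (f : A → B) where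

    NoTriple : List A → Set
    NoTriple xs = ∀ {x y z} → x ∈ xs → y ∈ xs → z ∈ xs → x ≢ y → x ≢ z → y ≢ z → f x ≡ f y → f x ≡ f z → ⊥

    -- Pigeonhole principle for fibres of at most two elements, by removing the fibre of one value
    -- at a time.
    length≤2* : ∀ ys {xs} → Unique xs → (∀ {x} → x ∈ xs → f x ∈ ys) → NoTriple xs → length xs ≤ 2 * length ys
    length≤2* [] {[]}    _ _ _ = z≤n
    length≤2* [] {x ∷ _} _ f∈ _ with () ← f∈ (here refl)
    length≤2* (y ∷ ys) {xs} uniq f∈ noTriple = begin
      length xs                                            ≡⟨ length-filter-¬ P? xs ⟩
      length (filter P? xs) + length (filter (¬? ∘ P?) xs)
        ≤⟨ +-mono-≤
             (fibre (filter P? xs) (Unique.filter⁺ P? uniq) (∈-filter⁻ P? {xs = xs}))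
             (length≤2* ys (Unique.filter⁺ (¬? ∘ P?) uniq)
               (λ x∈ → let x∈xs , fx≢y = ∈-filter⁻ (¬? ∘ P?) {xs = xs} x∈ in tail (f∈ x∈xs) fx≢y)
               (λ a b c → noTriple (sub a) (sub b) (sub c))) ⟩
      2 + 2 * length ys                                    ≡⟨ *-suc 2 (length ys) ⟨
      2 * suc (length ys)                                  ∎
      where
      open ≤-Reasoning
      P? : ∀ x → Dec (f x ≡ y)
      P? x = f x ≟ᴮ y
      sub : ∀ {x} → x ∈ filter (¬? ∘ P?) xs → x ∈ xs
      sub x∈ = proj₁ (∈-filter⁻ (¬? ∘ P?) {xs = xs} x∈)
      tail : ∀ {b} → b ∈ y ∷ ys → b ≢ y → b ∈ ys
      tail (here b≡y) b≢y = contradiction b≡y b≢y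
      tail (there b∈) _   = b∈
      fibre : ∀ zs → Unique zs → (∀ {x} → x ∈ zs → x ∈ xs × f x ≡ y) → length zs ≤ 2
      fibre [] _ _ = z≤n
      fibre (_ ∷ []) _ _ = s≤s z≤n
      fibre (_ ∷ _ ∷ []) _ _ = ≤-refl
      fibre (a ∷ b ∷ c ∷ _) ((a≢b ∷ a≢c ∷ _) ∷ (b≢c ∷ _) ∷ _) h =
        let a∈ , fa = h (here refl)
            b∈ , fb = h (there (here refl))
            c∈ , fc = h (there (there (here refl)))
        in ⊥-elim (noTriple a∈ b∈ c∈ a≢b a≢c b≢c (trans fa (sym fb)) (trans fa (sym fc)))

-- No three solutions share a signature.

module ThreePoints where

  open import Data.Integer hiding (suc) renaming (∣_∣ to abs)
  open import Data.Integer.Properties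
  open import Data.Integer.Divisibility.Signed
  open import Data.Integer.Tactic.RingSolver using (solve-∀)
  open LocalRoots
  open CommonClasses
  open Determinant
  open Arcs

  -- The `m` are the bases of the coefficients, so that either of the two factors of a squareful
  -- number can take the part of the unknown. Coprimality of the products `m u` covers coefficients
  -- and unknowns at once.
  record Solution (n : Exponent) (M m₀ m₁ m₂ u v w : ℕ) : Set where
    field
      0<m₀ : 0 ℕ.< m₀
      0<m₁ : 0 ℕ.< m₁
      0<m₂ : 0 ℕ.< m₂
      0<u  : 0 ℕ.< u
      0<v  : 0 ℕ.< v
      0<w  : 0 ℕ.< w
      ⟂₀₁  : (m₀ ℕ.* u) ⟂ (m₁ ℕ.* v)
      ⟂₀₂  : (m₀ ℕ.* u) ⟂ (m₂ ℕ.* w)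
      ⟂₁₂  : (m₁ ℕ.* v) ⟂ (m₂ ℕ.* w)
      equation : OnCurve₂ n (m₀ ℕ.^ cof n) (m₁ ℕ.^ cof n) (m₂ ℕ.^ cof n) u v w
      bound : m₂ ℕ.^ cof n ℕ.* w ℕ.^ deg n ℕ.≤ M

  ⟂-sub : ∀ {a b c d} → a ℕ.∣ c → b ℕ.∣ d → c ⟂ d → a ⟂ b
  ⟂-sub a∣c b∣d c⟂d p pp p∣a p∣b = c⟂d p pp (ℕ.∣-trans p∣a a∣c) (ℕ.∣-trans p∣b b∣d)

  ^-⟂ʳ : ∀ {a b} k → a ⟂ b → a ⟂ (b ℕ.^ k)
  ^-⟂ʳ {b = b} k a⟂b p pp p∣a p∣bᵏ = a⟂b p pp p∣a (prime∣^⇒∣ b k pp p∣bᵏ)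

  ^-⟂ : ∀ {a b} k → a ⟂ b → (a ℕ.^ k) ⟂ (b ℕ.^ k)
  ^-⟂ {a} {b} k a⟂b p pp p∣aᵏ p∣bᵏ = a⟂b p pp (prime∣^⇒∣ a k pp p∣aᵏ) (prime∣^⇒∣ b k pp p∣bᵏ)

  %-≡⇒∣ : ∀ {u u′} → u ℕ.% 4 ≡ u′ ℕ.% 4 → + 4 ∣ + u - + u′
  %-≡⇒∣ {u} {u′} eq = divides (+ (u ℕ./ 4) - + (u′ ℕ./ 4)) (trans (cong₂ _-_ (expand u) (expand u′))
    (trans (cong (λ r → (+ (u ℕ.% 4) + + (u ℕ./ 4) * + 4) - (+ r + + (u′ ℕ./ 4) * + 4)) (sym eq))
      (identity (+ (u ℕ.% 4)) (+ (u ℕ./ 4)) (+ (u′ ℕ./ 4)))))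
    where
    expand : ∀ u → + u ≡ + (u ℕ.% 4) + + (u ℕ./ 4) * + 4
    expand u = trans (cong +_ (ℕ.m≡m%n+[m/n]*n u 4)) (cong (λ t → + (u ℕ.% 4) + t) (pos-* (u ℕ./ 4) 4))
    identity : ∀ r a b → (r + a * + 4) - (r + b * + 4) ≡ (a - b) * + 4
    identity = solve-∀

  minor-%4 : ∀ {u v u′ v′} → u ℕ.% 4 ≡ u′ ℕ.% 4 → v ℕ.% 4 ≡ v′ ℕ.% 4 → + 4 ∣ + u * + v′ - + u′ * + v
  minor-%4 {u} {v} {u′} {v′} eqᵤ eqᵥ = subst (+ 4 ∣_) (identity (+ u) (+ v) (+ u′) (+ v′))
    (∣m∣n⇒∣m-n (∣n⇒∣m*n (+ v) (%-≡⇒∣ {u} {u′} eqᵤ)) (∣n⇒∣m*n (+ u) (%-≡⇒∣ {v} {v′} eqᵥ)))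
    where
    identity : ∀ u v u′ v′ → v * (u - u′) - u * (v - v′) ≡ u * v′ - u′ * v
    identity = solve-∀

  ^-injective-deg : ∀ n {a b} → a ℕ.^ deg n ≡ b ℕ.^ deg n → a ≡ b
  ^-injective-deg n {a} {b} eq with ℕ.<-cmp a b
  ... | tri< a<b _ _ = contradiction eq (ℕ.<⇒≢ (^-mono-<-deg n a<b))
  ... | tri≈ _ a≡b _ = a≡b
  ... | tri> _ _ b<a = contradiction (sym eq) (ℕ.<⇒≢ (^-mono-<-deg n b<a))

  module Fixed (n : Exponent) (M k m₀ m₁ m₂ : ℕ) where

    private
      N = deg n
      α = m₀ ℕ.^ cof n
      β = m₁ ℕ.^ cof n
      γ = m₂ ℕ.^ cof n

    open Arc n k

    Signature : Set
    Signature = ((ℕ × ℕ × ℕ) × (ℕ × ℕ × ℕ) × (ℕ × ℕ × ℕ)) × (ℕ × ℕ × ℕ) × ℕ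

    -- Points of equal signature agree in the ratio of any two coordinates modulo
    -- every prime dividing the coefficient of the third one.
    signature : (u v w : ℕ) → Signature
    signature u v w =
      (ratioSlots n m₀ (+ β) (- + γ) v w , ratioSlots n m₁ (+ α) (- + γ) u w , ratioSlots n m₂ (+ α) (+ β) u v) ,
      -- Equal residues modulo 4 make all minors of two points divisible by 4, which is what the
      -- lifting step needs at the prime 2.
      (u ℕ.% 4 , v ℕ.% 4 , w ℕ.% 4) , arcCode (α ℕ.* u ℕ.^ N) (β ℕ.* v ℕ.^ N) (γ ℕ.* w ℕ.^ N)

    module OfSolution {u v w} (s : Solution n M m₀ m₁ m₂ u v w) where
      open Solution s public

      m₀≢0 : m₀ ≢ 0
      m₀≢0 = ℕ.m<n⇒n≢0 0<m₀
      m₁≢0 : m₁ ≢ 0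
      m₁≢0 = ℕ.m<n⇒n≢0 0<m₁
      m₂≢0 : m₂ ≢ 0
      m₂≢0 = ℕ.m<n⇒n≢0 0<m₂

      0<^ : ∀ {a} k → 0 ℕ.< a → 0 ℕ.< a ℕ.^ k
      0<^ {a} k 0<a = ℕ.m^n>0 a {{ℕ.>-nonZero 0<a}} k

      0<α : 0 ℕ.< α
      0<α = 0<^ (cof n) 0<m₀
      0<β : 0 ℕ.< β
      0<β = 0<^ (cof n) 0<m₁
      0<γ : 0 ℕ.< γ
      0<γ = 0<^ (cof n) 0<m₂

      m₀⟂m₁ = ⟂-sub (ℕ.m∣m*n {m₀} u) (ℕ.m∣m*n {m₁} v) ⟂₀₁
      m₀⟂m₂ = ⟂-sub (ℕ.m∣m*n {m₀} u) (ℕ.m∣m*n {m₂} w) ⟂₀₂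
      m₁⟂m₂ = ⟂-sub (ℕ.m∣m*n {m₁} v) (ℕ.m∣m*n {m₂} w) ⟂₁₂
      m₀⟂v  = ⟂-sub (ℕ.m∣m*n {m₀} u) (ℕ.n∣m*n m₁ {v}) ⟂₀₁
      m₀⟂w  = ⟂-sub (ℕ.m∣m*n {m₀} u) (ℕ.n∣m*n m₂ {w}) ⟂₀₂
      m₁⟂u  = ⟂-sub (ℕ.m∣m*n {m₁} v) (ℕ.n∣m*n m₀ {u}) (⟂-sym ⟂₀₁)
      m₁⟂w  = ⟂-sub (ℕ.m∣m*n {m₁} v) (ℕ.n∣m*n m₂ {w}) ⟂₁₂
      m₂⟂u  = ⟂-sub (ℕ.m∣m*n {m₂} w) (ℕ.n∣m*n m₀ {u}) (⟂-sym ⟂₀₂)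
      m₂⟂v  = ⟂-sub (ℕ.m∣m*n {m₂} w) (ℕ.n∣m*n m₁ {v}) (⟂-sym ⟂₁₂)
      u⟂w   = ⟂-sub (ℕ.n∣m*n m₀ {u}) (ℕ.n∣m*n m₂ {w}) ⟂₀₂

      private
        X = + α * (+ u) ^ N
        Y = + β * (+ v) ^ N
        Z = + γ * (+ w) ^ N

        equation-ℤ : X + Y ≡ Z
        equation-ℤ = trans (sym (cong₂ _+_ (pos-*^ α u N) (pos-*^ β v N)))
          (trans (cong +_ equation) (pos-*^ γ w N))

      -- Modulo `α` the equation involves `v` and `w` only; the other two coefficients are treated
      -- alike.
      local₀ : Modulus.Local n m₀≢0 (+ β) (- + γ) v w
      local₀ = Modulus.local m₀⟂v m₀⟂w (subst (+ α ∣_)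
        (trans (id₁ (+ α) ((+ u) ^ N) Y) (trans (cong (λ t → Y - t) equation-ℤ) (id₂ Y (+ γ) ((+ w) ^ N))))
        (∣m⇒∣m*n (- (+ u) ^ N) (∣-refl {+ α})))
        where
        id₁ : ∀ a x y → a * (- x) ≡ y - (a * x + y)
        id₁ = solve-∀
        id₂ : ∀ y c z → y - c * z ≡ y + - c * z
        id₂ = solve-∀

      local₁ : Modulus.Local n m₁≢0 (+ α) (- + γ) u w
      local₁ = Modulus.local m₁⟂u m₁⟂w (subst (+ β ∣_)
        (trans (id₁ (+ β) ((+ v) ^ N) X) (trans (cong (λ t → X - t) equation-ℤ) (id₂ X (+ γ) ((+ w) ^ N))))
        (∣m⇒∣m*n (- (+ v) ^ N) (∣-refl {+ β})))
        where
        id₁ : ∀ a x y → a * (- x) ≡ y - (y + a * x)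
        id₁ = solve-∀
        id₂ : ∀ y c z → y - c * z ≡ y + - c * z
        id₂ = solve-∀

      local₂ : Modulus.Local n m₂≢0 (+ α) (+ β) u v
      local₂ = Modulus.local m₂⟂u m₂⟂v (subst (+ γ ∣_) (sym equation-ℤ) (∣m⇒∣m*n ((+ w) ^ N) (∣-refl {+ γ})))

      x<z : α ℕ.* u ℕ.^ N ℕ.< γ ℕ.* w ℕ.^ N
      x<z = subst (α ℕ.* u ℕ.^ N ℕ.<_) equation (ℕ.m<m+n _ (ℕ.*-mono-< 0<β (0<^ N 0<v)))

      y<z : β ℕ.* v ℕ.^ N ℕ.< γ ℕ.* w ℕ.^ N
      y<z = subst (β ℕ.* v ℕ.^ N ℕ.<_) equation (ℕ.m<n+m _ (ℕ.*-mono-< 0<α (0<^ N 0<u)))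

      0<z : 0 ℕ.< γ ℕ.* w ℕ.^ N
      0<z = ℕ.*-mono-< 0<γ (0<^ N 0<w)

    module Pair (0<k : 0 ℕ.< k) {u v w u′ v′ w′}
      (s : Solution n M m₀ m₁ m₂ u v w) (s′ : Solution n M m₀ m₁ m₂ u′ v′ w′) where
      private
        module S = OfSolution s
        module S′ = OfSolution s′

      -- Both `u / w` and `u′ / w′` are in lowest terms, so equal fractions have equal entries; the
      -- equation then determines `v`.
      proportional⇒≡ : u ℕ.* w′ ≡ u′ ℕ.* w → (u , v , w) ≡ (u′ , v′ , w′)
      proportional⇒≡ eq = cong₂ _,_ u≡u′ (cong₂ _,_ v≡v′ w≡w′)
        where
        u≡u′ : u ≡ u′
        u≡u′ = ℕ.∣-antisym
          (coprime-divisor (⟂⇒coprime (ℕ.m<n⇒n≢0 S.0<u) S.u⟂w) (ℕ.divides w′ (trans (ℕ.*-comm w u′) (trans (sym eq) (ℕ.*-comm u w′)))))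
          (coprime-divisor (⟂⇒coprime (ℕ.m<n⇒n≢0 S′.0<u) S′.u⟂w) (ℕ.divides w (trans (ℕ.*-comm w′ u) (trans eq (ℕ.*-comm u′ w)))))
        w≡w′ : w ≡ w′
        w≡w′ = sym (ℕ.*-cancelˡ-≡ w′ w u {{ℕ.>-nonZero S.0<u}} (trans eq (cong (ℕ._* w) (sym u≡u′))))
        v≡v′ : v ≡ v′
        v≡v′ = ^-injective-deg n (ℕ.*-cancelˡ-≡ (v ℕ.^ N) (v′ ℕ.^ N) β {{ℕ.>-nonZero S.0<β}}
          (ℕ.+-cancelˡ-≡ (α ℕ.* u ℕ.^ N) _ _ (trans S.equation
            (trans (cong (λ t → γ ℕ.* t ℕ.^ N) w≡w′) (trans (sym S′.equation)
              (cong (λ t → α ℕ.* t ℕ.^ N ℕ.+ β ℕ.* v′ ℕ.^ N) (sym u≡u′)))))))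

      module _ (eq : signature u v w ≡ signature u′ v′ w′) where
        private
          eq-u = cong (proj₁ ∘ proj₁ ∘ proj₂) eq
          eq-v = cong (proj₁ ∘ proj₂ ∘ proj₁ ∘ proj₂) eq
          eq-w = cong (proj₂ ∘ proj₂ ∘ proj₁ ∘ proj₂) eq
          arcs = arcs-≡ S.0<z S′.0<z S.equation S′.equation (cong (proj₂ ∘ proj₂) eq)

        ∣minor₀ : + α ∣ + N * (+ v * + w′ - + v′ * + w)
        ∣minor₀ = Modulus.minor-∣ n S.m₀≢0 (+ β) (- + γ)
          (^-⟂ʳ (cof n) S.m₀⟂m₁)
          S.local₀ S′.local₀ (cong (proj₁ ∘ proj₁) eq) (minor-%4 {v} {w} {v′} {w′} eq-v eq-w)

        ∣minor₁ : + β ∣ + N * (+ u * + w′ - + u′ * + w)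
        ∣minor₁ = Modulus.minor-∣ n S.m₁≢0 (+ α) (- + γ) (^-⟂ʳ (cof n) (⟂-sym S.m₀⟂m₁))
          S.local₁ S′.local₁ (cong (proj₁ ∘ proj₂ ∘ proj₁) eq) (minor-%4 {u} {w} {u′} {w′} eq-u eq-w)

        ∣minor₂ : + γ ∣ + N * (+ u * + v′ - + u′ * + v)
        ∣minor₂ = Modulus.minor-∣ n S.m₂≢0 (+ α) (+ β) (^-⟂ʳ (cof n) (⟂-sym S.m₀⟂m₂))
          S.local₂ S′.local₂ (cong (proj₂ ∘ proj₂ ∘ proj₁) eq) (minor-%4 {u} {v} {u′} {v′} eq-u eq-v)

        near₀ : Near n k α γ u w u′ w′
        near₀ = near {α} {γ} {u} {w} {u′} {w′} 0<k S.0<w S′.0<w S.x<z S′.x<z (proj₁ arcs)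

        near₁ : Near n k β γ v w v′ w′
        near₁ = near {β} {γ} {v} {w} {v′} {w′} 0<k S.0<w S′.0<w S.y<z S′.y<z (proj₂ arcs)

    ∣-combination : ∀ {c} x y z a b d → c ∣ + N * a → c ∣ + N * b → c ∣ + N * d → c ∣ + N * (x * a - y * b + z * d)
    ∣-combination {c} x y z a b d ha hb hd = subst (c ∣_) (identity (+ N) x y z a b d)
      (∣m∣n⇒∣m+n (∣m∣n⇒∣m-n (∣n⇒∣m*n x ha) (∣n⇒∣m*n y hb)) (∣n⇒∣m*n z hd))
      where
      identity : ∀ N x y z a b d → x * (N * a) - y * (N * b) + z * (N * d) ≡ N * (x * a - y * b + z * d)
      identity = solve-∀

    module Triple (0<k : 0 ℕ.< k) {u₁ v₁ w₁ u₂ v₂ w₂ u₃ v₃ w₃}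
      (s₁ : Solution n M m₀ m₁ m₂ u₁ v₁ w₁) (s₂ : Solution n M m₀ m₁ m₂ u₂ v₂ w₂) (s₃ : Solution n M m₀ m₁ m₂ u₃ v₃ w₃)
      (≢₁₂ : (u₁ , v₁ , w₁) ≢ (u₂ , v₂ , w₂)) (≢₁₃ : (u₁ , v₁ , w₁) ≢ (u₃ , v₃ , w₃)) (≢₂₃ : (u₂ , v₂ , w₂) ≢ (u₃ , v₃ , w₃))
      (eq₁₂ : signature u₁ v₁ w₁ ≡ signature u₂ v₂ w₂) (eq₁₃ : signature u₁ v₁ w₁ ≡ signature u₃ v₃ w₃) where

      private
        module S₁ = OfSolution s₁
        module S₂ = OfSolution s₂
        module S₃ = OfSolution s₃
        module P₁₂ = Pair 0<k s₁ s₂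
        module P₁₃ = Pair 0<k s₁ s₃
        module P₂₃ = Pair 0<k s₂ s₃
        eq₂₃ : signature u₂ v₂ w₂ ≡ signature u₃ v₃ w₃
        eq₂₃ = trans (sym eq₁₂) eq₁₃
        D = detℕ u₁ v₁ w₁ u₂ v₂ w₂ u₃ v₃ w₃
        d = abs D

      D≢0 : D ≢ 0ℤ
      D≢0 = det≢0 n {α} {β} {γ} S₁.0<α S₁.0<β S₂.0<u S₂.0<v S₃.0<u S₃.0<v S₁.0<w S₂.0<w S₃.0<w
        S₁.equation S₂.equation S₃.equation
        (≢₁₂ ∘ P₁₂.proportional⇒≡) (≢₁₃ ∘ P₁₃.proportional⇒≡) (≢₂₃ ∘ P₂₃.proportional⇒≡)

      private
        α∣ND : + α ∣ + N * D
        α∣ND = subst (λ t → + α ∣ + N * t) (expand (+ u₁) (+ v₁) (+ w₁) (+ u₂) (+ v₂) (+ w₂) (+ u₃) (+ v₃) (+ w₃))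
          (∣-combination (+ u₁) (+ u₂) (+ u₃) _ _ _ (P₂₃.∣minor₀ eq₂₃) (P₁₃.∣minor₀ eq₁₃) (P₁₂.∣minor₀ eq₁₂))
          where
          expand : ∀ u₁ v₁ w₁ u₂ v₂ w₂ u₃ v₃ w₃ →
            u₁ * (v₂ * w₃ - v₃ * w₂) - u₂ * (v₁ * w₃ - v₃ * w₁) + u₃ * (v₁ * w₂ - v₂ * w₁) ≡
            u₁ * (v₂ * w₃ - v₃ * w₂) - v₁ * (u₂ * w₃ - u₃ * w₂) + w₁ * (u₂ * v₃ - u₃ * v₂)
          expand = solve-∀
        β∣ND : + β ∣ + N * D
        β∣ND = subst (λ t → + β ∣ + N * t) (expand (+ u₁) (+ v₁) (+ w₁) (+ u₂) (+ v₂) (+ w₂) (+ u₃) (+ v₃) (+ w₃))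
          (∣-combination (- + v₁) (- + v₂) (- + v₃) _ _ _ (P₂₃.∣minor₁ eq₂₃) (P₁₃.∣minor₁ eq₁₃) (P₁₂.∣minor₁ eq₁₂))
          where
          expand : ∀ u₁ v₁ w₁ u₂ v₂ w₂ u₃ v₃ w₃ →
            - v₁ * (u₂ * w₃ - u₃ * w₂) - - v₂ * (u₁ * w₃ - u₃ * w₁) + - v₃ * (u₁ * w₂ - u₂ * w₁) ≡
            u₁ * (v₂ * w₃ - v₃ * w₂) - v₁ * (u₂ * w₃ - u₃ * w₂) + w₁ * (u₂ * v₃ - u₃ * v₂)
          expand = solve-∀
        γ∣ND : + γ ∣ + N * D
        γ∣ND = subst (λ t → + γ ∣ + N * t) (expand (+ u₁) (+ v₁) (+ w₁) (+ u₂) (+ v₂) (+ w₂) (+ u₃) (+ v₃) (+ w₃))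
          (∣-combination (+ w₁) (+ w₂) (+ w₃) _ _ _ (P₂₃.∣minor₂ eq₂₃) (P₁₃.∣minor₂ eq₁₃) (P₁₂.∣minor₂ eq₁₂))
          where
          expand : ∀ u₁ v₁ w₁ u₂ v₂ w₂ u₃ v₃ w₃ →
            w₁ * (u₂ * v₃ - u₃ * v₂) - w₂ * (u₁ * v₃ - u₃ * v₁) + w₃ * (u₁ * v₂ - u₂ * v₁) ≡
            u₁ * (v₂ * w₃ - v₃ * w₂) - v₁ * (u₂ * w₃ - u₃ * w₂) + w₁ * (u₂ * v₃ - u₃ * v₂)
          expand = solve-∀

        α⟂β : α ⟂ β
        α⟂β = ^-⟂ (cof n) S₁.m₀⟂m₁

        αβ⟂γ : (α ℕ.* β) ⟂ γ
        αβ⟂γ p pp p∣αβ p∣γ with euclidsLemma α β pp p∣αβ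
        ... | inj₁ p∣α = ^-⟂ (cof n) S₁.m₀⟂m₂ p pp p∣α p∣γ
        ... | inj₂ p∣β = ^-⟂ (cof n) S₁.m₁⟂m₂ p pp p∣β p∣γ

      -- Expanding along a column, whose cofactors are the minors of the other two, shows that the
      -- coefficient of that column divides `N * D`. The coefficients are pairwise coprime, so their
      -- product divides it too, and `D` is nonzero.
      αβγ≤ : α ℕ.* β ℕ.* γ ℕ.≤ N ℕ.* d
      αβγ≤ = ℕ.∣⇒≤ {{ℕ.≢-nonZero Nd≢0}} (⟂-∣* (ℕ.m<n⇒n≢0 (ℕ.*-mono-< S₁.0<α S₁.0<β)) αβ⟂γ
        (⟂-∣* (ℕ.m<n⇒n≢0 S₁.0<α) α⟂β (toℕ α∣ND) (toℕ β∣ND)) (toℕ γ∣ND))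
        where
        toℕ : ∀ {c} → + c ∣ + N * D → c ℕ.∣ N ℕ.* d
        toℕ {c} h = subst (c ℕ.∣_) (abs-* (+ N) D) (∣⇒∣ᵤ {+ c} {+ N * D} h)
        0<N : ∀ n → 0 ℕ.< deg n
        0<N two   = ℕ.s≤s ℕ.z≤n
        0<N three = ℕ.s≤s ℕ.z≤n
        Nd≢0 : N ℕ.* d ≢ 0
        Nd≢0 eq with ℕ.m*n≡0⇒m≡0∨n≡0 N eq
        ... | inj₁ N≡0 = ℕ.m<n⇒n≢0 (0<N n) N≡0
        ... | inj₂ d≡0 = D≢0 (∣i∣≡0⇒i≡0 d≡0)

      zzz≤ : γ ℕ.* w₁ ℕ.^ N ℕ.* (γ ℕ.* w₂ ℕ.^ N) ℕ.* (γ ℕ.* w₃ ℕ.^ N) ℕ.≤ M ℕ.* M ℕ.* M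
      zzz≤ = ℕ.*-mono-≤ (ℕ.*-mono-≤ S₁.bound S₂.bound) S₃.bound

  -- With `Π` the product of the coefficients, `Π ≤ N |D|` and the arc bounds give
  -- `k⁶ Π³ ≤ 4 * 2 M³` for the conic and `k⁶ Π⁴ ≤ 27 * 8 M³` for the cubic; 216 is the larger
  -- constant. As `Π` is `Y³` or `Y²`, the left side is `k⁶ Y⁹` or `k⁶ Y⁸`, which is at least
  -- `(k Y)⁶`.
  no-triple : ∀ n {M k m₀ m₁ m₂ u₁ v₁ w₁ u₂ v₂ w₂ u₃ v₃ w₃} → 216 ℕ.* (M ℕ.* M ℕ.* M) ℕ.< (k ℕ.* (m₀ ℕ.* m₁ ℕ.* m₂)) ℕ.^ 6 →
    Solution n M m₀ m₁ m₂ u₁ v₁ w₁ → Solution n M m₀ m₁ m₂ u₂ v₂ w₂ → Solution n M m₀ m₁ m₂ u₃ v₃ w₃ →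
    (u₁ , v₁ , w₁) ≢ (u₂ , v₂ , w₂) → (u₁ , v₁ , w₁) ≢ (u₃ , v₃ , w₃) → (u₂ , v₂ , w₂) ≢ (u₃ , v₃ , w₃) →
    let open Fixed n M k m₀ m₁ m₂ in
    signature u₁ v₁ w₁ ≡ signature u₂ v₂ w₂ → signature u₁ v₁ w₁ ≡ signature u₃ v₃ w₃ → ⊥
  no-triple n {M} {zero} () s₁ s₂ s₃ ≢₁₂ ≢₁₃ ≢₂₃ eq₁₂ eq₁₃
  no-triple two {M} {k@(suc _)} {m₀} {m₁} {m₂} {u₁} {v₁} {w₁} {u₂} {v₂} {w₂} {u₃} {v₃} {w₃} M³< s₁ s₂ s₃ ≢₁₂ ≢₁₃ ≢₂₃ eq₁₂ eq₁₃ =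
    ℕ.<⇒≱ M³< (begin
      (k ℕ.* Y) ℕ.^ 6                      ≤⟨ ℕ.m≤m*n ((k ℕ.* Y) ℕ.^ 6) (Y ℕ.* Y ℕ.* Y) {{ℕ.>-nonZero 0<Y³}} ⟩
      (k ℕ.* Y) ℕ.^ 6 ℕ.* (Y ℕ.* Y ℕ.* Y)  ≡⟨ id₁ k m₀ m₁ m₂ ⟩
      k ℕ.^ 6 ℕ.* (Π ℕ.* (Π ℕ.* Π))        ≤⟨ ℕ.*-monoʳ-≤ (k ℕ.^ 6) (ℕ.*-monoʳ-≤ Π (ℕ.*-mono-≤ T.αβγ≤ T.αβγ≤)) ⟩
      k ℕ.^ 6 ℕ.* (Π ℕ.* (2 ℕ.* d ℕ.* (2 ℕ.* d)))  ≡⟨ id₂ (k ℕ.^ 6) Π d ⟩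
      4 ℕ.* (k ℕ.^ 6 ℕ.* (Π ℕ.* d ℕ.^ 2))
        ≤⟨ ℕ.*-monoʳ-≤ 4 (ℕ.≤-trans (Conic.det²-bound (m₀ ℕ.^ 3) (m₁ ℕ.^ 3) (m₂ ℕ.^ 3) k {u₁} {v₁} {w₁} {u₂} {v₂} {w₂} {u₃} {v₃} {w₃}
             (S.0<w s₁) (S.0<w s₂) (S.0<w s₃) (S.equation s₁) (S.equation s₂) (S.equation s₃)
             (P.near₀ s₁ s₂ eq₁₂) (P.near₀ s₁ s₃ eq₁₃) (P.near₀ s₂ s₃ eq₂₃)
             (P.near₁ s₁ s₂ eq₁₂) (P.near₁ s₁ s₃ eq₁₃) (P.near₁ s₂ s₃ eq₂₃))
             (ℕ.*-monoʳ-≤ 2 T.zzz≤)) ⟩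
      4 ℕ.* (2 ℕ.* (M ℕ.* M ℕ.* M))        ≡⟨ ℕ.*-assoc 4 2 (M ℕ.* M ℕ.* M) ⟨
      8 ℕ.* (M ℕ.* M ℕ.* M)                ≤⟨ ℕ.*-monoˡ-≤ (M ℕ.* M ℕ.* M) (ℕ.m≤m+n 8 208) ⟩
      216 ℕ.* (M ℕ.* M ℕ.* M)              ∎)
    where
    open ℕ.≤-Reasoning
    module S = Solution
    0<k : 0 ℕ.< k
    0<k = ℕ.s≤s ℕ.z≤n
    module F = Fixed two M k m₀ m₁ m₂
    module P {u v w u′ v′ w′} s s′ = F.Pair 0<k {u} {v} {w} {u′} {v′} {w′} s s′
    module T = F.Triple 0<k s₁ s₂ s₃ ≢₁₂ ≢₁₃ ≢₂₃ eq₁₂ eq₁₃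
    eq₂₃ = trans (sym eq₁₂) eq₁₃
    Y = m₀ ℕ.* m₁ ℕ.* m₂
    Π = m₀ ℕ.^ 3 ℕ.* m₁ ℕ.^ 3 ℕ.* m₂ ℕ.^ 3
    d = abs (detℕ u₁ v₁ w₁ u₂ v₂ w₂ u₃ v₃ w₃)
    0<Y : 0 ℕ.< Y
    0<Y = ℕ.*-mono-< (ℕ.*-mono-< (S.0<m₀ s₁) (S.0<m₁ s₁)) (S.0<m₂ s₁)
    0<Y³ : 0 ℕ.< Y ℕ.* Y ℕ.* Y
    0<Y³ = ℕ.*-mono-< (ℕ.*-mono-< 0<Y 0<Y) 0<Y
    id₁ : ∀ k a b c → let Y = a ℕ.* b ℕ.* c; Π = a ℕ.* (a ℕ.* (a ℕ.* 1)) ℕ.* (b ℕ.* (b ℕ.* (b ℕ.* 1))) ℕ.* (c ℕ.* (c ℕ.* (c ℕ.* 1))) in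
      k ℕ.* Y ℕ.* (k ℕ.* Y ℕ.* (k ℕ.* Y ℕ.* (k ℕ.* Y ℕ.* (k ℕ.* Y ℕ.* (k ℕ.* Y ℕ.* 1))))) ℕ.* (Y ℕ.* Y ℕ.* Y) ≡
      k ℕ.* (k ℕ.* (k ℕ.* (k ℕ.* (k ℕ.* (k ℕ.* 1))))) ℕ.* (Π ℕ.* (Π ℕ.* Π))
    id₁ = ℕSolver.solve-∀
    id₂ : ∀ K Π d → K ℕ.* (Π ℕ.* (2 ℕ.* d ℕ.* (2 ℕ.* d))) ≡ 4 ℕ.* (K ℕ.* (Π ℕ.* (d ℕ.* (d ℕ.* 1))))
    id₂ = ℕSolver.solve-∀
  no-triple three {M} {k@(suc _)} {m₀} {m₁} {m₂} {u₁} {v₁} {w₁} {u₂} {v₂} {w₂} {u₃} {v₃} {w₃} M³< s₁ s₂ s₃ ≢₁₂ ≢₁₃ ≢₂₃ eq₁₂ eq₁₃ =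
    ℕ.<⇒≱ M³< (begin
      (k ℕ.* Y) ℕ.^ 6                      ≤⟨ ℕ.m≤m*n ((k ℕ.* Y) ℕ.^ 6) (Y ℕ.* Y) {{ℕ.>-nonZero (ℕ.*-mono-< 0<Y 0<Y)}} ⟩
      (k ℕ.* Y) ℕ.^ 6 ℕ.* (Y ℕ.* Y)        ≡⟨ id₁ k m₀ m₁ m₂ ⟩
      k ℕ.^ 6 ℕ.* (Π ℕ.* (Π ℕ.* (Π ℕ.* Π)))
        ≤⟨ ℕ.*-monoʳ-≤ (k ℕ.^ 6) (ℕ.*-monoʳ-≤ Π (ℕ.*-mono-≤ T.αβγ≤ (ℕ.*-mono-≤ T.αβγ≤ T.αβγ≤))) ⟩
      k ℕ.^ 6 ℕ.* (Π ℕ.* (3 ℕ.* d ℕ.* (3 ℕ.* d ℕ.* (3 ℕ.* d))))  ≡⟨ id₂ (k ℕ.^ 6) Π d ⟩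
      27 ℕ.* (k ℕ.^ 6 ℕ.* (Π ℕ.* d ℕ.^ 3))
        ≤⟨ ℕ.*-monoʳ-≤ 27 (ℕ.≤-trans (Cubic.det³-bound (m₀ ℕ.^ 2) (m₁ ℕ.^ 2) (m₂ ℕ.^ 2) k {u₁} {v₁} {w₁} {u₂} {v₂} {w₂} {u₃} {v₃} {w₃}
             (S.0<w s₁) (P.near₀ s₁ s₂ eq₁₂) (P.near₀ s₁ s₃ eq₁₃) (P.near₁ s₁ s₂ eq₁₂) (P.near₁ s₁ s₃ eq₁₃))
             (ℕ.*-monoʳ-≤ 8 T.zzz≤)) ⟩
      27 ℕ.* (8 ℕ.* (M ℕ.* M ℕ.* M))       ≡⟨ ℕ.*-assoc 27 8 (M ℕ.* M ℕ.* M) ⟨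
      216 ℕ.* (M ℕ.* M ℕ.* M)              ∎)
    where
    open ℕ.≤-Reasoning
    module S = Solution
    0<k : 0 ℕ.< k
    0<k = ℕ.s≤s ℕ.z≤n
    module F = Fixed three M k m₀ m₁ m₂
    module P {u v w u′ v′ w′} s s′ = F.Pair 0<k {u} {v} {w} {u′} {v′} {w′} s s′
    module T = F.Triple 0<k s₁ s₂ s₃ ≢₁₂ ≢₁₃ ≢₂₃ eq₁₂ eq₁₃
    Y = m₀ ℕ.* m₁ ℕ.* m₂
    Π = m₀ ℕ.^ 2 ℕ.* m₁ ℕ.^ 2 ℕ.* m₂ ℕ.^ 2
    d = abs (detℕ u₁ v₁ w₁ u₂ v₂ w₂ u₃ v₃ w₃)
    0<Y : 0 ℕ.< Y
    0<Y = ℕ.*-mono-< (ℕ.*-mono-< (S.0<m₀ s₁) (S.0<m₁ s₁)) (S.0<m₂ s₁)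
    id₁ : ∀ k a b c → let Y = a ℕ.* b ℕ.* c; Π = a ℕ.* (a ℕ.* 1) ℕ.* (b ℕ.* (b ℕ.* 1)) ℕ.* (c ℕ.* (c ℕ.* 1)) in
      k ℕ.* Y ℕ.* (k ℕ.* Y ℕ.* (k ℕ.* Y ℕ.* (k ℕ.* Y ℕ.* (k ℕ.* Y ℕ.* (k ℕ.* Y ℕ.* 1))))) ℕ.* (Y ℕ.* Y) ≡
      k ℕ.* (k ℕ.* (k ℕ.* (k ℕ.* (k ℕ.* (k ℕ.* 1))))) ℕ.* (Π ℕ.* (Π ℕ.* (Π ℕ.* Π)))
    id₁ = ℕSolver.solve-∀
    id₂ : ∀ K Π d → K ℕ.* (Π ℕ.* (3 ℕ.* d ℕ.* (3 ℕ.* d ℕ.* (3 ℕ.* d)))) ≡ 27 ℕ.* (K ℕ.* (Π ℕ.* (d ℕ.* (d ℕ.* (d ℕ.* 1)))))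
    id₂ = ℕSolver.solve-∀

-- Encoding solutions by 10-tuples with product at most `T`.

module Codes where

  open import Data.Nat
  open import Data.Nat.Properties
  open import Data.Nat.DivMod
  open import Data.Nat.Tactic.RingSolver using (solve-∀)
  open import Data.Integer using (+_; -_)
  open LocalRoots using (Exponent; deg)
  open CommonClasses using (cof; module Modulus; ratioSlots; ⟂-sym)
  open Determinant using (^-*-distribℕ)
  open Arcs using (module Arc)
  open Counting
  open ThreePoints

  ℕ³ : Set
  ℕ³ = ℕ × ℕ × ℕ

  _≟³_ : DecidableEquality ℕ³
  _≟³_ = Product.≡-dec _≟_ (Product.≡-dec _≟_ _≟_)

  ∏³ : ℕ³ → ℕ
  ∏³ (a , b , c) = a * b * c

  IsSolution : Exponent → ℕ → ℕ³ × ℕ³ → Set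
  IsSolution n M ((m₀ , m₁ , m₂) , u , v , w) = Solution n M m₀ m₁ m₂ u v w

  length-cartesianProduct : ∀ {A B : Set} (xs : List A) (ys : List B) →
    length (cartesianProduct xs ys) ≡ length xs * length ys
  length-cartesianProduct []       ys = refl
  length-cartesianProduct (x ∷ xs) ys = trans (length-++ (map (x ,_) ys))
    (cong₂ _+_ (length-map (x ,_) ys) (length-cartesianProduct xs ys))

  quotient : ℕ → ℕ → ℕ
  quotient T zero    = 0
  quotient T (suc Y) = T / suc Y

  quotient-* : ∀ T Y → quotient T Y * Y ≤ T
  quotient-* T zero    = z≤n
  quotient-* T (suc Y) = m/n*n≤m T (suc Y)

  <-suc-quotient : ∀ T {Y} → 0 < Y → T < suc (quotient T Y) * Y
  <-suc-quotient T {suc Y} _ = begin-strict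
    T                                        ≡⟨ m≡m%n+[m/n]*n T (suc Y) ⟩
    T % suc Y + T / suc Y * suc Y            <⟨ +-monoˡ-< (T / suc Y * suc Y) (m%n<n T (suc Y)) ⟩
    suc (T / suc Y) * suc Y                  ∎
    where open ≤-Reasoning

  0<quotient : ∀ {T Y} → 0 < Y → Y ≤ T → 0 < quotient T Y
  0<quotient {T} {suc Y} _ Y≤T = ≤-trans (≤-reflexive (sym (m*n/n≡m 1 (suc Y))))
    (/-monoˡ-≤ (suc Y) (subst (_≤ T) (sym (*-identityˡ (suc Y))) Y≤T))

  Code : Set
  Code = Vec ℕ 10 × ℕ × ℕ³

  _≟ᶜ_ : DecidableEquality Code
  _≟ᶜ_ = Product.≡-dec (Vec.≡-dec _≟_) (Product.≡-dec _≟_ _≟³_)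

  residues : List (ℕ × ℕ³)
  residues = cartesianProduct (upTo 13) (cartesianProduct (upTo 4) (cartesianProduct (upTo 4) (upTo 4)))

  slotProducts : (ℕ³ × ℕ³ × ℕ³) × ℕ³ × ℕ → ℕ³
  slotProducts ((s₀ , s₁ , s₂) , _) = ∏³ s₀ , ∏³ s₁ , ∏³ s₂

  -- The arc code is at most 6 (t + 1) ≤ 12 t < 13 t for t = quotient T Y ≥ 1.
  encode : (ℕ³ × ℕ³ × ℕ³) × ℕ³ × ℕ → Code
  encode (((a , b , c) , (d , e , f) , (g , h , i)) , r , q) =
    -- The successor makes the last entry positive, as membership in `tuples` demands; since
    -- `q / 13 < t`, it is still at most `t`.
    (a ∷ b ∷ c ∷ d ∷ e ∷ f ∷ g ∷ h ∷ i ∷ suc (q / 13) ∷ []) , q % 13 , r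

  Vec-injective : ∀ {a b c d e f g h i j a′ b′ c′ d′ e′ f′ g′ h′ i′ j′ : ℕ} →
    _≡_ {A = Vec ℕ 10} (a ∷ b ∷ c ∷ d ∷ e ∷ f ∷ g ∷ h ∷ i ∷ j ∷ []) (a′ ∷ b′ ∷ c′ ∷ d′ ∷ e′ ∷ f′ ∷ g′ ∷ h′ ∷ i′ ∷ j′ ∷ []) →
    ((a , b , c) , (d , e , f) , (g , h , i)) ≡ ((a′ , b′ , c′) , (d′ , e′ , f′) , (g′ , h′ , i′)) × j ≡ j′
  Vec-injective refl = refl , refl

  encode-injective : ∀ x y → encode x ≡ encode y → x ≡ y
  encode-injective (_ , _ , q) (_ , _ , q′) eq =
    let slots≡ , q/13≡ = Vec-injective (cong proj₁ eq) in
    cong₂ _,_ slots≡ (cong₂ _,_ (cong (proj₂ ∘ proj₂) eq) (begin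
      q                       ≡⟨ m≡m%n+[m/n]*n q 13 ⟩
      q % 13 + q / 13 * 13    ≡⟨ cong₂ (λ r t → r + t * 13) (cong (proj₁ ∘ proj₂) eq) (suc-injective {q / 13} {q′ / 13} q/13≡) ⟩
      q′ % 13 + q′ / 13 * 13  ≡⟨ m≡m%n+[m/n]*n q′ 13 ⟨
      q′                      ∎))
    where open ≡-Reasoning

  module Count (n : Exponent) (M T H : ℕ) (M³<[1+T]⁵ : M * M * M < suc T ^ 5) (T≤2^H : T ≤ 2 ^ H) where

    -- The successor of the quotient makes the number of arcs times `Y` exceed `3 T`. The factor 3
    -- is chosen because `3⁶ = 729` exceeds the 216 of `no-triple`, whereas `2⁶` does not.
    arcCount : ℕ³ → ℕ
    arcCount m = 3 * suc (quotient T (∏³ m))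

    sig : ℕ³ × ℕ³ → (ℕ³ × ℕ³ × ℕ³) × ℕ³ × ℕ
    sig (m@(m₀ , m₁ , m₂) , u , v , w) = Fixed.signature n M (arcCount m) m₀ m₁ m₂ u v w

    code : ℕ³ × ℕ³ → Code
    code p = encode (sig p)

    private
      many-arcs : ∀ m → 0 < ∏³ m → 216 * (M * M * M) < (arcCount m * ∏³ m) ^ 6
      many-arcs m 0<Y = begin-strict
        216 * (M * M * M)                      <⟨ *-monoʳ-< 216 M³<[1+T]⁵ ⟩
        -- Here `729 = 216 + 513`, and one further factor `suc T` is given away to reach a sixth
        -- power.
        216 * suc T ^ 5                        ≤⟨ *-mono-≤ (m≤m+n 216 513) (m≤n*m (suc T ^ 5) (suc T)) ⟩
        3 ^ 6 * suc T ^ 6                      ≡⟨ ^-*-distribℕ 3 (suc T) 6 ⟨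
        (3 * suc T) ^ 6                        ≤⟨ ^-monoˡ-≤ 6 (≤-trans (*-monoʳ-≤ 3 (<-suc-quotient T 0<Y))
                                                    (≤-reflexive (sym (*-assoc 3 (suc (quotient T (∏³ m))) (∏³ m))))) ⟩
        (arcCount m * ∏³ m) ^ 6                ∎
        where
        open ≤-Reasoning

    slots-∏ : ∀ {p} → IsSolution n M p → slotProducts (sig p) ≡ proj₁ p
    slots-∏ {m@(m₀ , m₁ , m₂) , u , v , w} s = cong₂ _,_
      (Modulus.product-ratioSlots n m₀≢0 (+ (m₁ ^ cof n)) (- + (m₂ ^ cof n)) (^-⟂ʳ (cof n) m₀⟂m₁) local₀)
      (cong₂ _,_
        (Modulus.product-ratioSlots n m₁≢0 (+ (m₀ ^ cof n)) (- + (m₂ ^ cof n)) (^-⟂ʳ (cof n) (⟂-sym m₀⟂m₁)) local₁)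
        (Modulus.product-ratioSlots n m₂≢0 (+ (m₀ ^ cof n)) (+ (m₁ ^ cof n)) (^-⟂ʳ (cof n) (⟂-sym m₀⟂m₂)) local₂))
      where open Fixed.OfSolution n M (arcCount m) m₀ m₁ m₂ s

    -- The slots multiply back to the coefficient bases, so points of equal code lie on the same
    -- curve and `no-triple` applies to them.
    code⇒m : ∀ {p p′} → IsSolution n M p → IsSolution n M p′ → code p ≡ code p′ → proj₁ p ≡ proj₁ p′
    code⇒m {p} {p′} s s′ eq = trans (sym (slots-∏ {p} s))
      (trans (cong slotProducts (encode-injective (sig p) (sig p′) eq)) (slots-∏ {p′} s′))

    distinct-no-triple : ∀ {p q r} → IsSolution n M p → IsSolution n M q → IsSolution n M r →
      p ≢ q → p ≢ r → q ≢ r → code p ≡ code q → code p ≡ code r → ⊥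
    distinct-no-triple {m , x} {m′ , y} {m″ , z} s₁ s₂ s₃ p≢q p≢r q≢r eq₁₂ eq₁₃ =
      same-m {m} {m′} {m″} {x} {y} {z} (code⇒m {p = m , x} {m′ , y} s₁ s₂ eq₁₂) (code⇒m {p = m , x} {m″ , z} s₁ s₃ eq₁₃) s₁ s₂ s₃ p≢q p≢r q≢r eq₁₂ eq₁₃
      where
      same-m : ∀ {m m′ m″ x y z} → m ≡ m′ → m ≡ m″ →
        IsSolution n M (m , x) → IsSolution n M (m′ , y) → IsSolution n M (m″ , z) →
        (m , x) ≢ (m′ , y) → (m , x) ≢ (m″ , z) → (m′ , y) ≢ (m″ , z) → code (m , x) ≡ code (m′ , y) → code (m , x) ≡ code (m″ , z) → ⊥
      same-m {m@(m₀ , m₁ , m₂)} {x = x@(u₁ , v₁ , w₁)} {y@(u₂ , v₂ , w₂)} {z@(u₃ , v₃ , w₃)} refl refl s₁ s₂ s₃ p≢q p≢r q≢r eq₁₂ eq₁₃ = no-triple n {M} {arcCount m} {m₀} {m₁} {m₂} {u₁} {v₁} {w₁} {u₂} {v₂} {w₂} {u₃} {v₃} {w₃}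
        (many-arcs m 0<Y) s₁ s₂ s₃
        (p≢q ∘ cong (m ,_)) (p≢r ∘ cong (m ,_)) (q≢r ∘ cong (m ,_)) (encode-injective (sig (m , x)) (sig (m , y)) eq₁₂) (encode-injective (sig (m , x)) (sig (m , z)) eq₁₃)
        where
        0<Y : 0 < ∏³ m
        0<Y = *-mono-< (*-mono-< (Solution.0<m₀ s₁) (Solution.0<m₁ s₁)) (Solution.0<m₂ s₁)

    codes : List Code
    codes = cartesianProduct (tuples H 9 T) residues

    code∈codes : ∀ {p} → IsSolution n M p → ∏³ (proj₁ p) ≤ T → code p ∈ codes
    code∈codes {m@(m₀ , m₁ , m₂) , u , v , w} s Y≤T = ∈-cartesianProduct⁺
      (∈-tuples H T≤2^H positive product≤)
      (∈-cartesianProduct⁺ (∈-upTo⁺ (m%n<n q 13)) (∈-cartesianProduct⁺ (∈-upTo⁺ (m%n<n u 4))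
        (∈-cartesianProduct⁺ (∈-upTo⁺ (m%n<n v 4)) (∈-upTo⁺ (m%n<n w 4)))))
      where
      open Fixed.OfSolution n M (arcCount m) m₀ m₁ m₂ s
      Y = ∏³ m
      t = quotient T Y
      k = arcCount m
      s₀ = ratioSlots n m₀ (+ (m₁ ^ cof n)) (- + (m₂ ^ cof n)) v w
      s₁ = ratioSlots n m₁ (+ (m₀ ^ cof n)) (- + (m₂ ^ cof n)) u w
      s₂ = ratioSlots n m₂ (+ (m₀ ^ cof n)) (+ (m₁ ^ cof n)) u v
      q = Arc.arcCode n k (m₀ ^ cof n * u ^ deg n) (m₁ ^ cof n * v ^ deg n) (m₂ ^ cof n * w ^ deg n)
      0<Y : 0 < Y
      0<Y = *-mono-< (*-mono-< 0<m₀ 0<m₁) 0<m₂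
      slots≡ = slots-∏ {m , u , v , w} s
      factors>0 : ∀ {a b c m} → a * b * c ≡ m → 0 < m → 0 < a × 0 < b × 0 < c
      factors>0 {a} {b} {c} refl 0<m =
        n≢0⇒n>0 (λ { refl → <-irrefl refl 0<m }) ,
        n≢0⇒n>0 (λ { refl → <-irrefl (sym (cong (_* c) (*-zeroʳ a))) 0<m }) ,
        n≢0⇒n>0 (λ { refl → <-irrefl (sym (*-zeroʳ (a * b))) 0<m })
      positive : VAll.All (0 <_) (proj₁ (code (m , u , v , w)))
      positive =
        let a , b , c = factors>0 {m = m₀} (cong proj₁ slots≡) 0<m₀
            d , e , f = factors>0 {m = m₁} (cong (proj₁ ∘ proj₂) slots≡) 0<m₁
            g , h , i = factors>0 {m = m₂} (cong (proj₂ ∘ proj₂) slots≡) 0<m₂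
        in a ∷ b ∷ c ∷ d ∷ e ∷ f ∷ g ∷ h ∷ i ∷ z<s ∷ []
      q/13<t : q / 13 < t
      q/13<t = m<n*o⇒m/o<n {q} {t} {13} (≤-<-trans (Arc.arcCode≤ n k _ _ _)
        (≤-<-trans (small t (0<quotient 0<Y Y≤T)) (*-monoʳ-< t {{>-nonZero (0<quotient 0<Y Y≤T)}} (n<1+n 12))))
        where
        small : ∀ t → 0 < t → 3 * suc t + 3 * suc t ≤ t * 12
        small t 0<t = begin
          3 * suc t + 3 * suc t   ≡⟨ id₁ t ⟩
          t * 6 + 1 * 6           ≤⟨ +-monoʳ-≤ (t * 6) (*-monoˡ-≤ 6 0<t) ⟩
          t * 6 + t * 6           ≡⟨ *-distribˡ-+ t 6 6 ⟨
          t * 12                  ∎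
          where
          open ≤-Reasoning
          id₁ : ∀ t → 3 * (1 + t) + 3 * (1 + t) ≡ t * 6 + 1 * 6
          id₁ = solve-∀
      product≤ : ∏ (proj₁ (code (m , u , v , w))) ≤ T
      product≤ = begin
        ∏ (proj₁ (code (m , u , v , w)))                ≡⟨ regroup s₀ s₁ s₂ (suc (q / 13)) ⟩
        suc (q / 13) * (∏³ s₀ * ∏³ s₁ * ∏³ s₂)         ≡⟨ cong (λ x → suc (q / 13) * ∏³ x) slots≡ ⟩
        suc (q / 13) * Y                               ≤⟨ *-monoˡ-≤ Y q/13<t ⟩
        t * Y                                          ≤⟨ quotient-* T Y ⟩
        T                                              ∎
        where
        open ≤-Reasoning
        id₁ : ∀ a b c d e f g h i j → a * (b * (c * (d * (e * (f * (g * (h * (i * (j * 1))))))))) ≡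
          j * (a * b * c * (d * e * f) * (g * h * i))
        id₁ = solve-∀
        regroup : ∀ (x y z : ℕ³) j → let a , b , c = x; d , e , f = y; g , h , i = z in
          ∏ (a ∷ b ∷ c ∷ d ∷ e ∷ f ∷ g ∷ h ∷ i ∷ j ∷ []) ≡ j * (∏³ x * ∏³ y * ∏³ z)
        regroup (a , b , c) (d , e , f) (g , h , i) j = id₁ a b c d e f g h i j

    count : ∀ {ps} → Unique ps → All (IsSolution n M) ps → All (λ p → ∏³ (proj₁ p) ≤ T) ps →
      length ps ≤ 2 * length residues * (T * suc H ^ 9)
    count {ps} uniq sols small = begin
      length ps               ≤⟨ length≤2* _≟ᶜ_ code codes uniq
                                   (λ p∈ → code∈codes (All.lookup sols p∈) (All.lookup small p∈))
                                   (λ p∈ q∈ r∈ → distinct-no-triple (All.lookup sols p∈) (All.lookup sols q∈) (All.lookup sols r∈)) ⟩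
      2 * length codes        ≡⟨ cong (2 *_) (length-cartesianProduct (tuples H 9 T) residues) ⟩
      2 * (length (tuples H 9 T) * R)    ≤⟨ *-monoʳ-≤ 2 (*-monoˡ-≤ R (length-tuples H 9 T)) ⟩
      2 * (T * suc H ^ 9 * R)            ≡⟨ id₁ (T * suc H ^ 9) R ⟩
      2 * R * (T * suc H ^ 9)            ∎
      where
      open ≤-Reasoning
      R = length residues
      id₁ : ∀ x R → 2 * (x * R) ≡ 2 * R * x
      id₁ = solve-∀

-- Squareful numbers, and the bound for an integer height `M`.

module Powerful where

  open import Data.Nat
  open import Data.Nat.Properties
  open import Data.Nat.Divisibility
  open import Data.Nat.Tactic.RingSolver using (solve-∀)
  open LocalRoots using (two; three)
  open CommonClasses using (_⟂_; ⟂⇒coprime; prime-divisor; prime∣^⇒∣; ⟂-sym)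
  open Determinant using (^-*-distribℕ)
  open Arcs using (largest; largest-holds; largest≤; largest-greatest)
  open Counting using (length-filter-¬)
  open ThreePoints
  open Codes

  prime-∣-prime : ∀ {p q} → Prime p → Prime q → p ∣ q → p ≡ q
  prime-∣-prime pp pq p∣q with prime⇒irreducible pq p∣q
  ... | inj₂ p≡q  = p≡q
  ... | inj₁ refl = contradiction (prime⇒nonTrivial pp) λ ()

  cancel-prime-power : ∀ {p q k} j → Prime p → Prime q → q ≢ p → q ^ 2 ∣ k * p ^ j → q ^ 2 ∣ k
  cancel-prime-power {p} {q} {k} j pp pq q≢p h = coprime-divisor
    (⟂⇒coprime (m<n⇒n≢0 (m^n>0 q {{prime⇒nonZero pq}} 2)) q²⟂pʲ) (subst (q ^ 2 ∣_) (*-comm k (p ^ j)) h)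
    where
    q²⟂pʲ : (q ^ 2) ⟂ (p ^ j)
    q²⟂pʲ r pr r∣q² r∣pʲ = q≢p (trans (sym (prime-∣-prime pr pq (prime∣^⇒∣ q 2 pr r∣q²)))
      (prime-∣-prime pr pp (prime∣^⇒∣ p j pr r∣pʲ)))

  -- Strong induction, removing a prime `p`. If `k / p²` is prime to `p` or divisible by `p²`, it is
  -- again squareful, and `p` goes into the square. Otherwise `p` divides it exactly once; then
  -- `k / p³` is prime to `p`, and `p` goes into the cube.
  squareful-decomposition : ∀ {k} → Acc _<_ k → 0 < k → Squareful k → ∃₂ λ a b → k ≡ b ^ 3 * a ^ 2
  squareful-decomposition {k} (acc rec) 0<k sf with k ≟ 1
  ... | yes refl = 1 , 1 , refl
  ... | no k≢1 with prime-divisor k (m<n⇒n≢0 0<k) k≢1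
  ... | p , pp , p∣k with sf p pp p∣k
  ... | divides-refl k′ = go (p ∣? k′) (p ^ 2 ∣? k′)
    where
    instance
      _ = prime⇒nonZero pp
      _ = prime⇒nonTrivial pp
    0<factor : ∀ {k c} → 0 < k * c → 0 < k
    0<factor {zero}  ()
    0<factor {suc _} _ = z<s
    1<p² : 1 < p ^ 2
    1<p² = ≤-<-trans (m^n>0 p 1) (^-monoʳ-< p (nonTrivial⇒n>1 p) (n<1+n 1))
    0<k′ = 0<factor {k′} {p ^ 2} 0<k
    k′<k : k′ < k′ * p ^ 2
    k′<k = m<m*n k′ (p ^ 2) {{>-nonZero 0<k′}} 1<p²
    id₁ : ∀ a b p → b * (b * (b * 1)) * (a * (a * 1)) * (p * (p * 1)) ≡ b * (b * (b * 1)) * (a * p * (a * p * 1))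
    id₁ = solve-∀
    id₂ : ∀ a b p → b * (b * (b * 1)) * (a * (a * 1)) * p * (p * (p * 1)) ≡ b * p * (b * p * (b * p * 1)) * (a * (a * 1))
    id₂ = solve-∀
    square-case : Squareful k′ → ∃₂ λ a b → k′ * p ^ 2 ≡ b ^ 3 * a ^ 2
    square-case sf′ with squareful-decomposition (rec k′<k) 0<k′ sf′
    ... | a , b , eq = a * p , b , trans (cong (_* p ^ 2) eq) (id₁ a b p)
    go : Dec (p ∣ k′) → Dec (p ^ 2 ∣ k′) → ∃₂ λ a b → k′ * p ^ 2 ≡ b ^ 3 * a ^ 2
    go (no p∤k′) _ = square-case λ q pq q∣k′ →
      cancel-prime-power 2 pp pq (λ { refl → p∤k′ q∣k′ }) (sf q pq (∣m⇒∣m*n (p ^ 2) q∣k′))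
    go (yes _) (yes p²∣k′) = square-case λ q pq q∣k′ → other q pq q∣k′ (q ≟ p)
      where
      other : ∀ q → Prime q → q ∣ k′ → Dec (q ≡ p) → q ^ 2 ∣ k′
      other q pq q∣k′ (yes refl) = p²∣k′
      other q pq q∣k′ (no q≢p)   = cancel-prime-power 2 pp pq q≢p (sf q pq (∣m⇒∣m*n (p ^ 2) q∣k′))
    go (yes (divides k″ eq)) (no p²∤k′) with squareful-decomposition (rec k″<k) 0<k″ sf″
      where
      0<k″ : 0 < k″
      0<k″ = 0<factor {k″} {p} (subst (0 <_) eq 0<k′)
      k″<k : k″ < k′ * p ^ 2
      k″<k = ≤-<-trans (subst (k″ ≤_) (sym eq) (m≤m*n k″ p)) k′<k
      p∤k″ : ¬ p ∣ k″
      p∤k″ (divides l refl) = p²∤k′ (divides l (trans eq (trans (*-assoc l p p) (cong (λ t → l * (p * t)) (sym (*-identityʳ p))))))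
      k≡k″p³ : k′ * p ^ 2 ≡ k″ * p ^ 3
      k≡k″p³ = trans (cong (_* p ^ 2) eq) (*-assoc k″ p (p ^ 2))
      sf″ : Squareful k″
      sf″ q pq q∣k″ = cancel-prime-power 3 pp pq (λ { refl → p∤k″ q∣k″ })
        (subst (q ^ 2 ∣_) k≡k″p³ (sf q pq (subst (q ∣_) (sym k≡k″p³) (∣m⇒∣m*n (p ^ 3) q∣k″))))
    ... | a , b , eq″ = a , b * p , trans (cong (_* p ^ 2) (trans eq (cong (_* p) eq″))) (id₂ a b p)

  record PowerfulSum (M x y z : ℕ) : Set where
    field
      0<x : 0 < x
      0<y : 0 < y
      0<z : 0 < z
      coprime : gcd (gcd x y) z ≡ 1
      sum : x + y ≡ z
      z≤M : z ≤ M
      x-squareful : Squareful x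
      y-squareful : Squareful y
      z-squareful : Squareful z

  value : ℕ³ × ℕ³ → ℕ³
  value ((b₀ , b₁ , b₂) , (a₀ , a₁ , a₂)) = b₀ ^ 3 * a₀ ^ 2 , b₁ ^ 3 * a₁ ^ 2 , b₂ ^ 3 * a₂ ^ 2

  -- The same equation read twice: as a conic in the `a` with coefficients `b³`, and after `swap` as
  -- a cubic in the `b` with coefficients `a²`.
  Decomposed : ℕ → ℕ³ × ℕ³ → Set
  Decomposed M p = IsSolution two M p × IsSolution three M (swap p)

  ⟂-roots : ∀ {a b c d} → (b ^ 3 * a ^ 2) ⟂ (d ^ 3 * c ^ 2) → (b * a) ⟂ (d * c)
  ⟂-roots {a} {b} {c} {d} h = ⟂-sub (ba∣ a b) (ba∣ c d) h
    where
    ba∣ : ∀ a b → b * a ∣ b ^ 3 * a ^ 2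
    ba∣ a b = *-pres-∣ (m∣m*n {b} (b ^ 2)) (m∣m*n {a} (a ^ 1))

  -- By `x + y = z` a prime dividing two of the terms divides the third. So the triple is pairwise
  -- coprime, and the factors of its terms inherit this.
  decompose : ∀ {M x y z} → PowerfulSum M x y z → ∃ λ p → value p ≡ (x , y , z) × Decomposed M p
  decompose {M} {x} {y} {z} h
    with squareful-decomposition (<-wellFounded x) (PowerfulSum.0<x h) (PowerfulSum.x-squareful h)
       | squareful-decomposition (<-wellFounded y) (PowerfulSum.0<y h) (PowerfulSum.y-squareful h)
       | squareful-decomposition (<-wellFounded z) (PowerfulSum.0<z h) (PowerfulSum.z-squareful h)
  ... | a₀ , b₀ , refl | a₁ , b₁ , refl | a₂ , b₂ , refl =
    ((b₀ , b₁ , b₂) , (a₀ , a₁ , a₂)) , refl ,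
    record { 0<m₀ = 0<b a₀ b₀ 0<x ; 0<m₁ = 0<b a₁ b₁ 0<y ; 0<m₂ = 0<b a₂ b₂ 0<z
           ; 0<u = 0<a a₀ b₀ 0<x ; 0<v = 0<a a₁ b₁ 0<y ; 0<w = 0<a a₂ b₂ 0<z
           ; ⟂₀₁ = ⟂-roots {a₀} {b₀} {a₁} {b₁} x⟂y ; ⟂₀₂ = ⟂-roots {a₀} {b₀} {a₂} {b₂} x⟂z ; ⟂₁₂ = ⟂-roots {a₁} {b₁} {a₂} {b₂} y⟂z
           ; equation = sum ; bound = z≤M } ,
    record { 0<m₀ = 0<a a₀ b₀ 0<x ; 0<m₁ = 0<a a₁ b₁ 0<y ; 0<m₂ = 0<a a₂ b₂ 0<z
           ; 0<u = 0<b a₀ b₀ 0<x ; 0<v = 0<b a₁ b₁ 0<y ; 0<w = 0<b a₂ b₂ 0<z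
           ; ⟂₀₁ = subst₂ _⟂_ (*-comm b₀ a₀) (*-comm b₁ a₁) (⟂-roots {a₀} {b₀} {a₁} {b₁} x⟂y)
           ; ⟂₀₂ = subst₂ _⟂_ (*-comm b₀ a₀) (*-comm b₂ a₂) (⟂-roots {a₀} {b₀} {a₂} {b₂} x⟂z)
           ; ⟂₁₂ = subst₂ _⟂_ (*-comm b₁ a₁) (*-comm b₂ a₂) (⟂-roots {a₁} {b₁} {a₂} {b₂} y⟂z)
           ; equation = trans (cong₂ _+_ (*-comm (a₀ ^ 2) (b₀ ^ 3)) (*-comm (a₁ ^ 2) (b₁ ^ 3))) (trans sum (*-comm (b₂ ^ 3) (a₂ ^ 2)))
           ; bound = subst (_≤ M) (*-comm (b₂ ^ 3) (a₂ ^ 2)) z≤M }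
    where
    open PowerfulSum h
    0<factors : ∀ a b → 0 < b ^ 3 * a ^ 2 → 0 < a × 0 < b
    0<factors zero    b       h = contradiction (subst (0 <_) (*-zeroʳ (b ^ 3)) h) λ ()
    0<factors (suc a) zero    ()
    0<factors (suc a) (suc b) _ = z<s , z<s
    0<a = λ a b h → proj₁ (0<factors a b h)
    0<b = λ a b h → proj₂ (0<factors a b h)
    coprime-⊥ : ∀ p → Prime p → p ∣ x → p ∣ y → p ∣ z → ⊥
    coprime-⊥ p pp p∣x p∣y p∣z = contradiction
      (subst Prime (∣1⇒≡1 (subst (p ∣_) coprime (gcd-greatest (gcd-greatest p∣x p∣y) p∣z))) pp) (λ pp → contradiction (prime⇒nonTrivial pp) λ ())
    x⟂y : x ⟂ y
    x⟂y p pp p∣x p∣y = coprime-⊥ p pp p∣x p∣y (subst (p ∣_) sum (∣m∣n⇒∣m+n p∣x p∣y))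
    x⟂z : x ⟂ z
    x⟂z p pp p∣x p∣z = coprime-⊥ p pp p∣x (∣m+n∣m⇒∣n (subst (p ∣_) (sym sum) p∣z) p∣x) p∣z
    y⟂z : y ⟂ z
    y⟂z p pp p∣y p∣z = coprime-⊥ p pp (∣m+n∣m⇒∣n (subst (p ∣_) (trans (sym sum) (+-comm x y)) p∣z) p∣y) p∣y p∣z

  decompose-all : ∀ {M xs} → All (λ (x , y , z) → PowerfulSum M x y z) xs →
    ∃ λ ps → map value ps ≡ xs × All (Decomposed M) ps
  decompose-all [] = [] , refl , []
  decompose-all (h ∷ hs) =
    let p , eq , d = decompose h
        ps , eqs , ds = decompose-all hs
    in p ∷ ps , cong₂ _∷_ eq eqs , d ∷ ds

  module _ {M T H : ℕ} (M³<[1+T]⁵ : M * M * M < suc T ^ 5) (T≤2^H : T ≤ 2 ^ H) where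

    -- X² Y³ = x y z ≤ M³ < (T + 1)⁵.
    one-small : ∀ {p} → Decomposed M p → ¬ ∏³ (proj₁ p) ≤ T → ∏³ (proj₂ p) ≤ T
    one-small {(b₀ , b₁ , b₂) , (a₀ , a₁ , a₂)} (s , _) Y≰T with a₀ * a₁ * a₂ ≤? T
    ... | yes X≤T = X≤T
    ... | no X≰T = contradiction M³<[1+T]⁵ (≤⇒≯ (begin
      suc T ^ 5                                   ≡⟨ ^-distribˡ-+-* (suc T) 3 2 ⟩
      suc T ^ 3 * suc T ^ 2                       ≤⟨ *-mono-≤ (^-monoˡ-≤ 3 (≰⇒> Y≰T)) (^-monoˡ-≤ 2 (≰⇒> X≰T)) ⟩
      (b₀ * b₁ * b₂) ^ 3 * (a₀ * a₁ * a₂) ^ 2     ≡⟨ id₁ a₀ a₁ a₂ b₀ b₁ b₂ ⟩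
      b₀ ^ 3 * a₀ ^ 2 * (b₁ ^ 3 * a₁ ^ 2) * (b₂ ^ 3 * a₂ ^ 2)
        ≤⟨ *-mono-≤ (*-mono-≤ (≤-trans (m≤m+n (b₀ ^ 3 * a₀ ^ 2) (b₁ ^ 3 * a₁ ^ 2)) sum≤M)
             (≤-trans (m≤n+m (b₁ ^ 3 * a₁ ^ 2) (b₀ ^ 3 * a₀ ^ 2)) sum≤M)) bound ⟩
      M * M * M                                   ∎))
      where
      open ≤-Reasoning
      open Solution s
      sum≤M : b₀ ^ 3 * a₀ ^ 2 + b₁ ^ 3 * a₁ ^ 2 ≤ M
      sum≤M = subst (_≤ M) (sym equation) bound
      id₁ : ∀ a₀ a₁ a₂ b₀ b₁ b₂ →
        b₀ * b₁ * b₂ * (b₀ * b₁ * b₂ * (b₀ * b₁ * b₂ * 1)) * (a₀ * a₁ * a₂ * (a₀ * a₁ * a₂ * 1)) ≡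
        b₀ * (b₀ * (b₀ * 1)) * (a₀ * (a₀ * 1)) * (b₁ * (b₁ * (b₁ * 1)) * (a₁ * (a₁ * 1))) * (b₂ * (b₂ * (b₂ * 1)) * (a₂ * (a₂ * 1)))
      id₁ = solve-∀

    count-powerful : ∀ {xs} → Unique xs → All (λ (x , y , z) → PowerfulSum M x y z) xs →
      length xs ≤ 2 * (2 * length residues * (T * suc H ^ 9))
    count-powerful {xs} uniq powerful = begin
      length xs                                              ≡⟨ cong length (sym value≡) ⟩
      length (map value ps)                                  ≡⟨ length-map value ps ⟩
      length ps                                              ≡⟨ length-filter-¬ small? ps ⟩
      length (filter small? ps) + length large               ≡⟨ cong (length (filter small? ps) +_) (sym (length-map swap large)) ⟩
      length (filter small? ps) + length (map swap large)
        ≤⟨ +-mono-≤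
             (Count.count two M T H M³<[1+T]⁵ T≤2^H (Unique.filter⁺ small? uniq-ps)
               (All.filter⁺ small? (All.map proj₁ decomposed)) (All.all-filter small? ps))
             (Count.count three M T H M³<[1+T]⁵ T≤2^H (Unique.map⁺ (cong swap) (Unique.filter⁺ (¬? ∘ small?) uniq-ps))
               (All.map⁺ (All.map proj₂ large-decomposed))
               (All.map⁺ (All.zipWith (λ {p} (d , h) → one-small {p} d h) (large-decomposed , All.all-filter (¬? ∘ small?) ps)))) ⟩
      C + C                                                  ≡⟨ cong (C +_) (sym (+-identityʳ C)) ⟩
      2 * C                                                  ∎
      where
      open ≤-Reasoning
      C = 2 * length residues * (T * suc H ^ 9)
      ps = proj₁ (decompose-all powerful)
      value≡ = proj₁ (proj₂ (decompose-all powerful))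
      decomposed = proj₂ (proj₂ (decompose-all powerful))
      small? : ∀ p → Dec (∏³ (proj₁ p) ≤ T)
      small? p = ∏³ (proj₁ p) ≤? T
      large = filter (¬? ∘ small?) ps
      large-decomposed = All.filter⁺ (¬? ∘ small?) decomposed
      uniq-ps : Unique ps
      -- One decomposition is chosen for each triple; distinct triples have distinct ones because
      -- `value` recovers the triple.
      uniq-ps = Unique.map⁻ (subst Unique (sym value≡) uniq)

  -- ⌊ M^(3/5) ⌋
  fifthRoot : ℕ → ℕ
  fifthRoot M = largest (λ t → t ^ 5 ≤? M ^ 3) M

  log₂ : ℕ → ℕ
  log₂ M = largest (λ i → 2 ^ i ≤? M) M

  module _ {M : ℕ} (1≤M : 1 ≤ M) where

    private instance
      _ = >-nonZero 1≤M

    fifthRoot-lower : fifthRoot M ^ 5 ≤ M ^ 3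
    fifthRoot-lower = largest-holds (λ t → t ^ 5 ≤? M ^ 3) z≤n M

    1≤fifthRoot : 1 ≤ fifthRoot M
    1≤fifthRoot = largest-greatest (λ t → t ^ 5 ≤? M ^ 3) 1≤M (m^n>0 M 3)

    fifthRoot-upper : M * M * M < suc (fifthRoot M) ^ 5
    fifthRoot-upper = subst (_< suc T ^ 5) (id₁ M) M³<
      where
      T = fifthRoot M
      id₁ : ∀ M → M * (M * (M * 1)) ≡ M * M * M
      id₁ = solve-∀
      M³< : M ^ 3 < suc T ^ 5
      M³< with suc T ≤? M
      ... | yes 1+T≤M = ≰⇒> λ h → <-irrefl refl (largest-greatest (λ t → t ^ 5 ≤? M ^ 3) 1+T≤M h)
      -- The search ended at its limit, so `M ≤ T`, and `M³ ≤ M⁵ < (T + 1)⁵` holds directly.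
      ... | no  1+T≰M = ≤-<-trans (^-monoʳ-≤ M (m≤m+n 3 2)) (^-monoˡ-< 5 (≰⇒> 1+T≰M))

    log₂-lower : 2 ^ log₂ M ≤ M
    log₂-lower = largest-holds (λ i → 2 ^ i ≤? M) 1≤M M

    log₂-upper : M ≤ 2 ^ suc (log₂ M)
    log₂-upper with suc (log₂ M) ≤? M
    ... | yes 1+λ≤M = <⇒≤ (≰⇒> λ h → <-irrefl refl (largest-greatest (λ i → 2 ^ i ≤? M) 1+λ≤M h))
    ... | no  1+λ≰M = ≤-trans (<⇒≤ (≰⇒> 1+λ≰M)) (<⇒≤ (n<2^n (suc (log₂ M))))
      where
      n<2^n : ∀ n → n < 2 ^ n
      n<2^n zero    = z<s
      n<2^n (suc n) = +-mono-≤-< (m^n>0 2 n) (subst (n <_) (sym (+-identityʳ (2 ^ n))) (n<2^n n))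

  1≤log₂ : ∀ {M} → 2 ≤ M → 1 ≤ log₂ M
  1≤log₂ {M} 2≤M = largest-greatest (λ i → 2 ^ i ≤? M) (≤-trans (s≤s z≤n) 2≤M) 2≤M

  abstract
    -- Two cases, two solutions per code, the residues of a code, and `3 ^ 9` from replacing
    -- `suc (suc ℓ)` by `3 * ℓ`. It is sealed so that the number is not unfolded.
    constant : ℕ
    constant = 2 * (2 * length residues) * 3 ^ 9

    constant≡ : constant ≡ 2 * (2 * length residues) * 3 ^ 9
    constant≡ = refl

  count-≤ : ∀ {M xs} → 2 ≤ M → Unique xs → All (λ (x , y , z) → PowerfulSum M x y z) xs →
    length xs ≤ constant * (fifthRoot M * log₂ M ^ 12)
  count-≤ {M} {xs} 2≤M uniq powerful = subst (λ C → length xs ≤ C * (T * ℓ ^ 12)) (sym constant≡)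
    (collect (length residues) (3 ^ 9) (count-powerful {M} {T} {suc ℓ} (fifthRoot-upper 1≤M)
      (≤-trans (largest≤ (λ t → t ^ 5 ≤? M ^ 3) M) (log₂-upper 1≤M)) uniq powerful) 2+ℓ≤)
    where
    open ≤-Reasoning
    T = fifthRoot M
    ℓ = log₂ M
    1≤M = ≤-trans (s≤s z≤n) 2≤M
    collect : ∀ R c {N S L} → N ≤ 2 * (2 * R * (T * S)) → S ≤ c * L → N ≤ 2 * (2 * R) * c * (T * L)
    collect R c {N} {S} {L} N≤ S≤ = begin
      N                             ≤⟨ N≤ ⟩
      2 * (2 * R * (T * S))         ≤⟨ *-monoʳ-≤ 2 (*-monoʳ-≤ (2 * R) (*-monoʳ-≤ T S≤)) ⟩
      2 * (2 * R * (T * (c * L)))   ≡⟨ id₁ R T c L ⟩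
      2 * (2 * R) * c * (T * L)     ∎
      where
      id₁ : ∀ R T a b → 2 * (2 * R * (T * (a * b))) ≡ 2 * (2 * R) * a * (T * b)
      id₁ = solve-∀
    -- The range of the tuples is `2 ^ suc ℓ`, hence `suc (suc ℓ)`. Since `ℓ ≥ 1`, this is at most
    -- `3 * ℓ`, and the ninth power of `ℓ` may be raised to the twelfth.
    2+ℓ≤ : suc (suc ℓ) ^ 9 ≤ 3 ^ 9 * ℓ ^ 12
    2+ℓ≤ = begin
      suc (suc ℓ) ^ 9      ≤⟨ ^-monoˡ-≤ 9 (≤-trans (≤-reflexive (+-comm 2 ℓ)) (+-monoʳ-≤ ℓ (*-monoʳ-≤ 2 (1≤log₂ 2≤M)))) ⟩
      (3 * ℓ) ^ 9          ≡⟨ ^-*-distribℕ 3 ℓ 9 ⟩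
      3 ^ 9 * ℓ ^ 9        ≤⟨ *-monoʳ-≤ (3 ^ 9) (^-monoʳ-≤ ℓ {{>-nonZero (1≤log₂ 2≤M)}} (m≤m+n 9 3)) ⟩
      3 ^ 9 * ℓ ^ 12       ∎

-- Comparison with the real fifth root and logarithm.

module RealBounds where

  open import Data.Rational
  open import Data.Rational.Properties
  open import Data.Rational.Solver using (module +-*-Solver)
  open import Algebra.Definitions.RawSemiring +-*-rawSemiring using (_^_)
  open import Defs
  open Powerful

  fromℕℚ-+ : ∀ m n → fromℕℚ (m ℕ.+ n) ≡ fromℕℚ m + fromℕℚ n
  fromℕℚ-+ zero    n = sym (+-identityˡ (fromℕℚ n))
  fromℕℚ-+ (suc m) n = begin
    fromℕℚ (suc (m ℕ.+ n))          ≡⟨ fromℕℚ-suc (m ℕ.+ n) ⟩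
    1ℚ + fromℕℚ (m ℕ.+ n)           ≡⟨ cong (1ℚ +_) (fromℕℚ-+ m n) ⟩
    1ℚ + (fromℕℚ m + fromℕℚ n)      ≡⟨ +-assoc 1ℚ (fromℕℚ m) (fromℕℚ n) ⟨
    1ℚ + fromℕℚ m + fromℕℚ n        ≡⟨ cong (_+ fromℕℚ n) (fromℕℚ-suc m) ⟨
    fromℕℚ (suc m) + fromℕℚ n       ∎
    where open ≡-Reasoning

  fromℕℚ-* : ∀ m n → fromℕℚ (m ℕ.* n) ≡ fromℕℚ m * fromℕℚ n
  fromℕℚ-* zero    n = sym (*-zeroˡ (fromℕℚ n))
  fromℕℚ-* (suc m) n = begin
    fromℕℚ (n ℕ.+ m ℕ.* n)                ≡⟨ fromℕℚ-+ n (m ℕ.* n) ⟩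
    fromℕℚ n + fromℕℚ (m ℕ.* n)           ≡⟨ cong (fromℕℚ n +_) (fromℕℚ-* m n) ⟩
    fromℕℚ n + fromℕℚ m * fromℕℚ n        ≡⟨ solve 2 (λ x y → y :+ x :* y := (con 1ℚ :+ x) :* y) refl (fromℕℚ m) (fromℕℚ n) ⟩
    (1ℚ + fromℕℚ m) * fromℕℚ n            ≡⟨ cong (_* fromℕℚ n) (fromℕℚ-suc m) ⟨
    fromℕℚ (suc m) * fromℕℚ n             ∎
    where
    open ≡-Reasoning
    open +-*-Solver

  fromℕℚ-^ : ∀ m k → fromℕℚ (m ℕ.^ k) ≡ fromℕℚ m ^ k
  fromℕℚ-^ m zero    = refl
  fromℕℚ-^ m (suc k) = trans (fromℕℚ-* m (m ℕ.^ k)) (cong (fromℕℚ m *_) (fromℕℚ-^ m k))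

  fromℕℚ-mono : ∀ {m n} → m ℕ.≤ n → fromℕℚ m ≤ fromℕℚ n
  fromℕℚ-mono {m} {n} m≤n = ≤-by (fromℕℚ (n ℕ.∸ m)) (0≤fromℕℚ (n ℕ.∸ m))
    (trans (sym (fromℕℚ-+ m (n ℕ.∸ m))) (cong fromℕℚ (ℕ.m+[n∸m]≡n m≤n)))

  *-^-distrib : ∀ p q k → (p * q) ^ k ≡ p ^ k * q ^ k
  *-^-distrib p q zero    = refl
  *-^-distrib p q (suc k) = trans (cong (p * q *_) (*-^-distrib p q k))
    (solve 4 (λ p q x y → p :* q :* (x :* y) := p :* x :* (q :* y)) refl p q (p ^ k) (q ^ k))
    where open +-*-Solver

  seq-^ : ∀ x k n → ℝ.seq (x ^ℝ k) n ≡ ℝ.seq x n ^ k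
  seq-^ x zero    n = refl
  seq-^ x (suc k) n = cong (ℝ.seq x n *_) (seq-^ x k n)

  ¼ : ℚ
  ¼ = ½ * ½

  4ℚ : ℚ
  4ℚ = fromℕℚ 4

  0≤¼ : 0ℚ ≤ ¼
  0≤¼ = 0≤* 0≤½ 0≤½

  4*¼ : ∀ p → 4ℚ * (¼ * p) ≡ p
  4*¼ p = trans (sym (*-assoc 4ℚ ¼ p)) (*-identityˡ p)

  -- The numbers 3/2 · 2^ℓ.
  growth : ℕ → ℚ
  growth zero    = 1ℚ + ½
  growth (suc ℓ) = growth ℓ + growth ℓ

  1≤growth : ∀ ℓ → 1ℚ ≤ growth ℓ
  1≤growth zero    = ≤-by ½ 0≤½ refl
  1≤growth (suc ℓ) = ≤-trans (1≤growth ℓ) (≤-by (growth ℓ) (≤-trans 0≤1 (1≤growth ℓ)) refl)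

  -- The summand `½` pays for the tolerance with which `M ≤ B` is known at a finite index. Equality
  -- at `ℓ = 0` explains the starting value `3/2`.
  growth≤2^ : ∀ ℓ → growth ℓ + ½ ≤ fromℕℚ (2 ℕ.^ suc ℓ)
  growth≤2^ zero    = ≤-refl
  growth≤2^ (suc ℓ) = begin
    growth ℓ + growth ℓ + ½                ≤⟨ ≤-by ½ 0≤½ (solve 2 (λ g h → g :+ g :+ h :+ h := (g :+ h) :+ (g :+ h)) refl (growth ℓ) ½) ⟩
    (growth ℓ + ½) + (growth ℓ + ½)        ≤⟨ +-mono-≤ (growth≤2^ ℓ) (growth≤2^ ℓ) ⟩
    fromℕℚ x + fromℕℚ x                    ≡⟨ fromℕℚ-+ x x ⟨
    fromℕℚ (x ℕ.+ x)                       ≡⟨ cong (λ t → fromℕℚ (x ℕ.+ t)) (ℕ.+-identityʳ x) ⟨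
    fromℕℚ (2 ℕ.^ suc (suc ℓ))             ∎
    where
    open ≤-Reasoning
    open +-*-Solver
    x = 2 ℕ.^ suc ℓ

  -- The rectangle of width `w` under `1 / t` with right end `s`, which is the coarsest lower sum.
  -- Its area is at least `1/4` once `w` is at least `s / 4`.
  ¼≤w*recip : ∀ {s w} → 1ℚ ≤ s → s ≤ 4ℚ * w → ¼ ≤ w * recip s
  ¼≤w*recip {s} {w} 1≤s s≤4w = begin
    ¼                          ≡⟨ *-identityʳ ¼ ⟨
    ¼ * 1ℚ                     ≡⟨ cong (¼ *_) (recip-inverse s) ⟨
    ¼ * (recip s * (1ℚ ⊔ s))   ≡⟨ cong (λ t → ¼ * (recip s * t)) (p≤q⇒p⊔q≡q 1≤s) ⟩
    ¼ * (recip s * s)          ≤⟨ *-monoˡ 0≤¼ (*-monoˡ (0≤recip s) s≤4w) ⟩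
    ¼ * (recip s * (4ℚ * w))   ≡⟨ solve 4 (λ a r b w → a :* (r :* (b :* w)) := b :* (a :* (w :* r))) refl ¼ (recip s) 4ℚ w ⟩
    4ℚ * (¼ * (w * recip s))   ≡⟨ 4*¼ (w * recip s) ⟩
    w * recip s                ∎
    where
    open ≤-Reasoning
    open +-*-Solver

  -- The left half of a long interval is still long, and the right half contributes
  -- at least 1/4.
  L-growth : ∀ ℓ a w n → 1ℚ ≤ a → 0ℚ ≤ w → growth ℓ * a ≤ a + w → ℓ ℕ.≤ n → ¼ * fromℕℚ (suc ℓ) ≤ L a w n
  L-growth zero a w n 1≤a 0≤w h _ = ≤-trans (¼≤w*recip {a + w} {w} 1≤a+w a+w≤4w) (L-lower a w n 0≤w)
    where
    open +-*-Solver
    1≤a+w : 1ℚ ≤ a + w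
    1≤a+w = ≤-trans 1≤a (≤-by w 0≤w refl)
    ½a≤w : ½ * a ≤ w
    ½a≤w = +-cancelˡ-≤′ a (subst (_≤ a + w) (solve 2 (λ e a → (con 1ℚ :+ e) :* a := a :+ e :* a) refl ½ a) h)
      where
      +-cancelˡ-≤′ : ∀ r {p q} → r + p ≤ r + q → p ≤ q
      +-cancelˡ-≤′ r {p} {q} k = subst₂ _≤_ (lemma p) (lemma q) (+-monoʳ-≤ (- r) k)
        where
        lemma : ∀ p → - r + (r + p) ≡ p
        lemma p = solve 2 (λ r p → :- r :+ (r :+ p) := p) refl r p
    a+w≤4w : a + w ≤ 4ℚ * w
    a+w≤4w = begin
      a + w                      ≡⟨ cong (_+ w) (½w+½w≡w a) ⟨
      ½ * a + ½ * a + w          ≤⟨ +-monoˡ-≤ w (+-mono-≤ ½a≤w ½a≤w) ⟩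
      w + w + w                  ≤⟨ ≤-by w 0≤w (solve 1 (λ w → w :+ w :+ w :+ w := con 4ℚ :* w) refl w) ⟩
      4ℚ * w                     ∎
      where open ≤-Reasoning
  -- One bisection is spent per doubling, hence `ℓ ≤ n`. The left half satisfies the hypothesis for
  -- `ℓ` because `a + e` is `½ (a + w)` plus `½ a`.
  L-growth (suc ℓ) a w (suc n) 1≤a 0≤w h (ℕ.s≤s ℓ≤n) = begin
    ¼ * fromℕℚ (suc (suc ℓ))           ≡⟨ cong (¼ *_) (fromℕℚ-suc (suc ℓ)) ⟩
    ¼ * (1ℚ + fromℕℚ (suc ℓ))          ≡⟨ solve 2 (λ q x → q :* (con 1ℚ :+ x) := q :* x :+ q) refl ¼ (fromℕℚ (suc ℓ)) ⟩
    ¼ * fromℕℚ (suc ℓ) + ¼             ≤⟨ +-mono-≤ (L-growth ℓ a e n 1≤a 0≤e left ℓ≤n)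
                                            (≤-trans (¼≤w*recip {a + e + e} {e} 1≤a+e+e right) (L-lower (a + e) e n 0≤e)) ⟩
    L a e n + L (a + e) e n            ∎
    where
    open ≤-Reasoning
    open +-*-Solver
    e = ½ * w
    g = growth ℓ
    0≤a = ≤-trans 0≤1 1≤a
    0≤e = 0≤* 0≤½ 0≤w
    1≤a+e+e : 1ℚ ≤ a + e + e
    1≤a+e+e = subst (1ℚ ≤_) (sym (a+½w+½w≡a+w a w)) (≤-trans 1≤a (≤-by w 0≤w refl))
    left : g * a ≤ a + e
    left = begin
      g * a                        ≡⟨ ½w+½w≡w (g * a) ⟨
      ½ * (g * a) + ½ * (g * a)    ≡⟨ solve 3 (λ h g a → h :* (g :* a) :+ h :* (g :* a) := h :* ((g :+ g) :* a)) refl ½ g a ⟩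
      ½ * ((g + g) * a)            ≤⟨ *-monoˡ 0≤½ h ⟩
      ½ * (a + w)                  ≤⟨ ≤-by (½ * a) (0≤* 0≤½ 0≤a) (solve 3 (λ h a w → h :* (a :+ w) :+ h :* a := (h :* a :+ h :* a) :+ h :* w) refl ½ a w) ⟩
      ½ * a + ½ * a + e            ≡⟨ cong (_+ e) (½w+½w≡w a) ⟩
      a + e                        ∎
    a≤w : a ≤ w
    a≤w = subst₂ _≤_ (solve 1 (λ a → :- a :+ (a :+ a) := a) refl a) (solve 2 (λ a w → :- a :+ (a :+ w) := w) refl a w)
      (+-monoʳ-≤ (- a) (begin
        a + a            ≡⟨ cong₂ _+_ (*-identityˡ a) (*-identityˡ a) ⟨
        1ℚ * a + 1ℚ * a  ≤⟨ +-mono-≤ (*-monoʳ 0≤a (1≤growth ℓ)) (*-monoʳ 0≤a (1≤growth ℓ)) ⟩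
        g * a + g * a    ≡⟨ *-distribʳ-+ a g g ⟨
        (g + g) * a      ≤⟨ h ⟩
        a + w            ∎))
    right : a + e + e ≤ 4ℚ * e
    right = begin
      a + e + e          ≡⟨ a+½w+½w≡a+w a w ⟩
      a + w              ≤⟨ +-monoˡ-≤ w a≤w ⟩
      w + w              ≡⟨ cong₂ _+_ (½w+½w≡w w) (½w+½w≡w w) ⟨
      (e + e) + (e + e)  ≡⟨ solve 1 (λ e → (e :+ e) :+ (e :+ e) := con 4ℚ :* e) refl e ⟩
      4ℚ * e             ∎

  -- The interval from 1 to the approximation of `B` contains the one from 1 to `growth ℓ`, and each
  -- of its `suc ℓ` dyadic pieces contributes `1/4`. It is applied with `suc ℓ = log₂ M`.
  log⁺-lower : ∀ {B M ℓ n} → 2 ℕ.^ suc ℓ ℕ.≤ M → fromℕℚ M ≤ ℝ.seq B n + ½ → ℓ ℕ.≤ n →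
    fromℕℚ (suc ℓ) ≤ 4ℚ * ℝ.seq (log⁺ B) n
  log⁺-lower {B} {M} {ℓ} {n} 2^≤M M≤B+½ ℓ≤n = subst (_≤ 4ℚ * ℝ.seq (log⁺ B) n) (4*¼ (fromℕℚ (suc ℓ)))
    (*-monoˡ (0≤fromℕℚ 4) (L-growth ℓ 1ℚ (q - 1ℚ) n ≤-refl 0≤q-1 long ℓ≤n))
    where
    open +-*-Solver
    q = 1ℚ ⊔ ℝ.seq B n
    0≤q-1 : 0ℚ ≤ q - 1ℚ
    0≤q-1 = +-monoˡ-≤ (- 1ℚ) (p≤p⊔q 1ℚ (ℝ.seq B n))
    cancel½ : growth ℓ ≤ ℝ.seq B n
    cancel½ = subst₂ _≤_ (lemma (growth ℓ)) (lemma (ℝ.seq B n))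
      (+-monoˡ-≤ (- ½) (≤-trans (growth≤2^ ℓ) (≤-trans (fromℕℚ-mono 2^≤M) M≤B+½)))
      where
      lemma : ∀ p → p + ½ + - ½ ≡ p
      lemma p = trans (+-assoc p ½ (- ½)) (+-identityʳ p)
    long : growth ℓ * 1ℚ ≤ 1ℚ + (q - 1ℚ)
    long = begin
      growth ℓ * 1ℚ      ≡⟨ *-identityʳ (growth ℓ) ⟩
      growth ℓ           ≤⟨ cancel½ ⟩
      ℝ.seq B n          ≤⟨ p≤q⊔p 1ℚ (ℝ.seq B n) ⟩
      q                  ≡⟨ solve 1 (λ q → q := con 1ℚ :+ (q :- con 1ℚ)) refl q ⟩
      1ℚ + (q - 1ℚ)      ∎
      where open ≤-Reasoning

  -- As `M ≥ 1`, the tolerance `½` leaves at least `M / 2`, and `(T / 2)⁵ ≤ (M / 2)³`. So the right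
  -- end of the bisection interval for the root is at least `T / 2`; late enough the interval is
  -- shorter than or equal to `1/4 ≤ T / 4`, and the left end keeps `T / 4`.
  root-lower : ∀ B {M T} N₁ → 1 ℕ.≤ M → 1 ℕ.≤ T → T ℕ.^ 5 ℕ.≤ M ℕ.^ 3 → (∀ n → N₁ ℕ.≤ n → fromℕℚ M ≤ ℝ.seq B n + ½) →
    ∃ λ N₂ → ∀ n → N₂ ℕ.≤ n → fromℕℚ T ≤ 4ℚ * ℝ.seq (root 5 (B ^ℝ 3)) n
  root-lower B {M} {T} N₁ 1≤M 1≤T T⁵≤M³ M≤B+½ =
    let D , 0<D , N₂ , q≤D = bounded (maxℝ 0ℚ (B ^ℝ 3))
        N₃ , small = *½^n-small (1ℚ + D) ¼ (0<* 0<½ 0<½)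
    in N₁ ℕ.⊔ (N₂ ℕ.⊔ N₃) , λ n N≤n →
      let N₂₃≤n = ℕ.m⊔n≤o⇒n≤o N₁ (N₂ ℕ.⊔ N₃) N≤n in
      bound D n (M≤B+½ n (ℕ.m⊔n≤o⇒m≤o N₁ (N₂ ℕ.⊔ N₃) N≤n))
        (q≤D n (ℕ.m⊔n≤o⇒m≤o N₂ N₃ N₂₃≤n)) (small n (ℕ.m⊔n≤o⇒n≤o N₂ N₃ N₂₃≤n))
    where
    open ≤-Reasoning
    open +-*-Solver
    M′ = fromℕℚ M
    T′ = fromℕℚ T
    bound : ∀ D n → M′ ≤ ℝ.seq B n + ½ → ∣ ℝ.seq (maxℝ 0ℚ (B ^ℝ 3)) n ∣ ≤ D → (1ℚ + D) * ½ ^ n ≤ ¼ →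
      T′ ≤ 4ℚ * ℝ.seq (root 5 (B ^ℝ 3)) n
    bound D n M≤b+½ ∣q∣≤D w≤ = begin
      T′                 ≡⟨ 4*¼ T′ ⟨
      4ℚ * (¼ * T′)      ≤⟨ *-monoˡ (0≤fromℕℚ 4) ¼T≤r ⟩
      4ℚ * r             ∎
      where
      b = ℝ.seq B n
      q = ℝ.seq (maxℝ 0ℚ (B ^ℝ 3)) n
      0≤q : 0ℚ ≤ q
      0≤q = p≤p⊔q 0ℚ (ℝ.seq (B ^ℝ 3) n)
      r = rootℚ 5 q n
      bounds = rootℚ-bounds 4 0≤q n
      0≤r = proj₁ bounds
      w = width 4 0≤q n
      0≤w = 0≤width 4 0≤q n
      w≤¼ : w ≤ ¼
      w≤¼ = ≤-trans (*-monoʳ (0≤^ n 0≤½) (+-monoʳ-≤ 1ℚ (subst (_≤ D) (0≤p⇒∣p∣≡p 0≤q) ∣q∣≤D))) w≤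
      ½M≤b : ½ * M′ ≤ b
      ½M≤b = subst (½ * M′ ≤_) (trans (+-assoc b ½ (- ½)) (+-identityʳ b)) (begin
        ½ * M′                 ≡⟨ solve 2 (λ h x → h :* x := h :* x :+ h :* con 1ℚ :- h) refl ½ M′ ⟩
        ½ * M′ + ½ * 1ℚ - ½    ≤⟨ +-monoˡ-≤ (- ½) (+-monoʳ-≤ (½ * M′) (*-monoˡ 0≤½ (fromℕℚ-mono 1≤M))) ⟩
        ½ * M′ + ½ * M′ - ½    ≡⟨ cong (λ t → t - ½) (½w+½w≡w M′) ⟩
        M′ - ½                 ≤⟨ +-monoˡ-≤ (- ½) M≤b+½ ⟩
        b + ½ - ½              ∎)
      [½T]⁵≤q : (½ * T′) ^ 5 ≤ q
      [½T]⁵≤q = begin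
        (½ * T′) ^ 5           ≡⟨ *-^-distrib ½ T′ 5 ⟩
        ½ ^ 5 * T′ ^ 5         ≤⟨ *-mono (0≤^ 5 0≤½) (0≤^ 3 (0≤fromℕℚ M)) (½^-anti (ℕ.m≤m+n 3 2))
                                    (subst₂ _≤_ (fromℕℚ-^ T 5) (fromℕℚ-^ M 3) (fromℕℚ-mono T⁵≤M³)) ⟩
        ½ ^ 3 * M′ ^ 3         ≡⟨ *-^-distrib ½ M′ 3 ⟨
        (½ * M′) ^ 3           ≤⟨ ^-mono 3 (0≤* 0≤½ (0≤fromℕℚ M)) ½M≤b ⟩
        b ^ 3                  ≡⟨ seq-^ B 3 n ⟨
        ℝ.seq (B ^ℝ 3) n       ≤⟨ p≤q⊔p 0ℚ (ℝ.seq (B ^ℝ 3) n) ⟩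
        q                      ∎
      ½T≤r+w : ½ * T′ ≤ r + w
      ½T≤r+w = ^-cancel 5 (0≤+ 0≤r 0≤w) (≤-<-trans [½T]⁵≤q (proj₂ (proj₂ bounds)))
      ¼T≤r : ¼ * T′ ≤ r
      ¼T≤r = subst (¼ * T′ ≤_) (trans (+-assoc r ¼ (- ¼)) (+-identityʳ r)) (begin
        ¼ * T′                    ≡⟨ solve 2 (λ c x → c :* x := c :* x :+ c :* con 1ℚ :- c) refl ¼ T′ ⟩
        ¼ * T′ + ¼ * 1ℚ - ¼       ≤⟨ +-monoˡ-≤ (- ¼) (+-monoʳ-≤ (¼ * T′) (*-monoˡ 0≤¼ (fromℕℚ-mono 1≤T))) ⟩
        ¼ * T′ + ¼ * T′ - ¼       ≡⟨ cong (λ t → t - ¼) (trans (sym (*-distribʳ-+ T′ ¼ ¼)) refl) ⟩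
        ½ * T′ - ¼                ≤⟨ +-monoˡ-≤ (- ¼) (≤-trans ½T≤r+w (+-monoʳ-≤ r w≤¼)) ⟩
        r + ¼ - ¼                 ∎)

  -- The maximum of 2 and all `z` in the list replaces `B` by an integer below it without taking an
  -- integer part of a real number. Starting at 2 ensures `log₂ M ≥ 1`.
  upperBound : ∀ B → fromℕ 2 ≤ℝ B → (xs : List (ℕ × ℕ × ℕ)) → (∀ {p} → p ∈ xs → fromℕ (proj₂ (proj₂ p)) ≤ℝ B) →
    ∃ λ M → 2 ℕ.≤ M × fromℕ M ≤ℝ B × All (λ p → proj₂ (proj₂ p) ℕ.≤ M) xs
  upperBound B 2≤B [] _ = 2 , ℕ.≤-refl , 2≤B , []
  upperBound B 2≤B (p ∷ xs) h =
    let M , 2≤M , M≤B , xs≤M = upperBound B 2≤B xs (λ x∈ → h (there x∈)) in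
    extend M 2≤M M≤B xs≤M (ℕ.≤-total (proj₂ (proj₂ p)) M)
    where
    extend : ∀ M → 2 ℕ.≤ M → fromℕ M ≤ℝ B → All (λ p → proj₂ (proj₂ p) ℕ.≤ M) xs →
      proj₂ (proj₂ p) ℕ.≤ M ⊎ M ℕ.≤ proj₂ (proj₂ p) →
      ∃ λ M → 2 ℕ.≤ M × fromℕ M ≤ℝ B × All (λ p → proj₂ (proj₂ p) ℕ.≤ M) (p ∷ xs)
    extend M 2≤M M≤B xs≤M (inj₁ z≤M) = M , 2≤M , M≤B , z≤M ∷ xs≤M
    extend M 2≤M M≤B xs≤M (inj₂ M≤z) = proj₂ (proj₂ p) , ℕ.≤-trans 2≤M M≤z , h (here refl) ,
      ℕ.≤-refl ∷ All.map (λ ≤M → ℕ.≤-trans ≤M M≤z) xs≤M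

  -- One factor 4 is lost for the root and one for each of the twelve logarithms; `suc` makes
  -- positivity immediate.
  K : ℚ
  K = fromℕℚ (suc constant) * (4ℚ * 4ℚ ^ 12)

  0<K : 0ℚ < K
  0<K = 0<* (subst (0ℚ <_) (sym (fromℕℚ-suc constant)) (<-≤-trans 0<1 (≤-by (fromℕℚ constant) (0≤fromℕℚ constant) refl)))
    (0<* 0<4 (0<^ 12 0<4))
    where
    0<4 : 0ℚ < 4ℚ
    0<4 = toWitness {a? = 0ℚ <? 4ℚ} _

  0<ℝK : fromℕ 0 <ℝ fromℚ K
  0<ℝK = K , 0<K , 0 , λ _ _ → ≤-reflexive (+-identityˡ K)

  N₁-bound : (B : ℝ) → fromℕ 2 ≤ℝ B → ∀ N → N₁ B N → fromℕ N ≤ℝ fromℚ K *ℝ root 5 (B ^ℝ 3) *ℝ log⁺ B ^ℝ 12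
  N₁-bound B 2≤B N (xs , uniq , iff , refl) ε 0<ε =
    let M , 2≤M , M≤B , xs≤M = upperBound B 2≤B xs λ x∈ → Admissible.z≤B (Equivalence.to (iff _) x∈)
        N₁ , M≤B+½ = M≤B ½ 0<½
        1≤M = ℕ.≤-trans (ℕ.s≤s ℕ.z≤n) 2≤M
        N₂ , T≤4r = root-lower B {M} {fifthRoot M} N₁ 1≤M (1≤fifthRoot 1≤M) (fifthRoot-lower 1≤M) M≤B+½
        count = count-≤ 2≤M uniq (All.tabulate λ {p} x∈ → powerful M p (All.lookup xs≤M x∈) (Equivalence.to (iff p) x∈))
    -- Beyond this index the height is approximated to within `½`, the root has converged well
    -- enough, and the logarithm has one bisection for each doubling. The estimate is then exact,
    -- and `ε` is added only at the end.
    in N₁ ℕ.⊔ (N₂ ℕ.⊔ log₂ M) , λ n N≤n →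
      let N₂₃≤n = ℕ.m⊔n≤o⇒n≤o N₁ (N₂ ℕ.⊔ log₂ M) N≤n in
      ≤-trans (collect n (fifthRoot M) (log₂ M) (length xs) count
        (T≤4r n (ℕ.m⊔n≤o⇒m≤o N₂ (log₂ M) N₂₃≤n))
        (log-bound n M 2≤M (M≤B+½ n (ℕ.m⊔n≤o⇒m≤o N₁ (N₂ ℕ.⊔ log₂ M) N≤n)) (ℕ.m⊔n≤o⇒n≤o N₂ (log₂ M) N₂₃≤n)))
        (≤-by ε (<⇒≤ 0<ε) refl)
    where
    powerful : ∀ M p → proj₂ (proj₂ p) ℕ.≤ M → Admissible B (proj₁ p) (proj₁ (proj₂ p)) (proj₂ (proj₂ p)) →
      PowerfulSum M (proj₁ p) (proj₁ (proj₂ p)) (proj₂ (proj₂ p))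
    powerful M p z≤M a = record { 0<x = x-positive ; 0<y = y-positive ; 0<z = z-positive ; coprime = coprime ; sum = sum
      ; z≤M = z≤M ; x-squareful = x-squareful ; y-squareful = y-squareful ; z-squareful = z-squareful }
      where open Admissible a
    log-bound : ∀ n M → 2 ℕ.≤ M → fromℕℚ M ≤ ℝ.seq B n + ½ → log₂ M ℕ.≤ n → fromℕℚ (log₂ M) ≤ 4ℚ * ℝ.seq (log⁺ B) n
    log-bound n M 2≤M M≤ log≤n = subst (λ ℓ → fromℕℚ ℓ ≤ 4ℚ * ℝ.seq (log⁺ B) n) suc-pred
      (log⁺-lower {B} {M} {ℕ.pred (log₂ M)} {n}
        (subst (λ ℓ → 2 ℕ.^ ℓ ℕ.≤ M) (sym suc-pred) (log₂-lower (ℕ.≤-trans (ℕ.s≤s ℕ.z≤n) 2≤M)))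
        M≤ (ℕ.≤-trans ℕ.pred[n]≤n log≤n))
      where
      suc-pred : suc (ℕ.pred (log₂ M)) ≡ log₂ M
      suc-pred = ℕ.suc-pred (log₂ M) {{ℕ.>-nonZero (1≤log₂ 2≤M)}}
    collect : ∀ n T ℓ N → N ℕ.≤ constant ℕ.* (T ℕ.* ℓ ℕ.^ 12) →
      fromℕℚ T ≤ 4ℚ * ℝ.seq (root 5 (B ^ℝ 3)) n → fromℕℚ ℓ ≤ 4ℚ * ℝ.seq (log⁺ B) n →
      fromℕℚ N ≤ K * ℝ.seq (root 5 (B ^ℝ 3)) n * ℝ.seq (log⁺ B ^ℝ 12) n
    collect n T ℓ N N≤ T≤ ℓ≤ = begin
      fromℕℚ N                                              ≤⟨ fromℕℚ-mono (ℕ.≤-trans N≤ (ℕ.*-monoˡ-≤ (T ℕ.* ℓ ℕ.^ 12) (ℕ.n≤1+n constant))) ⟩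
      fromℕℚ (suc constant ℕ.* (T ℕ.* ℓ ℕ.^ 12))            ≡⟨ fromℕℚ-* (suc constant) (T ℕ.* ℓ ℕ.^ 12) ⟩
      C * fromℕℚ (T ℕ.* ℓ ℕ.^ 12)                           ≡⟨ cong (C *_) (trans (fromℕℚ-* T (ℓ ℕ.^ 12)) (cong (fromℕℚ T *_) (fromℕℚ-^ ℓ 12))) ⟩
      C * (fromℕℚ T * fromℕℚ ℓ ^ 12)
        ≤⟨ *-monoˡ (0≤fromℕℚ (suc constant)) (*-mono (0≤fromℕℚ T) (0≤^ 12 (≤-trans (0≤fromℕℚ ℓ) ℓ≤)) T≤ (^-mono 12 (0≤fromℕℚ ℓ) ℓ≤)) ⟩
      C * (4ℚ * r * (4ℚ * l) ^ 12)                          ≡⟨ cong (λ t → C * (4ℚ * r * t)) (*-^-distrib 4ℚ l 12) ⟩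
      C * (4ℚ * r * (4ℚ ^ 12 * l ^ 12))                     ≡⟨ solve 5 (λ c f r g x → c :* (f :* r :* (g :* x)) := c :* (f :* g) :* r :* x) refl C 4ℚ r (4ℚ ^ 12) (l ^ 12) ⟩
      K * r * l ^ 12                                        ≡⟨ cong (K * r *_) (seq-^ (log⁺ B) 12 n) ⟨
      K * r * ℝ.seq (log⁺ B ^ℝ 12) n                        ∎
      where
      open ≤-Reasoning
      open +-*-Solver
      C = fromℕℚ (suc constant)
      r = ℝ.seq (root 5 (B ^ℝ 3)) n
      l = ℝ.seq (log⁺ B) n

open RealBounds using (K; 0<ℝK; N₁-bound)

theorem2 : ∃ λ (K : ℝ) → fromℕ 0 <ℝ K ×
    ((B : ℝ) → fromℕ 2 ≤ℝ B → ∀ N → N₁ B N →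
    fromℕ N ≤ℝ K *ℝ root 5 (B ^ℝ 3) *ℝ log⁺ B ^ℝ 12)
theorem2 = fromℚ K , 0<ℝK , N₁-bound
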